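{- Let $n$ be a positive integer, $R=\mathbb{Z}[\frac1{3n}]$ and $V=R[x,y]/(x^n,y^3-xy)$, with $R$-basis $\{x^iy^j: 0\le i\le n-1,\ 0\le j\le2\}$. Let $\mu_V\colon V\otimes V\to V$ be the multiplication, $\eta_V\colon R\to V$, $r\mapsto r$, the unit, $\epsilon_V\colon V\to R$ the $R$-linear map with $\epsilon_V(x^{n-1}y^2)=3n$ and zero on all other basis vectors, let $$\Delta_V(v)=-\frac1{3n}\sum_{\substack{i+j=n\\ i,j>0}}(v\cdot x^i)\otimes x^j+\frac1{3n}\sum_{i+j=n-1}\Big((v\cdot x^iy^2)\otimes x^j+(v\cdot x^iy)\otimes x^jy+(v\cdot x^i)\otimes x^jy^2\Big)$$ for $v\in V$ (sums over nonnegative integers $i,j$), and let $$m_V(v)=\begin{cases}v\cdot x^{(n-2)/2}y^2&n\text{ even},\\ v\cdot x^{(n-1)/2}y&n\text{ odd}.\end{cases}$$ Then $(V,\mu_V,\eta_V,\Delta_V,\epsilon_V,m_V)$ is a Möbius Frobenius algebra in $R\mathbf{Mod}$.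
   Context: $R\mathbf{Mod}$ is the symmetric monoidal category of finite-rank free $R$-modules with $\otimes=\otimes_R$. A Möbius Frobenius algebra in a braided monoidal category is a 6-tuple $(A,\mu_A,\eta_A,\Delta_A,\epsilon_A,m_A)$ where $(A,\mu_A,\eta_A,\Delta_A,\epsilon_A)$ (multiplication, unit, comultiplication, counit) is a commutative Frobenius algebra and $m_A\colon A\to A$ is a morphism with $\mu_A\circ(m_A\otimes\mathrm{id}_A)=m_A\circ\mu_A=\mu_A\circ(\mathrm{id}_A\otimes m_A)$ and $\mu_A\circ\Delta_A\circ m_A=m_A^3$. -}

module Defs where

open import Algebra.Bundles using (CommutativeRing; CommutativeMonoid)
open import Algebra.Module.Bundles using (LeftModule)
open import Algebra.Module.Morphism.Structures using (module LeftModuleMorphisms)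
open import Algebra.Module.Structures using (IsLeftModule)
open import Algebra.Morphism.Structures using (IsRingHomomorphism)
open import Algebra.Structures using (IsCommutativeRing)
open import Data.Bool.Base using (true; false; if_then_else_; _∧_)
open import Data.Fin.Base as Fin using (Fin; zero; suc; toℕ; _↑ˡ_; _↑ʳ_; remQuot; combine)
open import Data.Integer.Base as ℤ using (ℤ; +_)
open import Data.Integer.Solver using (module +-*-Solver)
open import Data.List.Base using (List; []; _∷_)
open import Data.Nat.Base as ℕ using (ℕ; zero; suc; NonZero; _∸_; _/_; _%_; _≡ᵇ_)
open import Data.Product.Base using (∃; _,_; proj₁; proj₂; uncurry)
open import Level using (Level; 0ℓ; _⊔_) renaming (suc to lsuc)
open import Relation.Binary.PropositionalEquality as ≡ using (_≡_; cong)
open import Relation.Binary.Structures using (IsEquivalence)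
open import Relation.Nullary using (does; yes; no; contradiction)

import Algebra.Module.Construct.TensorUnit as TensorUnit
import Algebra.Properties.CommutativeMonoid.Sum as Sum
import Algebra.Properties.CommutativeSemigroup as CommutativeSemigroupProperties
import Algebra.Properties.Group as GroupProperties
import Algebra.Properties.Ring as RingProperties
import Algebra.Properties.Semiring.Exp as Exp
import Algebra.Properties.Semiring.Sum as SemiringSum
import Algebra.Solver.Ring.NaturalCoefficients.Default as NaturalCoefficients
import Data.Fin.Properties as Fin
import Data.Integer.Properties as ℤ
import Data.Nat.Properties as ℕ
import Relation.Binary.Reasoning.Setoid as SetoidReasoning

private
  variable
    o ℓ e : Level

record Category (o ℓ e : Level) : Set (lsuc (o ⊔ ℓ ⊔ e)) where
  infix  4 _⇒_ _≈_
  infixr 9 _∘_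

  field
    Obj : Set o
    _⇒_ : Obj → Obj → Set ℓ
    _≈_ : ∀ {A B} → A ⇒ B → A ⇒ B → Set e
    id  : ∀ {A} → A ⇒ A
    _∘_ : ∀ {A B C} → B ⇒ C → A ⇒ B → A ⇒ C

    equiv     : ∀ {A B} → IsEquivalence (_≈_ {A} {B})
    ∘-resp-≈  : ∀ {A B C} {f h : B ⇒ C} {g i : A ⇒ B} → f ≈ h → g ≈ i → f ∘ g ≈ h ∘ i
    assoc     : ∀ {A B C D} (f : A ⇒ B) (g : B ⇒ C) (h : C ⇒ D) → (h ∘ g) ∘ f ≈ h ∘ (g ∘ f)
    identityˡ : ∀ {A B} (f : A ⇒ B) → id ∘ f ≈ f
    identityʳ : ∀ {A B} (f : A ⇒ B) → f ∘ id ≈ f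

record Monoidal (C : Category o ℓ e) : Set (o ⊔ ℓ ⊔ e) where
  open Category C
  infixr 10 _⊗₀_ _⊗₁_

  field
    unit : Obj
    _⊗₀_ : Obj → Obj → Obj
    _⊗₁_ : ∀ {A B C D} → A ⇒ B → C ⇒ D → A ⊗₀ C ⇒ B ⊗₀ D

    ⊗-resp-≈       : ∀ {A B C D} {f h : A ⇒ B} {g i : C ⇒ D} → f ≈ h → g ≈ i → f ⊗₁ g ≈ h ⊗₁ i
    ⊗-identity     : ∀ {A B} → id {A} ⊗₁ id {B} ≈ id
    ⊗-homomorphism : ∀ {A B C D E F} (f : A ⇒ B) (g : B ⇒ C) (h : D ⇒ E) (i : E ⇒ F) →
                     (g ∘ f) ⊗₁ (i ∘ h) ≈ (g ⊗₁ i) ∘ (f ⊗₁ h)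

    λ⇒ : ∀ {A} → unit ⊗₀ A ⇒ A
    λ⇐ : ∀ {A} → A ⇒ unit ⊗₀ A
    ρ⇒ : ∀ {A} → A ⊗₀ unit ⇒ A
    ρ⇐ : ∀ {A} → A ⇒ A ⊗₀ unit
    α⇒ : ∀ {A B C} → (A ⊗₀ B) ⊗₀ C ⇒ A ⊗₀ (B ⊗₀ C)
    α⇐ : ∀ {A B C} → A ⊗₀ (B ⊗₀ C) ⇒ (A ⊗₀ B) ⊗₀ C

    λ-isoˡ : ∀ {A} → λ⇐ ∘ λ⇒ ≈ id {unit ⊗₀ A}
    λ-isoʳ : ∀ {A} → λ⇒ ∘ λ⇐ ≈ id {A}
    ρ-isoˡ : ∀ {A} → ρ⇐ ∘ ρ⇒ ≈ id {A ⊗₀ unit}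
    ρ-isoʳ : ∀ {A} → ρ⇒ ∘ ρ⇐ ≈ id {A}
    α-isoˡ : ∀ {A B C} → α⇐ ∘ α⇒ ≈ id {(A ⊗₀ B) ⊗₀ C}
    α-isoʳ : ∀ {A B C} → α⇒ ∘ α⇐ ≈ id {A ⊗₀ (B ⊗₀ C)}

    λ-natural : ∀ {A B} (f : A ⇒ B) → λ⇒ ∘ (id ⊗₁ f) ≈ f ∘ λ⇒
    ρ-natural : ∀ {A B} (f : A ⇒ B) → ρ⇒ ∘ (f ⊗₁ id) ≈ f ∘ ρ⇒
    α-natural : ∀ {A B C D E F} (f : A ⇒ B) (g : C ⇒ D) (h : E ⇒ F) →
                α⇒ ∘ ((f ⊗₁ g) ⊗₁ h) ≈ (f ⊗₁ (g ⊗₁ h)) ∘ α⇒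

    triangle : ∀ {A B} → (id ⊗₁ λ⇒) ∘ α⇒ ≈ ρ⇒ {A} ⊗₁ id {B}
    pentagon : ∀ {A B C D} →
               (id ⊗₁ α⇒) ∘ α⇒ ∘ (α⇒ ⊗₁ id) ≈ α⇒ ∘ α⇒ {A ⊗₀ B} {C} {D}

record Braided {C : Category o ℓ e} (M : Monoidal C) : Set (o ⊔ ℓ ⊔ e) where
  open Category C
  open Monoidal M

  field
    σ⇒ : ∀ {A B} → A ⊗₀ B ⇒ B ⊗₀ A
    σ⇐ : ∀ {A B} → B ⊗₀ A ⇒ A ⊗₀ B

    σ-isoˡ    : ∀ {A B} → σ⇐ ∘ σ⇒ ≈ id {A ⊗₀ B}
    σ-isoʳ    : ∀ {A B} → σ⇒ ∘ σ⇐ ≈ id {B ⊗₀ A}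
    σ-natural : ∀ {A B C D} (f : A ⇒ B) (g : C ⇒ D) → σ⇒ ∘ (f ⊗₁ g) ≈ (g ⊗₁ f) ∘ σ⇒

    hexagon₁ : ∀ {A B C} → (id ⊗₁ σ⇒) ∘ α⇒ ∘ (σ⇒ ⊗₁ id) ≈ α⇒ ∘ σ⇒ ∘ α⇒ {A} {B} {C}
    hexagon₂ : ∀ {A B C} → (σ⇒ ⊗₁ id) ∘ α⇐ ∘ (id ⊗₁ σ⇒) ≈ α⇐ ∘ σ⇒ ∘ α⇐ {A} {B} {C}

record Symmetric {C : Category o ℓ e} (M : Monoidal C) : Set (o ⊔ ℓ ⊔ e) where
  field
    braided : Braided M

  open Category C
  open Monoidal M
  open Braided braided public

  field
    involutive : ∀ {A B} → σ⇒ ∘ σ⇒ ≈ id {A ⊗₀ B}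

module _ {C : Category o ℓ e} {M : Monoidal C} (B : Braided M) where
  open Category C
  open Monoidal M
  open Braided B

  record IsFrobeniusAlgebra (A : Obj)
    (μ : A ⊗₀ A ⇒ A) (η : unit ⇒ A) (Δ : A ⇒ A ⊗₀ A) (ε : A ⇒ unit) : Set e where
    field
      μ-assoc     : μ ∘ (μ ⊗₁ id) ≈ μ ∘ (id ⊗₁ μ) ∘ α⇒
      μ-identityˡ : μ ∘ (η ⊗₁ id) ≈ λ⇒
      μ-identityʳ : μ ∘ (id ⊗₁ η) ≈ ρ⇒

      Δ-coassoc     : α⇒ ∘ (Δ ⊗₁ id) ∘ Δ ≈ (id ⊗₁ Δ) ∘ Δ
      Δ-coidentityˡ : (ε ⊗₁ id) ∘ Δ ≈ λ⇐
      Δ-coidentityʳ : (id ⊗₁ ε) ∘ Δ ≈ ρ⇐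

      frobeniusˡ : (id ⊗₁ μ) ∘ α⇒ ∘ (Δ ⊗₁ id) ≈ Δ ∘ μ
      frobeniusʳ : (μ ⊗₁ id) ∘ α⇐ ∘ (id ⊗₁ Δ) ≈ Δ ∘ μ

  record IsCommutativeFrobeniusAlgebra (A : Obj)
    (μ : A ⊗₀ A ⇒ A) (η : unit ⇒ A) (Δ : A ⇒ A ⊗₀ A) (ε : A ⇒ unit) : Set e where
    field
      isFrobeniusAlgebra : IsFrobeniusAlgebra A μ η Δ ε
      μ-comm             : μ ∘ σ⇒ ≈ μ

  record IsMöbiusFrobeniusAlgebra (A : Obj)
    (μ : A ⊗₀ A ⇒ A) (η : unit ⇒ A) (Δ : A ⇒ A ⊗₀ A) (ε : A ⇒ unit) (m : A ⇒ A) : Set e where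
    field
      isCommutativeFrobeniusAlgebra : IsCommutativeFrobeniusAlgebra A μ η Δ ε
      m-μˡ   : μ ∘ (m ⊗₁ id) ≈ m ∘ μ
      m-μʳ   : m ∘ μ ≈ μ ∘ (id ⊗₁ m)
      möbius : μ ∘ Δ ∘ m ≈ m ∘ m ∘ m
-- Since R is commutative, left R-modules are the same thing as R-modules.

module FreeModules (R : CommutativeRing 0ℓ 0ℓ) where
  private module R = CommutativeRing R

  Mod : Set₁
  Mod = LeftModule R.ring 0ℓ 0ℓ

  infix 4 _⟶_

  record _⟶_ (M N : Mod) : Set where
    private
      module M = LeftModule M
      module N = LeftModule N
    open LeftModuleMorphisms M.rawLeftModule N.rawLeftModule
    field
      to                       : M.Carrierᴹ → N.Carrierᴹ
      isLeftModuleHomomorphism : IsLeftModuleHomomorphism to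
    open IsLeftModuleHomomorphism isLeftModuleHomomorphism public

  open _⟶_ using (to)

  module _ {M N : Mod} where
    private
      module M = LeftModule M
      module N = LeftModule N
    open GroupProperties N.+ᴹ-group using (inverseˡ-unique)

    open LeftModuleMorphisms M.rawLeftModule N.rawLeftModule using (IsLeftModuleHomomorphism)

    abstract
      isLinear : (f : M.Carrierᴹ → N.Carrierᴹ) →
                 (∀ {x y} → x M.≈ᴹ y → f x N.≈ᴹ f y) →
                 (∀ x y → f (x M.+ᴹ y) N.≈ᴹ f x N.+ᴹ f y) →
                 (∀ r x → f (r M.*ₗ x) N.≈ᴹ r N.*ₗ f x) →
                 IsLeftModuleHomomorphism f
      isLinear f f-cong f-+ f-* = record
        { +ᴹ-isGroupHomomorphism = record
          { isMonoidHomomorphism = record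
            { isMagmaHomomorphism = record
              { isRelHomomorphism = record { cong = f-cong }
              ; homo              = f-+
              }
            ; ε-homo = f-0
            }
          ; ⁻¹-homo = λ x → inverseˡ-unique _ _
              (N.≈ᴹ-trans (N.≈ᴹ-sym (f-+ _ _)) (N.≈ᴹ-trans (f-cong (M.-ᴹ‿inverseˡ x)) f-0))
          }
        ; *ₗ-homo = f-*
        }
        where
        f-0 : f M.0ᴹ N.≈ᴹ N.0ᴹ
        f-0 = N.≈ᴹ-trans (f-cong (M.≈ᴹ-sym (M.*ₗ-zeroˡ M.0ᴹ)))
                (N.≈ᴹ-trans (f-* R.0# M.0ᴹ) (N.*ₗ-zeroˡ (f M.0ᴹ)))

    linear : (f : M.Carrierᴹ → N.Carrierᴹ) →
             (∀ {x y} → x M.≈ᴹ y → f x N.≈ᴹ f y) →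
             (∀ x y → f (x M.+ᴹ y) N.≈ᴹ f x N.+ᴹ f y) →
             (∀ r x → f (r M.*ₗ x) N.≈ᴹ r N.*ₗ f x) →
             M ⟶ N
    linear f f-cong f-+ f-* = record
      { to                       = f
      ; isLeftModuleHomomorphism = isLinear f f-cong f-+ f-*
      }

    infix 4 _≈ₕ_

    _≈ₕ_ : M ⟶ N → M ⟶ N → Set
    f ≈ₕ g = ∀ x → to f x N.≈ᴹ to g x

    ≈ₕ-isEquivalence : IsEquivalence _≈ₕ_
    ≈ₕ-isEquivalence = record
      { refl  = λ _ → N.≈ᴹ-refl
      ; sym   = λ p x → N.≈ᴹ-sym (p x)
      ; trans = λ p q x → N.≈ᴹ-trans (p x) (q x)
      }

  idₕ : ∀ {M} → M ⟶ M
  idₕ {M} = linear (λ x → x) (λ p → p) (λ _ _ → ≈ᴹ-refl) (λ _ _ → ≈ᴹ-refl)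
    where open LeftModule M

  infixr 9 _∘ₕ_

  _∘ₕ_ : ∀ {M N P} → N ⟶ P → M ⟶ N → M ⟶ P
  _∘ₕ_ {P = P} g f = linear (λ x → g.to (f.to x))
    (λ p → g.⟦⟧-cong (f.⟦⟧-cong p))
    (λ x y → ≈ᴹ-trans (g.⟦⟧-cong (f.+ᴹ-homo x y)) (g.+ᴹ-homo _ _))
    (λ r x → ≈ᴹ-trans (g.⟦⟧-cong (f.*ₗ-homo r x)) (g.*ₗ-homo r _))
    where
    module g = _⟶_ g
    module f = _⟶_ f
    open LeftModule P

  module Combination (M : Mod) where
    open LeftModule M
    open Sum +ᴹ-commutativeMonoid public

    open CommutativeSemigroupProperties
      (CommutativeMonoid.commutativeSemigroup +ᴹ-commutativeMonoid) public
      using () renaming (interchange to +-interchange)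

    *ₗ-distribˡ-sum : ∀ {k} r (v : Fin k → Carrierᴹ) → r *ₗ sum v ≈ᴹ sum (λ i → r *ₗ v i)
    *ₗ-distribˡ-sum {zero}  r v = *ₗ-zeroʳ r
    *ₗ-distribˡ-sum {suc k} r v =
      ≈ᴹ-trans (*ₗ-distribˡ r _ _) (+ᴹ-congˡ (*ₗ-distribˡ-sum r (λ i → v (suc i))))

    linComb : ∀ {k} → (Fin k → R.Carrier) → (Fin k → Carrierᴹ) → Carrierᴹ
    linComb c v = sum (λ i → c i *ₗ v i)

    linComb-congˡ : ∀ {k} {c d : Fin k → R.Carrier} (v : Fin k → Carrierᴹ) →
                    (∀ i → c i R.≈ d i) → linComb c v ≈ᴹ linComb d v
    linComb-congˡ v p = sum-cong-≋ (λ i → *ₗ-congʳ (p i))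

    linComb-+ : ∀ {k} (c d : Fin k → R.Carrier) (v : Fin k → Carrierᴹ) →
                linComb (λ i → c i R.+ d i) v ≈ᴹ linComb c v +ᴹ linComb d v
    linComb-+ c d v = ≈ᴹ-trans (sum-cong-≋ (λ i → *ₗ-distribʳ (v i) (c i) (d i)))
                               (∑-distrib-+ (λ i → c i *ₗ v i) (λ i → d i *ₗ v i))

    linComb-* : ∀ {k} r (c : Fin k → R.Carrier) (v : Fin k → Carrierᴹ) →
                linComb (λ i → r R.* c i) v ≈ᴹ r *ₗ linComb c v
    linComb-* r c v = ≈ᴹ-trans (sum-cong-≋ (λ i → *ₗ-assoc r (c i) (v i)))
                               (≈ᴹ-sym (*ₗ-distribˡ-sum r (λ i → c i *ₗ v i)))

    sum-splitAt : ∀ m {k} (f : Fin (m ℕ.+ k) → Carrierᴹ) →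
                  sum f ≈ᴹ sum (λ i → f (i ↑ˡ k)) +ᴹ sum (λ j → f (m ↑ʳ j))
    sum-splitAt zero    f = ≈ᴹ-sym (+ᴹ-identityˡ _)
    sum-splitAt (suc m) f =
      ≈ᴹ-trans (+ᴹ-congˡ (sum-splitAt m (λ i → f (suc i)))) (≈ᴹ-sym (+ᴹ-assoc _ _ _))

    sum-remQuot : ∀ m {k} (f : Fin m → Fin k → Carrierᴹ) →
                  sum (λ l → uncurry f (remQuot {m} k l)) ≈ᴹ sum (λ i → sum (f i))
    sum-remQuot zero        f = ≈ᴹ-refl
    sum-remQuot (suc m) {k} f =
      ≈ᴹ-trans (sum-splitAt k (λ l → uncurry f (remQuot {suc m} k l)))
        (+ᴹ-cong (≈ᴹ-reflexive (sum-cong-≗ left))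
          (≈ᴹ-trans (≈ᴹ-reflexive (sum-cong-≗ right)) (sum-remQuot m (λ i → f (suc i)))))
      where
      left : ∀ i → uncurry f (remQuot {suc m} k (i ↑ˡ (m ℕ.* k))) ≡ f zero i
      left i rewrite Fin.splitAt-↑ˡ k i (m ℕ.* k) = ≡.refl
      right : ∀ j → uncurry f (remQuot {suc m} k (k ↑ʳ j)) ≡ uncurry (λ i → f (suc i)) (remQuot {m} k j)
      right j rewrite Fin.splitAt-↑ʳ k (m ℕ.* k) j = ≡.refl

  to-sum : ∀ {M N : Mod} (f : M ⟶ N) {k} (v : Fin k → LeftModule.Carrierᴹ M) →
           LeftModule._≈ᴹ_ N (to f (Combination.sum M v)) (Combination.sum N (λ i → to f (v i)))
  to-sum         f {zero}  v = _⟶_.0ᴹ-homo f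
  to-sum {N = N} f {suc k} v =
    ≈ᴹ-trans (_⟶_.+ᴹ-homo f _ _) (+ᴹ-congˡ (to-sum f (λ i → v (suc i))))
    where open LeftModule N

  record Basis (M : Mod) : Set where
    open LeftModule M
    open Combination M
    field
      rank      : ℕ
      basis     : Fin rank → Carrierᴹ
      coords    : Carrierᴹ → Fin rank → R.Carrier
      expansion : ∀ v → v ≈ᴹ linComb (coords v) basis
      unique    : ∀ v c → v ≈ᴹ linComb c basis → ∀ i → c i R.≈ coords v i

    module _ {v w : Carrierᴹ} where
      coords-cong : v ≈ᴹ w → ∀ i → coords v i R.≈ coords w i
      coords-cong p = unique w (coords v) (≈ᴹ-trans (≈ᴹ-sym p) (expansion v))

      coords-+ : ∀ i → coords (v +ᴹ w) i R.≈ coords v i R.+ coords w i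
      coords-+ i = R.sym (unique (v +ᴹ w) (λ j → coords v j R.+ coords w j)
        (≈ᴹ-trans (+ᴹ-cong (expansion v) (expansion w)) (≈ᴹ-sym (linComb-+ (coords v) (coords w) basis))) i)

    coords-* : ∀ r v i → coords (r *ₗ v) i R.≈ r R.* coords v i
    coords-* r v i = R.sym (unique (r *ₗ v) (λ j → r R.* coords v j)
      (≈ᴹ-trans (*ₗ-congˡ (expansion v)) (≈ᴹ-sym (linComb-* r (coords v) basis))) i)

  -- The linear map with prescribed values on a basis.

  extend : ∀ {M} (B : Basis M) (N : Mod) → (Fin (Basis.rank B) → LeftModule.Carrierᴹ N) → M ⟶ N
  extend B N f = linear (λ v → linComb (coords v) f)
    (λ p → linComb-congˡ f (coords-cong p))
    (λ v w → ≈ᴹ-trans (linComb-congˡ f coords-+) (linComb-+ (coords v) (coords w) f))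
    (λ r v → ≈ᴹ-trans (linComb-congˡ f (coords-* r v)) (linComb-* r (coords v) f))
    where
    open LeftModule N
    open Combination N
    open Basis B

  record FreeModule : Set₁ where
    field
      mod      : Mod
      hasBasis : Basis mod

  R-module : Mod
  R-module = TensorUnit.leftModule

  δ : ∀ {k} → Fin k → Fin k → R.Carrier
  δ i j = if does (i Fin.≟ j) then R.1# else R.0#

  private module CR = Combination R-module

  sum-δ : ∀ {k} (c : Fin k → R.Carrier) i → CR.sum (λ j → c j R.* δ i j) R.≈ c i
  sum-δ {suc k} c zero = R.trans
    (R.+-cong (R.*-identityʳ (c zero))
      (R.trans (CR.sum-cong-≋ (λ j → R.zeroʳ (c (suc j)))) (CR.sum-replicate-zero k)))
    (R.+-identityʳ (c zero))
  sum-δ {suc k} c (suc i) = R.trans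
    (R.+-cong (R.zeroʳ (c zero)) (sum-δ (λ j → c (suc j)) i))
    (R.+-identityˡ (c (suc i)))

  -- A basis indexed by pairs, given with its dual basis.

  module _ (M : Mod) (m k : ℕ) where
    open LeftModule M
    open Combination M
    open SetoidReasoning R.setoid

    private
      δ-remQuot : ∀ (l l′ : Fin (m ℕ.* k)) →
        δ (proj₁ (remQuot {m} k l)) (proj₁ (remQuot {m} k l′)) R.*
        δ (proj₂ (remQuot {m} k l)) (proj₂ (remQuot {m} k l′)) R.≈ δ l l′
      δ-remQuot l l′
        with proj₁ (remQuot {m} k l) Fin.≟ proj₁ (remQuot {m} k l′)
           | proj₂ (remQuot {m} k l) Fin.≟ proj₂ (remQuot {m} k l′)
           | l Fin.≟ l′
      ... | yes _ | yes _ | yes _    = R.*-identityˡ _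
      ... | no  _ | _     | no  _    = R.zeroˡ _
      ... | yes _ | no _  | no  _    = R.zeroʳ _
      ... | no ≢  | _     | yes ≡.refl = contradiction ≡.refl ≢
      ... | yes _ | no ≢  | yes ≡.refl = contradiction ≡.refl ≢
      ... | yes p | yes q | no l≢l′  = contradiction
        (≡.trans (≡.sym (Fin.combine-remQuot {m} k l))
          (≡.trans (≡.cong₂ combine p q) (Fin.combine-remQuot {m} k l′))) l≢l′

    module _ (b : Fin m → Fin k → Carrierᴹ) (b* : Fin m → Fin k → M ⟶ R-module)
      (dual : ∀ i j i′ j′ → to (b* i j) (b i′ j′) R.≈ δ i i′ R.* δ j j′)
      (expand : ∀ v → v ≈ᴹ sum (λ i → sum (λ j → to (b* i j) v *ₗ b i j))) where
      private
        b′ : Fin (m ℕ.* k) → Carrierᴹ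
        b′ l = uncurry b (remQuot {m} k l)

        b*′ : Fin (m ℕ.* k) → M ⟶ R-module
        b*′ l = uncurry b* (remQuot {m} k l)

        abstract
          b′-expansion : ∀ v → v ≈ᴹ linComb (λ l → to (b*′ l) v) b′
          b′-expansion v = ≈ᴹ-trans (expand v) (≈ᴹ-sym (sum-remQuot m (λ i j → to (b* i j) v *ₗ b i j)))

          b′-unique : ∀ v c → v ≈ᴹ linComb c b′ → ∀ l → c l R.≈ to (b*′ l) v
          b′-unique v c v≈ l = R.sym (begin
            to (b*′ l) v
              ≈⟨ _⟶_.⟦⟧-cong (b*′ l) v≈ ⟩
            to (b*′ l) (linComb c b′)
              ≈⟨ to-sum (b*′ l) {m ℕ.* k} (λ l′ → c l′ *ₗ b′ l′) ⟩
            CR.sum (λ l′ → to (b*′ l) (c l′ *ₗ b′ l′))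
              ≈⟨ CR.sum-cong-≋ {m ℕ.* k} (λ l′ → R.trans (_⟶_.*ₗ-homo (b*′ l) (c l′) (b′ l′))
                   (R.*-congˡ (R.trans (dual _ _ _ _) (δ-remQuot l l′)))) ⟩
            CR.sum (λ l′ → c l′ R.* δ l l′)
              ≈⟨ sum-δ c l ⟩
            c l ∎)

      productBasis : Basis M
      productBasis = record
        { rank      = m ℕ.* k
        ; basis     = b′
        ; coords    = λ v l → to (b*′ l) v
        ; expansion = b′-expansion
        ; unique    = b′-unique
        }

  -- The internal hom of modules.

  module InternalHom (M N : Mod) where
    open LeftModule N
    open Combination N using (+-interchange)

    0ₕ : M ⟶ N
    0ₕ = linear (λ _ → 0ᴹ) (λ _ → ≈ᴹ-refl) (λ _ _ → ≈ᴹ-sym (+ᴹ-identityʳ 0ᴹ)) (λ r _ → ≈ᴹ-sym (*ₗ-zeroʳ r))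

    infixl 6 _+ₕ_
    infixr 7 _*ₕ_

    _+ₕ_ : M ⟶ N → M ⟶ N → M ⟶ N
    f +ₕ g = linear (λ x → f.to x +ᴹ g.to x)
      (λ p → +ᴹ-cong (f.⟦⟧-cong p) (g.⟦⟧-cong p))
      (λ x y → ≈ᴹ-trans (+ᴹ-cong (f.+ᴹ-homo x y) (g.+ᴹ-homo x y)) (+-interchange _ _ _ _))
      (λ r x → ≈ᴹ-trans (+ᴹ-cong (f.*ₗ-homo r x) (g.*ₗ-homo r x)) (≈ᴹ-sym (*ₗ-distribˡ r _ _)))
      where
      module f = _⟶_ f
      module g = _⟶_ g

    _*ₕ_ : R.Carrier → M ⟶ N → M ⟶ N
    r *ₕ f = linear (λ x → r *ₗ f.to x)
      (λ p → *ₗ-congˡ (f.⟦⟧-cong p))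
      (λ x y → ≈ᴹ-trans (*ₗ-congˡ (f.+ᴹ-homo x y)) (*ₗ-distribˡ r _ _))
      (λ s x → ≈ᴹ-trans (*ₗ-congˡ (f.*ₗ-homo s x))
        (≈ᴹ-trans (≈ᴹ-sym (*ₗ-assoc r s _))
          (≈ᴹ-trans (*ₗ-congʳ (R.*-comm r s)) (*ₗ-assoc s r _))))
      where module f = _⟶_ f

    private
      abstract
        -1*-inverseˡ : ∀ x → (R.- R.1#) *ₗ x +ᴹ x ≈ᴹ 0ᴹ
        -1*-inverseˡ x = ≈ᴹ-trans (+ᴹ-congˡ (≈ᴹ-sym (*ₗ-identityˡ x)))
          (≈ᴹ-trans (≈ᴹ-sym (*ₗ-distribʳ x (R.- R.1#) R.1#))
            (≈ᴹ-trans (*ₗ-congʳ (R.-‿inverseˡ R.1#)) (*ₗ-zeroˡ x)))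

        isLeftModule-hom : IsLeftModule R.ring (_≈ₕ_ {M} {N}) _+ₕ_ 0ₕ ((R.- R.1#) *ₕ_) _*ₕ_
        isLeftModule-hom = record
          { isLeftSemimodule = record
            { +ᴹ-isCommutativeMonoid = record
              { isMonoid = record
                { isSemigroup = record
                  { isMagma = record
                    { isEquivalence = ≈ₕ-isEquivalence
                    ; ∙-cong        = λ p q x → +ᴹ-cong (p x) (q x)
                    }
                  ; assoc = λ f g h x → +ᴹ-assoc _ _ _
                  }
                ; identity = (λ f x → +ᴹ-identityˡ _) , (λ f x → +ᴹ-identityʳ _)
                }
              ; comm = λ f g x → +ᴹ-comm _ _
              }
            ; isPreleftSemimodule = record
              { *ₗ-cong      = λ p q x → *ₗ-cong p (q x)
              ; *ₗ-zeroˡ     = λ f x → *ₗ-zeroˡ _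
              ; *ₗ-distribʳ  = λ f r s x → *ₗ-distribʳ _ r s
              ; *ₗ-identityˡ = λ f x → *ₗ-identityˡ _
              ; *ₗ-assoc     = λ r s f x → *ₗ-assoc r s _
              ; *ₗ-zeroʳ     = λ r x → *ₗ-zeroʳ r
              ; *ₗ-distribˡ  = λ r f g x → *ₗ-distribˡ r _ _
              }
            }
          ; -ᴹ‿cong    = λ p x → *ₗ-congˡ (p x)
          ; -ᴹ‿inverse = (λ f x → -1*-inverseˡ _) , (λ f x → ≈ᴹ-trans (+ᴹ-comm _ _) (-1*-inverseˡ _))
          }

    homModule : Mod
    homModule = record { isLeftModule = isLeftModule-hom }

  [_,_] : Mod → Mod → Mod
  [ M , N ] = InternalHom.homModule M N

  module _ {M N P : Mod} where
    private
      module M = LeftModule M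
      module N = LeftModule N
      module P = LeftModule P

    bilinear : (f : M.Carrierᴹ → N.Carrierᴹ → P.Carrierᴹ) →
               (∀ {x x′ y y′} → x M.≈ᴹ x′ → y N.≈ᴹ y′ → f x y P.≈ᴹ f x′ y′) →
               (∀ x x′ y → f (x M.+ᴹ x′) y P.≈ᴹ f x y P.+ᴹ f x′ y) →
               (∀ r x y → f (r M.*ₗ x) y P.≈ᴹ r P.*ₗ f x y) →
               (∀ x y y′ → f x (y N.+ᴹ y′) P.≈ᴹ f x y P.+ᴹ f x y′) →
               (∀ r x y → f x (r N.*ₗ y) P.≈ᴹ r P.*ₗ f x y) →
               M ⟶ [ N , P ]
    bilinear f f-cong f-+ˡ f-*ˡ f-+ʳ f-*ʳ = linear
      (λ x → linear (f x) (f-cong M.≈ᴹ-refl) (f-+ʳ x) (λ r → f-*ʳ r x))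
      (λ p y → f-cong p N.≈ᴹ-refl) f-+ˡ f-*ˡ

  -- The tensor product, as the module generated by symbols x ⊗ y subject to bilinearity.

  module _ (M N : Mod) where
    private
      module M = LeftModule M
      module N = LeftModule N

    infix  4 _≈ₜ_
    infixl 5 _+ₜ_
    infixr 6 _*ₜ_
    infix  7 _⊗_

    data Tensor : Set where
      _⊗_  : M.Carrierᴹ → N.Carrierᴹ → Tensor
      0ₜ   : Tensor
      _+ₜ_ : Tensor → Tensor → Tensor
      _*ₜ_ : R.Carrier → Tensor → Tensor

    data _≈ₜ_ : Tensor → Tensor → Set where
      reflₜ  : ∀ {t} → t ≈ₜ t
      symₜ   : ∀ {t u} → t ≈ₜ u → u ≈ₜ t
      transₜ : ∀ {t u v} → t ≈ₜ u → u ≈ₜ v → t ≈ₜ v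

      +ₜ-cong      : ∀ {t t′ u u′} → t ≈ₜ t′ → u ≈ₜ u′ → t +ₜ u ≈ₜ t′ +ₜ u′
      +ₜ-assoc     : ∀ t u v → (t +ₜ u) +ₜ v ≈ₜ t +ₜ (u +ₜ v)
      +ₜ-comm      : ∀ t u → t +ₜ u ≈ₜ u +ₜ t
      +ₜ-identityˡ : ∀ t → 0ₜ +ₜ t ≈ₜ t
      *ₜ-cong      : ∀ {r r′ t t′} → r R.≈ r′ → t ≈ₜ t′ → r *ₜ t ≈ₜ r′ *ₜ t′
      *ₜ-zeroˡ     : ∀ t → R.0# *ₜ t ≈ₜ 0ₜ
      *ₜ-zeroʳ     : ∀ r → r *ₜ 0ₜ ≈ₜ 0ₜ
      *ₜ-distribʳ  : ∀ t r s → (r R.+ s) *ₜ t ≈ₜ r *ₜ t +ₜ s *ₜ t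
      *ₜ-distribˡ  : ∀ r t u → r *ₜ (t +ₜ u) ≈ₜ r *ₜ t +ₜ r *ₜ u
      *ₜ-identityˡ : ∀ t → R.1# *ₜ t ≈ₜ t
      *ₜ-assoc     : ∀ r s t → (r R.* s) *ₜ t ≈ₜ r *ₜ (s *ₜ t)

      ⊗-cong : ∀ {x x′ y y′} → x M.≈ᴹ x′ → y N.≈ᴹ y′ → x ⊗ y ≈ₜ x′ ⊗ y′
      ⊗-+ˡ   : ∀ x x′ y → (x M.+ᴹ x′) ⊗ y ≈ₜ x ⊗ y +ₜ x′ ⊗ y
      ⊗-*ˡ   : ∀ r x y → (r M.*ₗ x) ⊗ y ≈ₜ r *ₜ x ⊗ y
      ⊗-+ʳ   : ∀ x y y′ → x ⊗ (y N.+ᴹ y′) ≈ₜ x ⊗ y +ₜ x ⊗ y′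
      ⊗-*ʳ   : ∀ r x y → x ⊗ (r N.*ₗ y) ≈ₜ r *ₜ x ⊗ y

    private
      abstract
        inverseˡ : ∀ t → (R.- R.1#) *ₜ t +ₜ t ≈ₜ 0ₜ
        inverseˡ t = transₜ (+ₜ-cong reflₜ (symₜ (*ₜ-identityˡ t)))
          (transₜ (symₜ (*ₜ-distribʳ t (R.- R.1#) R.1#))
            (transₜ (*ₜ-cong (R.-‿inverseˡ R.1#) reflₜ) (*ₜ-zeroˡ t)))

        isLeftModule-⊗ : IsLeftModule R.ring _≈ₜ_ _+ₜ_ 0ₜ ((R.- R.1#) *ₜ_) _*ₜ_
        isLeftModule-⊗ = record
          { isLeftSemimodule = record
            { +ᴹ-isCommutativeMonoid = record
              { isMonoid = record
                { isSemigroup = record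
                  { isMagma = record
                    { isEquivalence = record { refl = reflₜ ; sym = symₜ ; trans = transₜ }
                    ; ∙-cong        = +ₜ-cong
                    }
                  ; assoc = +ₜ-assoc
                  }
                ; identity = +ₜ-identityˡ , λ t → transₜ (+ₜ-comm t 0ₜ) (+ₜ-identityˡ t)
                }
              ; comm = +ₜ-comm
              }
            ; isPreleftSemimodule = record
              { *ₗ-cong      = *ₜ-cong
              ; *ₗ-zeroˡ     = *ₜ-zeroˡ
              ; *ₗ-distribʳ  = *ₜ-distribʳ
              ; *ₗ-identityˡ = *ₜ-identityˡ
              ; *ₗ-assoc     = *ₜ-assoc
              ; *ₗ-zeroʳ     = *ₜ-zeroʳ
              ; *ₗ-distribˡ  = *ₜ-distribˡ
              }
            }
          ; -ᴹ‿cong    = *ₜ-cong R.refl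
          ; -ᴹ‿inverse = inverseˡ , λ t → transₜ (+ₜ-comm _ _) (inverseˡ t)
          }

    tensorModule : Mod
    tensorModule = record { isLeftModule = isLeftModule-⊗ }

  infixr 10 _⊗ᴹ_

  _⊗ᴹ_ : Mod → Mod → Mod
  M ⊗ᴹ N = tensorModule M N

  ⊗-bilinear : ∀ {M N} → M ⟶ [ N , M ⊗ᴹ N ]
  ⊗-bilinear = bilinear _⊗_ ⊗-cong ⊗-+ˡ ⊗-*ˡ ⊗-+ʳ ⊗-*ʳ

  module _ {M N P : Mod} where
    private
      module M = LeftModule M
      module N = LeftModule N
      module P = LeftModule P

    open Combination P using (+-interchange)

    liftFun : (M.Carrierᴹ → N.Carrierᴹ → P.Carrierᴹ) → Tensor M N → P.Carrierᴹ
    liftFun f (x ⊗ y)  = f x y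
    liftFun f 0ₜ       = P.0ᴹ
    liftFun f (t +ₜ u) = liftFun f t P.+ᴹ liftFun f u
    liftFun f (r *ₜ t) = r P.*ₗ liftFun f t

    liftFun-cong₂ : ∀ {f g} → (∀ x y → f x y P.≈ᴹ g x y) → ∀ t → liftFun f t P.≈ᴹ liftFun g t
    liftFun-cong₂ p (x ⊗ y)  = p x y
    liftFun-cong₂ p 0ₜ       = P.≈ᴹ-refl
    liftFun-cong₂ p (t +ₜ u) = P.+ᴹ-cong (liftFun-cong₂ p t) (liftFun-cong₂ p u)
    liftFun-cong₂ p (r *ₜ t) = P.*ₗ-congˡ (liftFun-cong₂ p t)

    liftFun-+ : ∀ f g t → liftFun (λ x y → f x y P.+ᴹ g x y) t P.≈ᴹ liftFun f t P.+ᴹ liftFun g t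
    liftFun-+ f g (x ⊗ y)  = P.≈ᴹ-refl
    liftFun-+ f g 0ₜ       = P.≈ᴹ-sym (P.+ᴹ-identityʳ P.0ᴹ)
    liftFun-+ f g (t +ₜ u) = P.≈ᴹ-trans (P.+ᴹ-cong (liftFun-+ f g t) (liftFun-+ f g u)) (+-interchange _ _ _ _)
    liftFun-+ f g (r *ₜ t) = P.≈ᴹ-trans (P.*ₗ-congˡ (liftFun-+ f g t)) (P.*ₗ-distribˡ r _ _)

    liftFun-* : ∀ r f t → liftFun (λ x y → r P.*ₗ f x y) t P.≈ᴹ r P.*ₗ liftFun f t
    liftFun-* r f (x ⊗ y)  = P.≈ᴹ-refl
    liftFun-* r f 0ₜ       = P.≈ᴹ-sym (P.*ₗ-zeroʳ r)
    liftFun-* r f (t +ₜ u) = P.≈ᴹ-trans (P.+ᴹ-cong (liftFun-* r f t) (liftFun-* r f u)) (P.≈ᴹ-sym (P.*ₗ-distribˡ r _ _))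
    liftFun-* r f (s *ₜ t) = P.≈ᴹ-trans (P.*ₗ-congˡ (liftFun-* r f t))
      (P.≈ᴹ-trans (P.≈ᴹ-sym (P.*ₗ-assoc s r _)) (P.≈ᴹ-trans (P.*ₗ-congʳ (R.*-comm s r)) (P.*ₗ-assoc r s _)))

    liftFun-cong : (f : M ⟶ [ N , P ]) → ∀ {t u} → _≈ₜ_ M N t u →
                   liftFun (λ x → to (to f x)) t P.≈ᴹ liftFun (λ x → to (to f x)) u
    liftFun-cong f = go
      where
      module f = _⟶_ f
      module f′ x = _⟶_ (f.to x)
      go : ∀ {t u} → _≈ₜ_ M N t u → liftFun (λ x → to (to f x)) t P.≈ᴹ liftFun (λ x → to (to f x)) u
      go reflₜ                      = P.≈ᴹ-refl
      go (symₜ p)                   = P.≈ᴹ-sym (go p)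
      go (transₜ p q)               = P.≈ᴹ-trans (go p) (go q)
      go (+ₜ-cong p q)              = P.+ᴹ-cong (go p) (go q)
      go (+ₜ-assoc t u v)           = P.+ᴹ-assoc _ _ _
      go (+ₜ-comm t u)              = P.+ᴹ-comm _ _
      go (+ₜ-identityˡ t)           = P.+ᴹ-identityˡ _
      go (*ₜ-cong p q)              = P.*ₗ-cong p (go q)
      go (*ₜ-zeroˡ t)               = P.*ₗ-zeroˡ _
      go (*ₜ-zeroʳ r)               = P.*ₗ-zeroʳ r
      go (*ₜ-distribʳ t r s)        = P.*ₗ-distribʳ _ r s
      go (*ₜ-distribˡ r t u)        = P.*ₗ-distribˡ r _ _
      go (*ₜ-identityˡ t)           = P.*ₗ-identityˡ _
      go (*ₜ-assoc r s t)           = P.*ₗ-assoc r s _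
      go (⊗-cong {x} {y′ = y′} p q) = P.≈ᴹ-trans (f′.⟦⟧-cong x q) (f.⟦⟧-cong p y′)
      go (⊗-+ˡ x x′ y)              = f.+ᴹ-homo x x′ y
      go (⊗-*ˡ r x y)               = f.*ₗ-homo r x y
      go (⊗-+ʳ x y y′)              = f′.+ᴹ-homo x y y′
      go (⊗-*ʳ r x y)               = f′.*ₗ-homo x r y

    lift : M ⟶ [ N , P ] → M ⊗ᴹ N ⟶ P
    lift f = linear (liftFun (λ x → to (to f x))) (liftFun-cong f)
      (λ _ _ → P.≈ᴹ-refl) (λ _ _ → P.≈ᴹ-refl)

    ⊗-ext : {f g : M ⊗ᴹ N ⟶ P} → (∀ x y → to f (x ⊗ y) P.≈ᴹ to g (x ⊗ y)) → f ≈ₕ g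
    ⊗-ext {f} {g} p = go
      where
      module f = _⟶_ f
      module g = _⟶_ g
      go : f ≈ₕ g
      go (x ⊗ y)  = p x y
      go 0ₜ       = P.≈ᴹ-trans f.0ᴹ-homo (P.≈ᴹ-sym g.0ᴹ-homo)
      go (t +ₜ u) = P.≈ᴹ-trans (f.+ᴹ-homo t u)
        (P.≈ᴹ-trans (P.+ᴹ-cong (go t) (go u)) (P.≈ᴹ-sym (g.+ᴹ-homo t u)))
      go (r *ₜ t) = P.≈ᴹ-trans (f.*ₗ-homo r t)
        (P.≈ᴹ-trans (P.*ₗ-congˡ (go t)) (P.≈ᴹ-sym (g.*ₗ-homo r t)))

  module _ {M N : Mod} where
    -⊗_ : LeftModule.Carrierᴹ N → M ⟶ M ⊗ᴹ N
    -⊗ y = linear (_⊗ y) (λ p → ⊗-cong p (LeftModule.≈ᴹ-refl N))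
                  (λ x x′ → ⊗-+ˡ x x′ y) (λ r x → ⊗-*ˡ r x y)

    _⊗- : LeftModule.Carrierᴹ M → N ⟶ M ⊗ᴹ N
    x ⊗- = to ⊗-bilinear x

  module _ {M N P Q : Mod} where
    private
      module Q = LeftModule Q

    ⊗-extˡ : {f g : (M ⊗ᴹ N) ⊗ᴹ P ⟶ Q} →
             (∀ x y z → to f ((x ⊗ y) ⊗ z) Q.≈ᴹ to g ((x ⊗ y) ⊗ z)) → f ≈ₕ g
    ⊗-extˡ {f} {g} p = ⊗-ext {f = f} {g} λ t z →
      ⊗-ext {f = f ∘ₕ (-⊗ z)} {g ∘ₕ (-⊗ z)} (λ x y → p x y z) t

    ⊗-extʳ : {f g : M ⊗ᴹ (N ⊗ᴹ P) ⟶ Q} →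
             (∀ x y z → to f (x ⊗ (y ⊗ z)) Q.≈ᴹ to g (x ⊗ (y ⊗ z))) → f ≈ₕ g
    ⊗-extʳ {f} {g} p = ⊗-ext {f = f} {g} λ x →
      ⊗-ext {f = f ∘ₕ (x ⊗-)} {g ∘ₕ (x ⊗-)} (λ y z → p x y z)

  ⊗-map : ∀ {M N P Q} → M ⟶ N → P ⟶ Q → M ⊗ᴹ P ⟶ N ⊗ᴹ Q
  ⊗-map {M} {N} {P} {Q} f g = lift (bilinear (λ x y → f.to x ⊗ g.to y)
    (λ p q → ⊗-cong (f.⟦⟧-cong p) (g.⟦⟧-cong q))
    (λ x x′ y → transₜ (⊗-cong (f.+ᴹ-homo x x′) Q.≈ᴹ-refl) (⊗-+ˡ _ _ _))
    (λ r x y → transₜ (⊗-cong (f.*ₗ-homo r x) Q.≈ᴹ-refl) (⊗-*ˡ _ _ _))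
    (λ x y y′ → transₜ (⊗-cong N.≈ᴹ-refl (g.+ᴹ-homo y y′)) (⊗-+ʳ _ _ _))
    (λ r x y → transₜ (⊗-cong N.≈ᴹ-refl (g.*ₗ-homo r y)) (⊗-*ʳ _ _ _)))
    where
    module N = LeftModule N
    module Q = LeftModule Q
    module f = _⟶_ f
    module g = _⟶_ g

  -- Defined on (x ⊗ y) ⊗ z by extending linearly in x ⊗ y for fixed z.

  associator : ∀ {M N P} → (M ⊗ᴹ N) ⊗ᴹ P ⟶ M ⊗ᴹ (N ⊗ᴹ P)
  associator {M} {N} {P} = lift (bilinear (λ t z → liftFun {M} {N} {T} (assoc z) t)
    (λ {t} {t′} {z} {z′} p q → transₜ (⟦⟧-cong (assocₕ z) p)
      (cong₂ {assoc z} {assoc z′} (λ x y → ⊗-cong M.≈ᴹ-refl (⊗-cong N.≈ᴹ-refl q)) t′))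
    (λ t t′ z → reflₜ)
    (λ r t z → reflₜ)
    (λ t z z′ → transₜ
      (cong₂ {assoc (z P.+ᴹ z′)} {λ x y → assoc z x y +ₜ assoc z′ x y}
        (λ x y → transₜ (⊗-cong M.≈ᴹ-refl (⊗-+ʳ y z z′)) (⊗-+ʳ x (y ⊗ z) (y ⊗ z′))) t)
      (liftFun-+ {M} {N} {T} (assoc z) (assoc z′) t))
    (λ r t z → transₜ
      (cong₂ {assoc (r P.*ₗ z)} {λ x y → r *ₜ assoc z x y}
        (λ x y → transₜ (⊗-cong M.≈ᴹ-refl (⊗-*ʳ r y z)) (⊗-*ʳ r x (y ⊗ z))) t)
      (liftFun-* {M} {N} {T} r (assoc z) t)))
    where
    module M = LeftModule M
    module N = LeftModule N
    module P = LeftModule P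
    open _⟶_ using (⟦⟧-cong)
    T : Mod
    T = M ⊗ᴹ (N ⊗ᴹ P)
    cong₂ : ∀ {f g} → (∀ x y → _≈ₜ_ M (N ⊗ᴹ P) (f x y) (g x y)) →
            ∀ t → _≈ₜ_ M (N ⊗ᴹ P) (liftFun {M} {N} {T} f t) (liftFun {M} {N} {T} g t)
    cong₂ {f} {g} = liftFun-cong₂ {M} {N} {T} {f} {g}
    assoc : P.Carrierᴹ → M.Carrierᴹ → N.Carrierᴹ → Tensor M (N ⊗ᴹ P)
    assoc z x y = x ⊗ (y ⊗ z)
    assocₕ : P.Carrierᴹ → M ⊗ᴹ N ⟶ T
    assocₕ z = lift (bilinear (assoc z)
      (λ p q → ⊗-cong p (⊗-cong q P.≈ᴹ-refl))
      (λ x x′ y → ⊗-+ˡ x x′ (y ⊗ z))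
      (λ r x y → ⊗-*ˡ r x (y ⊗ z))
      (λ x y y′ → transₜ (⊗-cong M.≈ᴹ-refl (⊗-+ˡ y y′ z)) (⊗-+ʳ x (y ⊗ z) (y′ ⊗ z)))
      (λ r x y → transₜ (⊗-cong M.≈ᴹ-refl (⊗-*ˡ r y z)) (⊗-*ʳ r x (y ⊗ z))))

  braiding : ∀ {M N} → M ⊗ᴹ N ⟶ N ⊗ᴹ M
  braiding = lift (bilinear (λ x y → y ⊗ x) (λ p q → ⊗-cong q p)
    (λ x x′ y → ⊗-+ʳ y x x′) (λ r x y → ⊗-*ʳ r y x)
    (λ x y y′ → ⊗-+ˡ y y′ x) (λ r x y → ⊗-*ˡ r y x))

  associator⁻¹ : ∀ {M N P} → M ⊗ᴹ (N ⊗ᴹ P) ⟶ (M ⊗ᴹ N) ⊗ᴹ P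
  associator⁻¹ = braiding ∘ₕ ⊗-map idₕ braiding ∘ₕ associator ∘ₕ ⊗-map braiding idₕ ∘ₕ braiding

  unitorˡ : ∀ {M} → R-module ⊗ᴹ M ⟶ M
  unitorˡ {M} = lift (bilinear _*ₗ_ *ₗ-cong (λ r s x → *ₗ-distribʳ x r s) *ₗ-assoc *ₗ-distribˡ
    (λ s r x → ≈ᴹ-trans (≈ᴹ-sym (*ₗ-assoc r s x))
      (≈ᴹ-trans (*ₗ-congʳ (R.*-comm r s)) (*ₗ-assoc s r x))))
    where open LeftModule M

  unitorʳ : ∀ {M} → M ⊗ᴹ R-module ⟶ M
  unitorʳ = unitorˡ ∘ₕ braiding

  R-basis : Basis R-module
  R-basis = record
    { rank      = 1
    ; basis     = λ _ → R.1#
    ; coords    = λ r _ → r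
    ; expansion = λ r → R.sym (R.trans (R.+-identityʳ _) (R.*-identityʳ r))
    ; unique    = λ r c r≈ → λ { zero → R.sym (R.trans r≈ (R.trans (R.+-identityʳ _) (R.*-identityʳ _))) }
    }

  coordₕ : ∀ {M} (B : Basis M) → Fin (Basis.rank B) → M ⟶ R-module
  coordₕ B i = linear (λ v → coords v i) (λ p → coords-cong p i) (λ v w → coords-+ i) (λ r v → coords-* r v i)
    where open Basis B

  coords-dual : ∀ {M} (B : Basis M) → let open Basis B in ∀ i j → coords (basis j) i R.≈ δ i j
  coords-dual {M} B i j = R.sym (unique (basis j) (λ k → δ k j) (≈ᴹ-sym (sum-δ-basis basis j)) i)
    where
    open LeftModule M
    open Combination M
    open Basis B
    sum-δ-basis : ∀ {k} (v : Fin k → Carrierᴹ) j → sum (λ i → δ i j *ₗ v i) ≈ᴹ v j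
    sum-δ-basis {suc k} v zero = ≈ᴹ-trans
      (+ᴹ-cong (*ₗ-identityˡ (v zero))
        (≈ᴹ-trans (sum-cong-≋ (λ i → *ₗ-zeroˡ (v (suc i)))) (sum-replicate-zero k)))
      (+ᴹ-identityʳ (v zero))
    sum-δ-basis {suc k} v (suc j) = ≈ᴹ-trans
      (+ᴹ-cong (*ₗ-zeroˡ (v zero)) (sum-δ-basis (λ i → v (suc i)) j))
      (+ᴹ-identityˡ (v (suc j)))

  sumₕ : ∀ {M N k} → (Fin k → M ⟶ N) → M ⟶ N
  sumₕ {N = N} {k} f = linear (λ x → sum (λ i → to (f i) x))
    (λ p → sum-cong-≋ (λ i → _⟶_.⟦⟧-cong (f i) p))
    (λ x y → ≈ᴹ-trans (sum-cong-≋ (λ i → _⟶_.+ᴹ-homo (f i) x y)) (∑-distrib-+ {k} _ _))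
    (λ r x → ≈ᴹ-trans (sum-cong-≋ (λ i → _⟶_.*ₗ-homo (f i) r x)) (≈ᴹ-sym (*ₗ-distribˡ-sum {k} r _)))
    where
    open LeftModule N
    open Combination N

  _*ₕ⟨_⟩ : ∀ {M} → M ⟶ R-module → (N : Mod) → LeftModule.Carrierᴹ N → M ⟶ N
  (φ *ₕ⟨ N ⟩) y = linear (λ x → φ.to x *ₗ y) (λ p → *ₗ-congʳ (φ.⟦⟧-cong p))
    (λ x x′ → ≈ᴹ-trans (*ₗ-congʳ (φ.+ᴹ-homo x x′)) (*ₗ-distribʳ y _ _))
    (λ r x → ≈ᴹ-trans (*ₗ-congʳ (φ.*ₗ-homo r x)) (*ₗ-assoc r _ y))
    where
    module φ = _⟶_ φ
    open LeftModule N

  ⊗-basis : ∀ {M N} → Basis M → Basis N → Basis (M ⊗ᴹ N)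
  ⊗-basis {M} {N} B C = productBasis (M ⊗ᴹ N) B.rank C.rank b b*
    (λ i j i′ j′ → R.*-cong (coords-dual B i i′) (coords-dual C j j′))
    (⊗-ext {f = idₕ} {g = sumₕ (λ i → sumₕ (λ j → (b* i j *ₕ⟨ M ⊗ᴹ N ⟩) (b i j)))} λ x y →
      transₜ (⊗-cong (B.expansion x) (C.expansion y))
        (transₜ (to-sum (-⊗ linComb (C.coords y) C.basis) {B.rank} _) (sum-cong-≋ {B.rank} λ i →
          transₜ (to-sum ((B.coords x i *ₗ B.basis i) ⊗-) {C.rank} _) (sum-cong-≋ {C.rank} λ j →
            transₜ (⊗-*ˡ _ _ _) (transₜ (*ₜ-cong R.refl (⊗-*ʳ _ _ _)) (symₜ (*ₜ-assoc _ _ _)))))))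
    where
    module B = Basis B
    module C = Basis C
    open LeftModule M using (_*ₗ_)
    open Combination N using (linComb)
    open Combination (M ⊗ᴹ N) using (sum-cong-≋)
    b : Fin B.rank → Fin C.rank → Tensor M N
    b i j = B.basis i ⊗ C.basis j
    b* : Fin B.rank → Fin C.rank → M ⊗ᴹ N ⟶ R-module
    b* i j = unitorˡ ∘ₕ ⊗-map (coordₕ B i) (coordₕ C j)

  -- The category RMod.

  private
    variable
      L M N P Q M′ N′ P′ : Mod

    ∘-cong : {f h : N ⟶ P} {g i : M ⟶ N} → f ≈ₕ h → g ≈ₕ i → f ∘ₕ g ≈ₕ h ∘ₕ i
    ∘-cong {P = P} {h = h} {g} p q x = LeftModule.≈ᴹ-trans P (p (to g x)) (_⟶_.⟦⟧-cong h (q x))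

    ⊗-map-cong : (f h : M ⟶ M′) (g i : N ⟶ N′) → f ≈ₕ h → g ≈ₕ i → ⊗-map f g ≈ₕ ⊗-map h i
    ⊗-map-cong f h g i p q = ⊗-ext {f = ⊗-map f g} {⊗-map h i} (λ x y → ⊗-cong (p x) (q y))

    ⊗-map-id : ⊗-map (idₕ {M}) (idₕ {N}) ≈ₕ idₕ
    ⊗-map-id {M} {N} = ⊗-ext {f = ⊗-map (idₕ {M}) (idₕ {N})} {idₕ} (λ _ _ → reflₜ)

    ⊗-map-∘ : (f : L ⟶ M) (g : M ⟶ N) (h : P ⟶ P′) (i : P′ ⟶ Q) →
              ⊗-map (g ∘ₕ f) (i ∘ₕ h) ≈ₕ ⊗-map g i ∘ₕ ⊗-map f h
    ⊗-map-∘ f g h i = ⊗-ext {f = ⊗-map (g ∘ₕ f) (i ∘ₕ h)} {⊗-map g i ∘ₕ ⊗-map f h} (λ _ _ → reflₜ)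

  unitorˡ⁻¹ : ∀ {M} → M ⟶ R-module ⊗ᴹ M
  unitorˡ⁻¹ = R.1# ⊗-

  unitorʳ⁻¹ : ∀ {M} → M ⟶ M ⊗ᴹ R-module
  unitorʳ⁻¹ = -⊗ R.1#

  private
    unitorˡ-isoˡ : unitorˡ⁻¹ {M} ∘ₕ unitorˡ ≈ₕ idₕ
    unitorˡ-isoˡ {M} = ⊗-ext {f = unitorˡ⁻¹ ∘ₕ unitorˡ} {idₕ} λ r x →
      transₜ (⊗-*ʳ r R.1# x) (transₜ (symₜ (⊗-*ˡ r R.1# x))
        (⊗-cong (R.*-identityʳ r) (LeftModule.≈ᴹ-refl M)))

    unitorʳ-isoˡ : unitorʳ⁻¹ {M} ∘ₕ unitorʳ ≈ₕ idₕ
    unitorʳ-isoˡ {M} = ⊗-ext {f = unitorʳ⁻¹ ∘ₕ unitorʳ} {idₕ} λ x r →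
      transₜ (⊗-*ˡ r x R.1#) (transₜ (symₜ (⊗-*ʳ r x R.1#))
        (⊗-cong (LeftModule.≈ᴹ-refl M) (R.*-identityʳ r)))

    associator-isoˡ : associator⁻¹ ∘ₕ associator {M} {N} {P} ≈ₕ idₕ
    associator-isoˡ {M} {N} {P} =
      ⊗-extˡ {f = associator⁻¹ ∘ₕ associator {M} {N} {P}} {idₕ} (λ _ _ _ → reflₜ)

    associator-isoʳ : associator ∘ₕ associator⁻¹ {M} {N} {P} ≈ₕ idₕ
    associator-isoʳ {M} {N} {P} =
      ⊗-extʳ {f = associator ∘ₕ associator⁻¹ {M} {N} {P}} {idₕ} (λ _ _ _ → reflₜ)

    unitorˡ-natural : (f : M ⟶ N) → unitorˡ ∘ₕ ⊗-map idₕ f ≈ₕ f ∘ₕ unitorˡ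
    unitorˡ-natural {N = N} f = ⊗-ext {f = unitorˡ ∘ₕ ⊗-map idₕ f} {f ∘ₕ unitorˡ}
      λ r x → LeftModule.≈ᴹ-sym N (_⟶_.*ₗ-homo f r x)

    unitorʳ-natural : (f : M ⟶ N) → unitorʳ ∘ₕ ⊗-map f idₕ ≈ₕ f ∘ₕ unitorʳ
    unitorʳ-natural {N = N} f = ⊗-ext {f = unitorʳ ∘ₕ ⊗-map f idₕ} {f ∘ₕ unitorʳ}
      λ x r → LeftModule.≈ᴹ-sym N (_⟶_.*ₗ-homo f r x)

    associator-natural : (f : M ⟶ M′) (g : N ⟶ N′) (h : P ⟶ P′) →
      associator ∘ₕ ⊗-map (⊗-map f g) h ≈ₕ ⊗-map f (⊗-map g h) ∘ₕ associator
    associator-natural f g h =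
      ⊗-extˡ {f = associator ∘ₕ ⊗-map (⊗-map f g) h} {⊗-map f (⊗-map g h) ∘ₕ associator} (λ _ _ _ → reflₜ)

    triangleₕ : ⊗-map idₕ unitorˡ ∘ₕ associator ≈ₕ ⊗-map (unitorʳ {M}) (idₕ {N})
    triangleₕ {M} {N} =
      ⊗-extˡ {f = ⊗-map idₕ unitorˡ ∘ₕ associator} {⊗-map (unitorʳ {M}) (idₕ {N})}
        λ x r y → transₜ (⊗-*ʳ r x y) (symₜ (⊗-*ˡ r x y))

    pentagonₕ : ⊗-map idₕ associator ∘ₕ associator ∘ₕ ⊗-map associator idₕ ≈ₕ
                associator ∘ₕ associator {M ⊗ᴹ N} {P} {Q}
    pentagonₕ {M} {N} {P} {Q} = ⊗-ext {f = f} {g} λ t w →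
      ⊗-extˡ {f = f ∘ₕ (-⊗ w)} {g ∘ₕ (-⊗ w)} (λ _ _ _ → reflₜ) t
      where
      f g : ((M ⊗ᴹ N) ⊗ᴹ P) ⊗ᴹ Q ⟶ M ⊗ᴹ (N ⊗ᴹ (P ⊗ᴹ Q))
      f = ⊗-map idₕ associator ∘ₕ associator ∘ₕ ⊗-map associator idₕ
      g = associator ∘ₕ associator

    braiding-natural : (f : M ⟶ M′) (g : N ⟶ N′) → braiding ∘ₕ ⊗-map f g ≈ₕ ⊗-map g f ∘ₕ braiding
    braiding-natural f g = ⊗-ext {f = braiding ∘ₕ ⊗-map f g} {⊗-map g f ∘ₕ braiding} (λ _ _ → reflₜ)

    braiding-involutive : braiding ∘ₕ braiding {M} {N} ≈ₕ idₕ
    braiding-involutive {M} {N} = ⊗-ext {f = braiding ∘ₕ braiding {M} {N}} {idₕ} (λ _ _ → reflₜ)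

    hexagon₁ₕ : ⊗-map idₕ braiding ∘ₕ associator ∘ₕ ⊗-map braiding idₕ ≈ₕ
                associator ∘ₕ braiding ∘ₕ associator {M} {N} {P}
    hexagon₁ₕ {M} {N} {P} =
      ⊗-extˡ {f = ⊗-map idₕ braiding ∘ₕ associator ∘ₕ ⊗-map braiding idₕ}
             {associator ∘ₕ braiding ∘ₕ associator {M} {N} {P}} (λ _ _ _ → reflₜ)

    hexagon₂ₕ : ⊗-map braiding idₕ ∘ₕ associator⁻¹ ∘ₕ ⊗-map idₕ braiding ≈ₕ
                associator⁻¹ ∘ₕ braiding ∘ₕ associator⁻¹ {M} {N} {P}
    hexagon₂ₕ {M} {N} {P} =
      ⊗-extʳ {f = ⊗-map braiding idₕ ∘ₕ associator⁻¹ ∘ₕ ⊗-map idₕ braiding}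
             {associator⁻¹ ∘ₕ braiding ∘ₕ associator⁻¹ {M} {N} {P}} (λ _ _ _ → reflₜ)

  RMod : Category (lsuc 0ℓ) 0ℓ 0ℓ
  RMod = record
    { Obj       = FreeModule
    ; _⇒_       = λ M N → FreeModule.mod M ⟶ FreeModule.mod N
    ; _≈_       = _≈ₕ_
    ; id        = idₕ
    ; _∘_       = _∘ₕ_
    ; equiv     = ≈ₕ-isEquivalence
    ; ∘-resp-≈  = λ {_} {_} {_} {f} {h} {g} {i} → ∘-cong {f = f} {h} {g} {i}
    ; assoc     = λ {_} {_} {_} {D} f g h x → LeftModule.≈ᴹ-refl (FreeModule.mod D)
    ; identityˡ = λ {_} {B} f x → LeftModule.≈ᴹ-refl (FreeModule.mod B)
    ; identityʳ = λ {_} {B} f x → LeftModule.≈ᴹ-refl (FreeModule.mod B)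
    }

  RMod-monoidal : Monoidal RMod
  RMod-monoidal = record
    { unit           = record { mod = R-module ; hasBasis = R-basis }
    ; _⊗₀_           = λ M N → record
      { mod      = FreeModule.mod M ⊗ᴹ FreeModule.mod N
      ; hasBasis = ⊗-basis (FreeModule.hasBasis M) (FreeModule.hasBasis N)
      }
    ; _⊗₁_           = ⊗-map
    ; ⊗-resp-≈       = λ {_} {_} {_} {_} {f} {h} {g} {i} → ⊗-map-cong f h g i
    ; ⊗-identity     = λ {A} {B} → ⊗-map-id {mod A} {mod B}
    ; ⊗-homomorphism = ⊗-map-∘
    ; λ⇒             = unitorˡ
    ; λ⇐             = unitorˡ⁻¹
    ; ρ⇒             = unitorʳ
    ; ρ⇐             = unitorʳ⁻¹
    ; α⇒             = λ {A} {B} {C} → associator {mod A} {mod B} {mod C}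
    ; α⇐             = λ {A} {B} {C} → associator⁻¹ {mod A} {mod B} {mod C}
    ; λ-isoˡ         = λ {A} → unitorˡ-isoˡ {mod A}
    ; λ-isoʳ         = λ {A} → LeftModule.*ₗ-identityˡ (mod A)
    ; ρ-isoˡ         = λ {A} → unitorʳ-isoˡ {mod A}
    ; ρ-isoʳ         = λ {A} → LeftModule.*ₗ-identityˡ (mod A)
    ; α-isoˡ         = λ {A} {B} {C} → associator-isoˡ {mod A} {mod B} {mod C}
    ; α-isoʳ         = λ {A} {B} {C} → associator-isoʳ {mod A} {mod B} {mod C}
    ; λ-natural      = unitorˡ-natural
    ; ρ-natural      = unitorʳ-natural
    ; α-natural      = associator-natural
    ; triangle       = λ {A} {B} → triangleₕ {mod A} {mod B}
    ; pentagon       = λ {A} {B} {C} {D} → pentagonₕ {mod A} {mod B} {mod C} {mod D}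
    }
    where open FreeModule

  RMod-symmetric : Symmetric RMod-monoidal
  RMod-symmetric = record
    { braided = record
      { σ⇒        = λ {A} {B} → braiding {mod A} {mod B}
      ; σ⇐        = λ {A} {B} → braiding {mod B} {mod A}
      ; σ-isoˡ    = λ {A} {B} → braiding-involutive {mod A} {mod B}
      ; σ-isoʳ    = λ {A} {B} → braiding-involutive {mod B} {mod A}
      ; σ-natural = braiding-natural
      ; hexagon₁  = λ {A} {B} {C} → hexagon₁ₕ {mod A} {mod B} {mod C}
      ; hexagon₂  = λ {A} {B} {C} → hexagon₂ₕ {mod A} {mod B} {mod C}
      }
    ; involutive = λ {A} {B} → braiding-involutive {mod A} {mod B}
    }
    where open FreeModule

-- Polynomials in one variable, as lists of coefficients (constant term first)
-- up to trailing zeros.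

module Polynomials (R : CommutativeRing 0ℓ 0ℓ) where
  private module R = CommutativeRing R
  open RingProperties R.ring using (-0#≈0#)

  Poly : Set
  Poly = List R.Carrier

  coeff : Poly → ℕ → R.Carrier
  coeff []      _       = R.0#
  coeff (a ∷ p) zero    = a
  coeff (a ∷ p) (suc k) = coeff p k

  infix  4 _≈ₚ_
  infixl 6 _+ₚ_
  infixl 7 _*ₚ_ _·_
  infix  8 -ₚ_

  record _≈ₚ_ (p q : Poly) : Set where
    constructor coeffwise
    field coeff-cong : ∀ k → coeff p k R.≈ coeff q k

  open _≈ₚ_ public

  _+ₚ_ : Poly → Poly → Poly
  []      +ₚ q       = q
  (a ∷ p) +ₚ []      = a ∷ p
  (a ∷ p) +ₚ (b ∷ q) = a R.+ b ∷ p +ₚ q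

  -ₚ_ : Poly → Poly
  -ₚ []      = []
  -ₚ (a ∷ p) = R.- a ∷ -ₚ p

  _·_ : R.Carrier → Poly → Poly
  a · []      = []
  a · (b ∷ q) = a R.* b ∷ a · q

  _*ₚ_ : Poly → Poly → Poly
  []      *ₚ q = []
  (a ∷ p) *ₚ q = a · q +ₚ (R.0# ∷ p *ₚ q)

  constant : R.Carrier → Poly
  constant a = a ∷ []

  var : Poly
  var = R.0# ∷ R.1# ∷ []

  coeff-+ : ∀ p q k → coeff (p +ₚ q) k R.≈ coeff p k R.+ coeff q k
  coeff-+ []      q       k       = R.sym (R.+-identityˡ _)
  coeff-+ (a ∷ p) []      k       = R.sym (R.+-identityʳ _)
  coeff-+ (a ∷ p) (b ∷ q) zero    = R.refl
  coeff-+ (a ∷ p) (b ∷ q) (suc k) = coeff-+ p q k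

  coeff-neg : ∀ p k → coeff (-ₚ p) k R.≈ R.- coeff p k
  coeff-neg []      k       = R.sym -0#≈0#
  coeff-neg (a ∷ p) zero    = R.refl
  coeff-neg (a ∷ p) (suc k) = coeff-neg p k

  coeff-· : ∀ a q k → coeff (a · q) k R.≈ a R.* coeff q k
  coeff-· a []      k       = R.sym (R.zeroʳ a)
  coeff-· a (b ∷ q) zero    = R.refl
  coeff-· a (b ∷ q) (suc k) = coeff-· a q k

  private
    ≈ₚ-refl : ∀ {p} → p ≈ₚ p
    ≈ₚ-refl = coeffwise λ k → R.refl

    ≈ₚ-sym : ∀ {p q} → p ≈ₚ q → q ≈ₚ p
    ≈ₚ-sym e = coeffwise λ k → R.sym (coeff-cong e k)

    ≈ₚ-trans : ∀ {p q r} → p ≈ₚ q → q ≈ₚ r → p ≈ₚ r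
    ≈ₚ-trans e f = coeffwise λ k → R.trans (coeff-cong e k) (coeff-cong f k)

    +ₚ-cong : ∀ {p p′ q q′} → p ≈ₚ p′ → q ≈ₚ q′ → p +ₚ q ≈ₚ p′ +ₚ q′
    +ₚ-cong {p} {p′} {q} {q′} e f = coeffwise λ k →
      R.trans (coeff-+ p q k) (R.trans (R.+-cong (coeff-cong e k) (coeff-cong f k)) (R.sym (coeff-+ p′ q′ k)))

    +ₚ-assoc : ∀ p q r → (p +ₚ q) +ₚ r ≈ₚ p +ₚ (q +ₚ r)
    +ₚ-assoc p q r = coeffwise λ k →
      R.trans (coeff-+ (p +ₚ q) r k) (R.trans (R.+-congʳ (coeff-+ p q k)) (R.trans (R.+-assoc _ _ _)
        (R.sym (R.trans (coeff-+ p (q +ₚ r) k) (R.+-congˡ (coeff-+ q r k))))))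

    +ₚ-comm : ∀ p q → p +ₚ q ≈ₚ q +ₚ p
    +ₚ-comm p q = coeffwise λ k →
      R.trans (coeff-+ p q k) (R.trans (R.+-comm _ _) (R.sym (coeff-+ q p k)))

    +ₚ-identityˡ : ∀ p → [] +ₚ p ≈ₚ p
    +ₚ-identityˡ p = ≈ₚ-refl

    +ₚ-identityʳ : ∀ p → p +ₚ [] ≈ₚ p
    +ₚ-identityʳ p = ≈ₚ-trans (+ₚ-comm p []) (+ₚ-identityˡ p)

    neg-cong : ∀ {p q} → p ≈ₚ q → -ₚ p ≈ₚ -ₚ q
    neg-cong {p} {q} e = coeffwise λ k →
      R.trans (coeff-neg p k) (R.trans (R.-‿cong (coeff-cong e k)) (R.sym (coeff-neg q k)))

    neg-inverseˡ : ∀ p → -ₚ p +ₚ p ≈ₚ []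
    neg-inverseˡ p = coeffwise λ k →
      R.trans (coeff-+ (-ₚ p) p k) (R.trans (R.+-congʳ (coeff-neg p k)) (R.-‿inverseˡ _))

  ∷-cong : ∀ {a b p q} → a R.≈ b → p ≈ₚ q → a ∷ p ≈ₚ b ∷ q
  ∷-cong e f = coeffwise λ { zero → e ; (suc k) → coeff-cong f k }

  0∷-zero : ∀ {p} → p ≈ₚ [] → R.0# ∷ p ≈ₚ []
  0∷-zero e = coeffwise λ { zero → R.refl ; (suc k) → coeff-cong e k }

  +ₚ-commutativeMonoid : CommutativeMonoid 0ℓ 0ℓ
  +ₚ-commutativeMonoid = record
    { Carrier = Poly
    ; _≈_     = _≈ₚ_
    ; _∙_     = _+ₚ_
    ; ε       = []
    ; isCommutativeMonoid = record
      { isMonoid = record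
        { isSemigroup = record
          { isMagma = record
            { isEquivalence = record
              { refl  = ≈ₚ-refl
              ; sym   = ≈ₚ-sym
              ; trans = ≈ₚ-trans
              }
            ; ∙-cong = +ₚ-cong
            }
          ; assoc = +ₚ-assoc
          }
        ; identity = +ₚ-identityˡ , +ₚ-identityʳ
        }
      ; comm = +ₚ-comm
      }
    }

  private
    module +ₚ = CommutativeMonoid +ₚ-commutativeMonoid
    open CommutativeSemigroupProperties +ₚ.commutativeSemigroup using (interchange; x∙yz≈y∙xz)
    open SetoidReasoning +ₚ.setoid

    ·-cong : ∀ {a b p q} → a R.≈ b → p ≈ₚ q → a · p ≈ₚ b · q
    ·-cong {a} {b} {p} {q} e f = coeffwise λ k →
      R.trans (coeff-· a p k) (R.trans (R.*-cong e (coeff-cong f k)) (R.sym (coeff-· b q k)))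

    ·-distribˡ : ∀ a p q → a · (p +ₚ q) ≈ₚ a · p +ₚ a · q
    ·-distribˡ a p q = coeffwise λ k →
      R.trans (coeff-· a (p +ₚ q) k) (R.trans (R.*-congˡ (coeff-+ p q k)) (R.trans (R.distribˡ _ _ _)
        (R.sym (R.trans (coeff-+ (a · p) (a · q) k) (R.+-cong (coeff-· a p k) (coeff-· a q k))))))

    ·-assoc : ∀ a b p → (a R.* b) · p ≈ₚ a · (b · p)
    ·-assoc a b p = coeffwise λ k →
      R.trans (coeff-· (a R.* b) p k) (R.trans (R.*-assoc _ _ _)
        (R.sym (R.trans (coeff-· a (b · p) k) (R.*-congˡ (coeff-· b p k)))))

    ·-identityˡ : ∀ p → R.1# · p ≈ₚ p
    ·-identityˡ p = coeffwise λ k → R.trans (coeff-· R.1# p k) (R.*-identityˡ _)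

    ·-zeroˡ : ∀ p → R.0# · p ≈ₚ []
    ·-zeroˡ p = coeffwise λ k → R.trans (coeff-· R.0# p k) (R.zeroˡ _)

    *ₚ-zeroʳ : ∀ p → p *ₚ [] ≈ₚ []
    *ₚ-zeroʳ []      = ≈ₚ-refl
    *ₚ-zeroʳ (a ∷ p) = 0∷-zero (*ₚ-zeroʳ p)

    *ₚ-congˡ : ∀ p {q q′} → q ≈ₚ q′ → p *ₚ q ≈ₚ p *ₚ q′
    *ₚ-congˡ []      e = ≈ₚ-refl
    *ₚ-congˡ (a ∷ p) {q} {q′} e = +ₚ-cong (·-cong R.refl e)
      (∷-cong R.refl (*ₚ-congˡ p e))

    *ₚ-∷ : ∀ p b q → p *ₚ (b ∷ q) ≈ₚ b · p +ₚ (R.0# ∷ p *ₚ q)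
    *ₚ-∷ []      b q = ≈ₚ-sym (0∷-zero (≈ₚ-refl))
    *ₚ-∷ (a ∷ p) b q = ∷-cong (R.+-congʳ (R.*-comm a b)) (begin
      a · q +ₚ p *ₚ (b ∷ q)               ≈⟨ +ₚ-cong (≈ₚ-refl) (*ₚ-∷ p b q) ⟩
      a · q +ₚ (b · p +ₚ (R.0# ∷ p *ₚ q)) ≈⟨ x∙yz≈y∙xz (a · q) (b · p) (R.0# ∷ p *ₚ q) ⟩
      b · p +ₚ (a · q +ₚ (R.0# ∷ p *ₚ q)) ∎)

    *ₚ-comm : ∀ p q → p *ₚ q ≈ₚ q *ₚ p
    *ₚ-comm []      q = ≈ₚ-sym (*ₚ-zeroʳ q)
    *ₚ-comm (a ∷ p) q = begin
      a · q +ₚ (R.0# ∷ p *ₚ q) ≈⟨ +ₚ-cong (≈ₚ-refl) (∷-cong R.refl (*ₚ-comm p q)) ⟩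
      a · q +ₚ (R.0# ∷ q *ₚ p) ≈⟨ *ₚ-∷ q a p ⟨
      q *ₚ (a ∷ p)             ∎

    *ₚ-cong : ∀ {p p′ q q′} → p ≈ₚ p′ → q ≈ₚ q′ → p *ₚ q ≈ₚ p′ *ₚ q′
    *ₚ-cong {p} {p′} {q} {q′} e f = begin
      p *ₚ q   ≈⟨ *ₚ-congˡ p f ⟩
      p *ₚ q′  ≈⟨ *ₚ-comm p q′ ⟩
      q′ *ₚ p  ≈⟨ *ₚ-congˡ q′ e ⟩
      q′ *ₚ p′ ≈⟨ *ₚ-comm q′ p′ ⟩
      p′ *ₚ q′ ∎

    *ₚ-distribˡ : ∀ p q r → p *ₚ (q +ₚ r) ≈ₚ p *ₚ q +ₚ p *ₚ r
    *ₚ-distribˡ []      q r = ≈ₚ-refl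
    *ₚ-distribˡ (a ∷ p) q r = begin
      a · (q +ₚ r) +ₚ (R.0# ∷ p *ₚ (q +ₚ r))
        ≈⟨ +ₚ-cong (·-distribˡ a q r) (∷-cong (R.sym (R.+-identityˡ _)) (*ₚ-distribˡ p q r)) ⟩
      (a · q +ₚ a · r) +ₚ ((R.0# ∷ p *ₚ q) +ₚ (R.0# ∷ p *ₚ r))
        ≈⟨ interchange (a · q) (a · r) (R.0# ∷ p *ₚ q) (R.0# ∷ p *ₚ r) ⟩
      (a · q +ₚ (R.0# ∷ p *ₚ q)) +ₚ (a · r +ₚ (R.0# ∷ p *ₚ r)) ∎

    *ₚ-distribʳ : ∀ r p q → (p +ₚ q) *ₚ r ≈ₚ p *ₚ r +ₚ q *ₚ r
    *ₚ-distribʳ r p q = begin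
      (p +ₚ q) *ₚ r    ≈⟨ *ₚ-comm (p +ₚ q) r ⟩
      r *ₚ (p +ₚ q)    ≈⟨ *ₚ-distribˡ r p q ⟩
      r *ₚ p +ₚ r *ₚ q ≈⟨ +ₚ-cong (*ₚ-comm r p) (*ₚ-comm r q) ⟩
      p *ₚ r +ₚ q *ₚ r ∎

    ·-*ₚ-assoc : ∀ a p q → (a · p) *ₚ q ≈ₚ a · (p *ₚ q)
    ·-*ₚ-assoc a []      q = ≈ₚ-refl
    ·-*ₚ-assoc a (b ∷ p) q = begin
      (a R.* b) · q +ₚ (R.0# ∷ (a · p) *ₚ q)
        ≈⟨ +ₚ-cong (·-assoc a b q) (∷-cong (R.sym (R.zeroʳ a)) (·-*ₚ-assoc a p q)) ⟩
      a · (b · q) +ₚ a · (R.0# ∷ p *ₚ q)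
        ≈⟨ ·-distribˡ a (b · q) (R.0# ∷ p *ₚ q) ⟨
      a · (b · q +ₚ (R.0# ∷ p *ₚ q)) ∎

    *ₚ-assoc : ∀ p q r → (p *ₚ q) *ₚ r ≈ₚ p *ₚ (q *ₚ r)
    *ₚ-assoc []      q r = ≈ₚ-refl
    *ₚ-assoc (a ∷ p) q r = begin
      (a · q +ₚ (R.0# ∷ p *ₚ q)) *ₚ r
        ≈⟨ *ₚ-distribʳ r (a · q) (R.0# ∷ p *ₚ q) ⟩
      (a · q) *ₚ r +ₚ (R.0# · r +ₚ (R.0# ∷ (p *ₚ q) *ₚ r))
        ≈⟨ +ₚ-cong (·-*ₚ-assoc a q r) (+ₚ-cong (·-zeroˡ r) (∷-cong R.refl (*ₚ-assoc p q r))) ⟩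
      a · (q *ₚ r) +ₚ (R.0# ∷ p *ₚ (q *ₚ r)) ∎

    *ₚ-identityˡ : ∀ p → constant R.1# *ₚ p ≈ₚ p
    *ₚ-identityˡ p = begin
      R.1# · p +ₚ (R.0# ∷ []) ≈⟨ +ₚ-cong (·-identityˡ p) (0∷-zero (≈ₚ-refl)) ⟩
      p +ₚ []                 ≈⟨ +ₚ-identityʳ p ⟩
      p                       ∎

  private
    abstract
      isCommutativeRing-ₚ : IsCommutativeRing _≈ₚ_ _+ₚ_ _*ₚ_ -ₚ_ [] (constant R.1#)
      isCommutativeRing-ₚ = record
        { isRing = record
          { +-isAbelianGroup = record
            { isGroup = record
              { isMonoid = +ₚ.isMonoid
              ; inverse  = neg-inverseˡ ,
                  λ p → ≈ₚ-trans (+ₚ-comm p (-ₚ p)) (neg-inverseˡ p)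
              ; ⁻¹-cong  = neg-cong
              }
            ; comm = +ₚ-comm
            }
          ; *-cong     = *ₚ-cong
          ; *-assoc    = *ₚ-assoc
          ; *-identity = *ₚ-identityˡ ,
              λ p → ≈ₚ-trans (*ₚ-comm p _) (*ₚ-identityˡ p)
          ; distrib    = *ₚ-distribˡ , *ₚ-distribʳ
          }
        ; *-comm = *ₚ-comm
        }

  polynomialRing : CommutativeRing 0ℓ 0ℓ
  polynomialRing = record
    { Carrier = Poly
    ; _≈_     = _≈ₚ_
    ; _+_     = _+ₚ_
    ; _*_     = _*ₚ_
    ; -_      = -ₚ_
    ; 0#      = []
    ; 1#      = constant R.1#
    ; isCommutativeRing = isCommutativeRing-ₚ
    }

  constant-* : ∀ a p → constant a *ₚ p ≈ₚ a · p
  constant-* a p = ≈ₚ-trans (+ₚ-cong (≈ₚ-refl {a · p}) (0∷-zero (≈ₚ-refl {[]}))) (+ₚ-identityʳ (a · p))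

-- The quotient S / (f, g).

module Quotient (S : CommutativeRing 0ℓ 0ℓ) (f g : CommutativeRing.Carrier S) where
  open CommutativeRing S
  open RingProperties ring using (-‿distribˡ-*; -‿+-comm; -‿involutive)
  open CommutativeSemigroupProperties +-commutativeSemigroup using (interchange)

  private
    I : Carrier → Carrier → Carrier
    I a b = a * f + b * g

  infix 4 _∼_

  record _∼_ (p q : Carrier) : Set where
    constructor congruent
    field
      a b      : Carrier
      p-q≈af+bg : p - q ≈ a * f + b * g

  private
    I-+ : ∀ a b c d → I a b + I c d ≈ I (a + c) (b + d)
    I-+ a b c d = trans (interchange _ _ _ _) (+-cong (sym (distribʳ f a c)) (sym (distribʳ g b d)))

    I-neg : ∀ a b → - I a b ≈ I (- a) (- b)
    I-neg a b = trans (sym (-‿+-comm _ _)) (+-cong (-‿distribˡ-* a f) (-‿distribˡ-* b g))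

    I-* : ∀ c a b → c * I a b ≈ I (c * a) (c * b)
    I-* c a b = trans (distribˡ c _ _) (+-cong (sym (*-assoc c a f)) (sym (*-assoc c b g)))

    open SetoidReasoning setoid

  ∼⇒ : ∀ {p q} ((congruent a b _) : p ∼ q) → p ≈ q + (a * f + b * g)
  ∼⇒ {p} {q} (congruent a b e) = begin
    p               ≈⟨ +-identityʳ p ⟨
    p + 0#          ≈⟨ +-congˡ (-‿inverseˡ q) ⟨
    p + (- q + q)   ≈⟨ +-assoc p (- q) q ⟨
    (p - q) + q     ≈⟨ +-cong e refl ⟩
    I a b + q       ≈⟨ +-comm _ q ⟩
    q + I a b       ∎

  ⇒∼ : ∀ {p q} a b → p ≈ q + (a * f + b * g) → p ∼ q
  ⇒∼ {p} {q} a b e = congruent a b (begin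
    p - q           ≈⟨ +-congʳ e ⟩
    q + I a b - q   ≈⟨ +-congʳ (+-comm q _) ⟩
    I a b + q - q   ≈⟨ +-assoc _ q (- q) ⟩
    I a b + (q - q) ≈⟨ +-congˡ (-‿inverseʳ q) ⟩
    I a b + 0#      ≈⟨ +-identityʳ _ ⟩
    I a b           ∎)

  ≈⇒∼ : ∀ {p q} → p ≈ q → p ∼ q
  ≈⇒∼ {p} {q} e = ⇒∼ 0# 0# (begin
    p          ≈⟨ e ⟩
    q          ≈⟨ +-identityʳ q ⟨
    q + 0#     ≈⟨ +-congˡ (trans (+-cong (zeroˡ f) (zeroˡ g)) (+-identityʳ 0#)) ⟨
    q + I 0# 0# ∎)

  f∼0 : f ∼ 0#
  f∼0 = ⇒∼ 1# 0# (sym (trans (+-identityˡ _)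
    (trans (+-cong (*-identityˡ f) (zeroˡ g)) (+-identityʳ f))))

  g-relation : ∀ {p q} → g ≈ p - q → p ∼ q
  g-relation e = congruent 0# 1# (trans (sym e)
    (sym (trans (+-cong (zeroˡ f) (*-identityˡ g)) (+-identityˡ g))))

  ∼-isEquivalence : IsEquivalence _∼_
  ∼-isEquivalence = record
    { refl  = ≈⇒∼ refl
    ; sym   = λ {p} {q} p∼q@(congruent a b _) → ⇒∼ (- a) (- b) (begin
        q                       ≈⟨ +-identityʳ q ⟨
        q + 0#                  ≈⟨ +-congˡ (-‿inverseʳ (I a b)) ⟨
        q + (I a b - I a b)     ≈⟨ +-assoc q _ _ ⟨
        (q + I a b) - I a b     ≈⟨ +-cong (sym (∼⇒ p∼q)) (I-neg a b) ⟩
        p + I (- a) (- b)       ∎)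
    ; trans = λ {p} {q} {r} p∼q@(congruent a b _) q∼r@(congruent c d _) → ⇒∼ (c + a) (d + b) (begin
        p                       ≈⟨ ∼⇒ p∼q ⟩
        q + I a b               ≈⟨ +-congʳ (∼⇒ q∼r) ⟩
        (r + I c d) + I a b     ≈⟨ +-assoc r _ _ ⟩
        r + (I c d + I a b)     ≈⟨ +-congˡ (I-+ c d a b) ⟩
        r + I (c + a) (d + b)   ∎)
    }

  private
    module ∼ = IsEquivalence ∼-isEquivalence

    ∼-+-cong : ∀ {p p′ q q′} → p ∼ p′ → q ∼ q′ → p + q ∼ p′ + q′
    ∼-+-cong {p} {p′} {q} {q′} e@(congruent a b _) e′@(congruent c d _) = ⇒∼ (a + c) (b + d) (begin
      p + q                       ≈⟨ +-cong (∼⇒ e) (∼⇒ e′) ⟩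
      (p′ + I a b) + (q′ + I c d) ≈⟨ interchange _ _ _ _ ⟩
      (p′ + q′) + (I a b + I c d) ≈⟨ +-congˡ (I-+ a b c d) ⟩
      (p′ + q′) + I (a + c) (b + d) ∎)

    ∼-neg-cong : ∀ {p q} → p ∼ q → - p ∼ - q
    ∼-neg-cong {p} {q} e@(congruent a b _) = ⇒∼ (- a) (- b) (begin
      - p                   ≈⟨ -‿cong (∼⇒ e) ⟩
      - (q + I a b)         ≈⟨ -‿+-comm q _ ⟨
      - q - I a b           ≈⟨ +-congˡ (I-neg a b) ⟩
      - q + I (- a) (- b)   ∎)

    ∼-*-congˡ : ∀ r {p q} → p ∼ q → r * p ∼ r * q
    ∼-*-congˡ r {p} {q} e@(congruent a b _) = ⇒∼ (r * a) (r * b) (begin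
      r * p                       ≈⟨ *-congˡ (∼⇒ e) ⟩
      r * (q + I a b)             ≈⟨ distribˡ r q _ ⟩
      r * q + r * I a b           ≈⟨ +-congˡ (I-* r a b) ⟩
      r * q + I (r * a) (r * b)   ∎)

    ∼-*-cong : ∀ {p p′ q q′} → p ∼ p′ → q ∼ q′ → p * q ∼ p′ * q′
    ∼-*-cong {p} {p′} {q} {q′} e e′ = ∼.trans (∼-*-congˡ p e′)
      (∼.trans (≈⇒∼ (*-comm p q′)) (∼.trans (∼-*-congˡ q′ e) (≈⇒∼ (*-comm q′ p′))))

  private
    abstract
      isCommutativeRing-/ : IsCommutativeRing _∼_ _+_ _*_ -_ 0# 1#
      isCommutativeRing-/ = record
        { isRing = record
          { +-isAbelianGroup = record
            { isGroup = record
              { isMonoid = record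
                { isSemigroup = record
                  { isMagma = record
                    { isEquivalence = ∼-isEquivalence
                    ; ∙-cong        = ∼-+-cong
                    }
                  ; assoc = λ p q r → ≈⇒∼ (+-assoc p q r)
                  }
                ; identity = (λ p → ≈⇒∼ (+-identityˡ p)) , (λ p → ≈⇒∼ (+-identityʳ p))
                }
              ; inverse = (λ p → ≈⇒∼ (-‿inverseˡ p)) , (λ p → ≈⇒∼ (-‿inverseʳ p))
              ; ⁻¹-cong = ∼-neg-cong
              }
            ; comm = λ p q → ≈⇒∼ (+-comm p q)
            }
          ; *-cong     = ∼-*-cong
          ; *-assoc    = λ p q r → ≈⇒∼ (*-assoc p q r)
          ; *-identity = (λ p → ≈⇒∼ (*-identityˡ p)) , (λ p → ≈⇒∼ (*-identityʳ p))
          ; distrib    = (λ p q r → ≈⇒∼ (distribˡ p q r)) , (λ p q r → ≈⇒∼ (distribʳ p q r))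
          }
        ; *-comm = λ p q → ≈⇒∼ (*-comm p q)
        }

  quotientRing : CommutativeRing 0ℓ 0ℓ
  quotientRing = record
    { Carrier = Carrier
    ; _≈_     = _∼_
    ; _+_     = _+_
    ; _*_     = _*_
    ; -_      = -_
    ; 0#      = 0#
    ; 1#      = 1#
    ; isCommutativeRing = isCommutativeRing-/
    }

-- The ring ℤ[1/N]: fractions a / Nᵏ.

module Localization (N : ℕ) .{{_ : NonZero N}} where

  infix 8 _/N^_

  record Fraction : Set where
    constructor _/N^_
    field
      numerator : ℤ
      exponent  : ℕ

  open Fraction

  private
    infix 9 N^_

    N^_ : ℕ → ℤ
    N^ k = (+ N) ℤ.^ k

    N^-nonZero : ∀ k → ℤ.NonZero (N^ k)
    N^-nonZero k = ℤ.≢-nonZero (λ N^k≡0 →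
      ℕ.≢-nonZero⁻¹ N (ℤ.+-injective (ℤ.i^n≡0⇒i≡0 (+ N) k N^k≡0)))

    N^-+ : ∀ k l → N^ (k ℕ.+ l) ≡ N^ k ℤ.* N^ l
    N^-+ k l = ℤ.^-distribˡ-+-* (+ N) k l

  infix  4 _≈_
  infixl 6 _+_
  infixl 7 _*_
  infix  8 -_

  record _≈_ (p q : Fraction) : Set where
    constructor cross
    field cross-≡ : numerator p ℤ.* N^ exponent q ≡ numerator q ℤ.* N^ exponent p

  _+_ _*_ : Fraction → Fraction → Fraction
  p + q = (numerator p ℤ.* N^ exponent q ℤ.+ numerator q ℤ.* N^ exponent p) /N^ (exponent p ℕ.+ exponent q)
  p * q = (numerator p ℤ.* numerator q) /N^ (exponent p ℕ.+ exponent q)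

  -_ : Fraction → Fraction
  - p = (ℤ.- numerator p) /N^ exponent p

  fromℤ : ℤ → Fraction
  fromℤ a = a /N^ 0

  1/N : Fraction
  1/N = ℤ.1ℤ /N^ 1

  private
   open +-*-Solver

   abstract
    ≈-trans : ∀ {p q r} → p ≈ q → q ≈ r → p ≈ r
    ≈-trans {a /N^ k} {b /N^ l} {c /N^ m} (cross e) (cross f) = cross
      (ℤ.*-cancelʳ-≡ (a ℤ.* N^ m) (c ℤ.* N^ k) (N^ l) {{N^-nonZero l}} (begin
        a ℤ.* N^ m ℤ.* N^ l   ≡⟨ swap a (N^ m) (N^ l) ⟩
        a ℤ.* N^ l ℤ.* N^ m   ≡⟨ cong (ℤ._* N^ m) e ⟩
        b ℤ.* N^ k ℤ.* N^ m   ≡⟨ swap b (N^ k) (N^ m) ⟩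
        b ℤ.* N^ m ℤ.* N^ k   ≡⟨ cong (ℤ._* N^ k) f ⟩
        c ℤ.* N^ l ℤ.* N^ k   ≡⟨ swap c (N^ l) (N^ k) ⟩
        c ℤ.* N^ k ℤ.* N^ l   ∎))
      where
      open ≡.≡-Reasoning
      swap : ∀ x y z → x ℤ.* y ℤ.* z ≡ x ℤ.* z ℤ.* y
      swap = solve 3 (λ x y z → x :* y :* z := x :* z :* y) ≡.refl

    +-cong : ∀ {p p′ q q′} → p ≈ p′ → q ≈ q′ → p + q ≈ p′ + q′
    +-cong {a /N^ k} {a′ /N^ k′} {b /N^ l} {b′ /N^ l′} (cross e) (cross f)
      = cross (begin
        (a ℤ.* N^ l ℤ.+ b ℤ.* N^ k) ℤ.* N^ (k′ ℕ.+ l′)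
          ≡⟨ cong ((a ℤ.* N^ l ℤ.+ b ℤ.* N^ k) ℤ.*_) (N^-+ k′ l′) ⟩
        (a ℤ.* N^ l ℤ.+ b ℤ.* N^ k) ℤ.* (N^ k′ ℤ.* N^ l′)
          ≡⟨ expand a b (N^ k) (N^ l) (N^ k′) (N^ l′) ⟩
        (a ℤ.* N^ k′) ℤ.* (N^ l ℤ.* N^ l′) ℤ.+ (b ℤ.* N^ l′) ℤ.* (N^ k ℤ.* N^ k′)
          ≡⟨ ≡.cong₂ (λ u v → u ℤ.* (N^ l ℤ.* N^ l′) ℤ.+ v ℤ.* (N^ k ℤ.* N^ k′)) e f ⟩
        (a′ ℤ.* N^ k) ℤ.* (N^ l ℤ.* N^ l′) ℤ.+ (b′ ℤ.* N^ l) ℤ.* (N^ k ℤ.* N^ k′)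
          ≡⟨ collect a′ b′ (N^ k) (N^ l) (N^ k′) (N^ l′) ⟩
        (a′ ℤ.* N^ l′ ℤ.+ b′ ℤ.* N^ k′) ℤ.* (N^ k ℤ.* N^ l)
          ≡⟨ cong ((a′ ℤ.* N^ l′ ℤ.+ b′ ℤ.* N^ k′) ℤ.*_) (N^-+ k l) ⟨
        (a′ ℤ.* N^ l′ ℤ.+ b′ ℤ.* N^ k′) ℤ.* N^ (k ℕ.+ l) ∎)
      where
      open ≡.≡-Reasoning
      expand : ∀ a b x y x′ y′ → (a ℤ.* y ℤ.+ b ℤ.* x) ℤ.* (x′ ℤ.* y′) ≡
                                 (a ℤ.* x′) ℤ.* (y ℤ.* y′) ℤ.+ (b ℤ.* y′) ℤ.* (x ℤ.* x′)
      expand = solve 6 (λ a b x y x′ y′ →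
        (a :* y :+ b :* x) :* (x′ :* y′) := (a :* x′) :* (y :* y′) :+ (b :* y′) :* (x :* x′)) ≡.refl
      collect : ∀ a b x y x′ y′ → (a ℤ.* x) ℤ.* (y ℤ.* y′) ℤ.+ (b ℤ.* y) ℤ.* (x ℤ.* x′) ≡
                                  (a ℤ.* y′ ℤ.+ b ℤ.* x′) ℤ.* (x ℤ.* y)
      collect = solve 6 (λ a b x y x′ y′ →
        (a :* x) :* (y :* y′) :+ (b :* y) :* (x :* x′) := (a :* y′ :+ b :* x′) :* (x :* y)) ≡.refl

    *-cong : ∀ {p p′ q q′} → p ≈ p′ → q ≈ q′ → p * q ≈ p′ * q′
    *-cong {a /N^ k} {a′ /N^ k′} {b /N^ l} {b′ /N^ l′} (cross e) (cross f)
      = cross (begin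
        (a ℤ.* b) ℤ.* N^ (k′ ℕ.+ l′)        ≡⟨ cong (a ℤ.* b ℤ.*_) (N^-+ k′ l′) ⟩
        (a ℤ.* b) ℤ.* (N^ k′ ℤ.* N^ l′)     ≡⟨ swap a b (N^ k′) (N^ l′) ⟩
        (a ℤ.* N^ k′) ℤ.* (b ℤ.* N^ l′)     ≡⟨ ≡.cong₂ ℤ._*_ e f ⟩
        (a′ ℤ.* N^ k) ℤ.* (b′ ℤ.* N^ l)     ≡⟨ swap a′ b′ (N^ k) (N^ l) ⟨
        (a′ ℤ.* b′) ℤ.* (N^ k ℤ.* N^ l)     ≡⟨ cong (a′ ℤ.* b′ ℤ.*_) (N^-+ k l) ⟨
        (a′ ℤ.* b′) ℤ.* N^ (k ℕ.+ l)        ∎)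
      where
      open ≡.≡-Reasoning
      swap : ∀ a b x y → (a ℤ.* b) ℤ.* (x ℤ.* y) ≡ (a ℤ.* x) ℤ.* (b ℤ.* y)
      swap = solve 4 (λ a b x y → (a :* b) :* (x :* y) := (a :* x) :* (b :* y)) ≡.refl

    neg-cong : ∀ {p q} → p ≈ q → - p ≈ - q
    neg-cong {a /N^ k} {b /N^ l} (cross e) = cross (begin
      ℤ.- a ℤ.* N^ l     ≡⟨ ℤ.neg-distribˡ-* a (N^ l) ⟨
      ℤ.- (a ℤ.* N^ l)   ≡⟨ cong ℤ.-_ e ⟩
      ℤ.- (b ℤ.* N^ k)   ≡⟨ ℤ.neg-distribˡ-* b (N^ k) ⟩
      ℤ.- b ℤ.* N^ k     ∎)
      where open ≡.≡-Reasoning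

    -- If the numerators agree over a common exponent, the fractions agree.
    sameExponent : ∀ {a b k l} → a ≡ b → k ≡ l → a /N^ k ≈ b /N^ l
    sameExponent ≡.refl ≡.refl = cross ≡.refl

    +-assoc : ∀ p q r → (p + q) + r ≈ p + (q + r)
    +-assoc (a /N^ k) (b /N^ l) (c /N^ m) = sameExponent (begin
        (a ℤ.* N^ l ℤ.+ b ℤ.* N^ k) ℤ.* N^ m ℤ.+ c ℤ.* N^ (k ℕ.+ l)
          ≡⟨ cong (λ u → (a ℤ.* N^ l ℤ.+ b ℤ.* N^ k) ℤ.* N^ m ℤ.+ c ℤ.* u) (N^-+ k l) ⟩
        (a ℤ.* N^ l ℤ.+ b ℤ.* N^ k) ℤ.* N^ m ℤ.+ c ℤ.* (N^ k ℤ.* N^ l)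
          ≡⟨ solve 6 (λ a b c x y z →
               (a :* y :+ b :* x) :* z :+ c :* (x :* y) := a :* (y :* z) :+ (b :* z :+ c :* y) :* x)
               ≡.refl a b c (N^ k) (N^ l) (N^ m) ⟩
        a ℤ.* (N^ l ℤ.* N^ m) ℤ.+ (b ℤ.* N^ m ℤ.+ c ℤ.* N^ l) ℤ.* N^ k
          ≡⟨ cong (λ u → a ℤ.* u ℤ.+ (b ℤ.* N^ m ℤ.+ c ℤ.* N^ l) ℤ.* N^ k) (N^-+ l m) ⟨
        a ℤ.* N^ (l ℕ.+ m) ℤ.+ (b ℤ.* N^ m ℤ.+ c ℤ.* N^ l) ℤ.* N^ k ∎)
      (ℕ.+-assoc k l m)
      where open ≡.≡-Reasoning

    +-comm : ∀ p q → p + q ≈ q + p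
    +-comm (a /N^ k) (b /N^ l) = sameExponent (ℤ.+-comm (a ℤ.* N^ l) (b ℤ.* N^ k)) (ℕ.+-comm k l)

    +-identityˡ : ∀ p → fromℤ (+ 0) + p ≈ p
    +-identityˡ (a /N^ k) = sameExponent
      (solve 2 (λ a x → con (+ 0) :* x :+ a :* con (+ 1) := a) ≡.refl a (N^ k)) ≡.refl

    neg-inverseˡ : ∀ p → - p + p ≈ fromℤ (+ 0)
    neg-inverseˡ (a /N^ k) = cross
      (solve 3 (λ a x y → (:- a :* x :+ a :* x) :* con (+ 1) := con (+ 0) :* y) ≡.refl
        a (N^ k) (N^ (k ℕ.+ k)))

    *-assoc : ∀ p q r → (p * q) * r ≈ p * (q * r)
    *-assoc (a /N^ k) (b /N^ l) (c /N^ m) = sameExponent (ℤ.*-assoc a b c) (ℕ.+-assoc k l m)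

    *-comm : ∀ p q → p * q ≈ q * p
    *-comm (a /N^ k) (b /N^ l) = sameExponent (ℤ.*-comm a b) (ℕ.+-comm k l)

    *-identityˡ : ∀ p → fromℤ (+ 1) * p ≈ p
    *-identityˡ (a /N^ k) = sameExponent (ℤ.*-identityˡ a) ≡.refl

    *-distribˡ : ∀ p q r → p * (q + r) ≈ p * q + p * r
    *-distribˡ (a /N^ k) (b /N^ l) (c /N^ m) = cross (begin
      a ℤ.* (b ℤ.* N^ m ℤ.+ c ℤ.* N^ l) ℤ.* N^ ((k ℕ.+ l) ℕ.+ (k ℕ.+ m))
        ≡⟨ cong (a ℤ.* (b ℤ.* N^ m ℤ.+ c ℤ.* N^ l) ℤ.*_)
             (≡.trans (N^-+ (k ℕ.+ l) (k ℕ.+ m)) (≡.cong₂ ℤ._*_ (N^-+ k l) (N^-+ k m))) ⟩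
      a ℤ.* (b ℤ.* N^ m ℤ.+ c ℤ.* N^ l) ℤ.* ((N^ k ℤ.* N^ l) ℤ.* (N^ k ℤ.* N^ m))
        ≡⟨ solve 6 (λ a b c x y z →
             a :* (b :* z :+ c :* y) :* ((x :* y) :* (x :* z)) :=
             ((a :* b) :* (x :* z) :+ (a :* c) :* (x :* y)) :* (x :* (y :* z)))
             ≡.refl a b c (N^ k) (N^ l) (N^ m) ⟩
      ((a ℤ.* b) ℤ.* (N^ k ℤ.* N^ m) ℤ.+ (a ℤ.* c) ℤ.* (N^ k ℤ.* N^ l)) ℤ.* (N^ k ℤ.* (N^ l ℤ.* N^ m))
        ≡⟨ ≡.cong₂ ℤ._*_
             (≡.cong₂ (λ u v → (a ℤ.* b) ℤ.* u ℤ.+ (a ℤ.* c) ℤ.* v) (N^-+ k m) (N^-+ k l))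
             (≡.trans (N^-+ k (l ℕ.+ m)) (cong (N^ k ℤ.*_) (N^-+ l m))) ⟨
      ((a ℤ.* b) ℤ.* N^ (k ℕ.+ m) ℤ.+ (a ℤ.* c) ℤ.* N^ (k ℕ.+ l)) ℤ.* N^ (k ℕ.+ (l ℕ.+ m)) ∎)
      where open ≡.≡-Reasoning

    isEquivalence : IsEquivalence _≈_
    isEquivalence = record { refl = cross ≡.refl ; sym = λ { (cross e) → cross (≡.sym e) } ; trans = ≈-trans }

  private
    abstract
      isCommutativeRing-N : IsCommutativeRing _≈_ _+_ _*_ -_ (fromℤ (+ 0)) (fromℤ (+ 1))
      isCommutativeRing-N = record
        { isRing = record
          { +-isAbelianGroup = record
            { isGroup = record
              { isMonoid = record
                { isSemigroup = record
                  { isMagma = record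
                    { isEquivalence = isEquivalence
                    ; ∙-cong        = +-cong
                    }
                  ; assoc = +-assoc
                  }
                ; identity = +-identityˡ , λ p → ≈-trans (+-comm p (fromℤ (+ 0))) (+-identityˡ p)
                }
              ; inverse = neg-inverseˡ , λ p → ≈-trans (+-comm p (- p)) (neg-inverseˡ p)
              ; ⁻¹-cong = neg-cong
              }
            ; comm = +-comm
            }
          ; *-cong     = *-cong
          ; *-assoc    = *-assoc
          ; *-identity = *-identityˡ , λ p → ≈-trans (*-comm p (fromℤ (+ 1))) (*-identityˡ p)
          ; distrib    = *-distribˡ , λ p q r →
              ≈-trans (*-comm (q + r) p) (≈-trans (*-distribˡ p q r) (+-cong (*-comm p q) (*-comm p r)))
          }
        ; *-comm = *-comm
        }

  localization : CommutativeRing 0ℓ 0ℓ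
  localization = record
    { Carrier = Fraction
    ; _≈_     = _≈_
    ; _+_     = _+_
    ; _*_     = _*_
    ; -_      = -_
    ; 0#      = fromℤ (+ 0)
    ; 1#      = fromℤ (+ 1)
    ; isCommutativeRing = isCommutativeRing-N
    }

-- Polynomials in y over P act on P³ in the way that y acts on P[y]/(y³ - Xy)
-- in the basis 1, y, y².

module Action (P-ring : CommutativeRing 0ℓ 0ℓ) (X : CommutativeRing.Carrier P-ring) where
  private
    module P = CommutativeRing P-ring
    module P[y] = Polynomials P-ring
    module S = CommutativeRing P[y].polynomialRing
    module PExp = Exp P.semiring
    open Exp S.semiring using (_^_)

    x y : S.Carrier
    x = P[y].constant X
    y = P[y].var

    P³ : Set
    P³ = Fin 3 → P.Carrier

  infix 4 _≋_

  _≋_ : P³ → P³ → Set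
  u ≋ v = ∀ j → u j P.≈ v j

  Y : P³ → P³
  Y v zero             = P.0#
  Y v (suc zero)       = v zero P.+ X P.* v (suc (suc zero))
  Y v (suc (suc zero)) = v (suc zero)

  act : S.Carrier → P³ → P³
  act []      v j = P.0#
  act (p ∷ q) v j = p P.* v j P.+ Y (act q v) j

  Y-cong : ∀ {u v} → u ≋ v → Y u ≋ Y v
  Y-cong e zero             = P.refl
  Y-cong e (suc zero)       = P.+-cong (e zero) (P.*-congˡ {X} (e (suc (suc zero))))
  Y-cong e (suc (suc zero)) = e (suc zero)

  open CommutativeSemigroupProperties P.+-commutativeSemigroup using () renaming (interchange to +-interchange)
  open CommutativeSemigroupProperties P.*-commutativeSemigroup using () renaming (x∙yz≈y∙xz to *-swap)

  Y-+ : ∀ u v → Y (λ j → u j P.+ v j) ≋ (λ j → Y u j P.+ Y v j)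
  Y-+ u v zero             = P.sym (P.+-identityʳ P.0#)
  Y-+ u v (suc zero)       = P.trans (P.+-congˡ (P.distribˡ _ _ _)) (+-interchange _ _ _ _)
  Y-+ u v (suc (suc zero)) = P.refl

  Y-* : ∀ p v → Y (λ j → p P.* v j) ≋ (λ j → p P.* Y v j)
  Y-* p v zero             = P.sym (P.zeroʳ p)
  Y-* p v (suc zero)       = P.trans (P.+-congˡ (*-swap X p _)) (P.sym (P.distribˡ p _ _))
  Y-* p v (suc (suc zero)) = P.refl

  Y-0 : ∀ {v} → (∀ j → v j P.≈ P.0#) → ∀ j → Y v j P.≈ P.0#
  Y-0 e zero             = P.refl
  Y-0 e (suc zero)       = P.trans (P.+-cong (e zero) (P.trans (P.*-congˡ {X} (e (suc (suc zero)))) (P.zeroʳ X)))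
                             (P.+-identityʳ P.0#)
  Y-0 e (suc (suc zero)) = e (suc zero)

  act-zero : ∀ q v → q S.≈ S.0# → ∀ j → act q v j P.≈ P.0#
  act-zero []      v e j = P.refl
  act-zero (p ∷ q) v e j = P.trans
    (P.+-cong (P.trans (P.*-congʳ (P[y].coeff-cong e 0)) (P.zeroˡ _))
      (Y-0 (act-zero q v (P[y].coeffwise λ k → P[y].coeff-cong e (suc k))) j))
    (P.+-identityʳ P.0#)

  act-congˡ : ∀ {q q′} v → q S.≈ q′ → act q v ≋ act q′ v
  act-congˡ {[]}    {q′}     v e j = P.sym (act-zero q′ v (S.sym e) j)
  act-congˡ {p ∷ q} {[]}     v e j = act-zero (p ∷ q) v e j
  act-congˡ {p ∷ q} {p′ ∷ q′} v e j = P.+-cong (P.*-congʳ (P[y].coeff-cong e 0))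
    (Y-cong (act-congˡ {q} {q′} v (P[y].coeffwise λ k → P[y].coeff-cong e (suc k))) j)

  act-congʳ : ∀ q {u v} → u ≋ v → act q u ≋ act q v
  act-congʳ []      e j = P.refl
  act-congʳ (p ∷ q) e j = P.+-cong (P.*-congˡ (e j)) (Y-cong (act-congʳ q e) j)

  act-+ : ∀ q q′ v → act (q S.+ q′) v ≋ (λ j → act q v j P.+ act q′ v j)
  act-+ []      q′        v j = P.sym (P.+-identityˡ _)
  act-+ (p ∷ q) []        v j = P.sym (P.+-identityʳ _)
  act-+ (p ∷ q) (p′ ∷ q′) v j = P.trans
    (P.+-cong (P.distribʳ (v j) p p′) (P.trans (Y-cong (act-+ q q′ v) j) (Y-+ (act q v) (act q′ v) j)))
    (+-interchange _ _ _ _)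

  act-· : ∀ p q v → act (p P[y].· q) v ≋ (λ j → p P.* act q v j)
  act-· p []       v j = P.sym (P.zeroʳ p)
  act-· p (p′ ∷ q) v j = P.trans
    (P.+-cong (P.*-assoc p p′ (v j)) (P.trans (Y-cong (act-· p q v) j) (Y-* p (act q v) j)))
    (P.sym (P.distribˡ p _ _))

  act-* : ∀ q q′ v → act (q S.* q′) v ≋ act q (act q′ v)
  act-* []      q′ v j = P.refl
  act-* (p ∷ q) q′ v j = P.trans (act-+ (p P[y].· q′) (P.0# ∷ q S.* q′) v j)
    (P.+-cong (act-· p q′ v j)
      (P.trans (P.+-congʳ (P.zeroˡ (v j))) (P.trans (P.+-identityˡ _) (Y-cong (act-* q q′ v) j))))

  act-linear : ∀ q p v → act q (λ j → p P.* v j) ≋ (λ j → p P.* act q v j)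
  act-linear []       p v j = P.sym (P.zeroʳ p)
  act-linear (p′ ∷ q) p v j = P.trans
    (P.+-cong (*-swap p′ p (v j)) (P.trans (Y-cong (act-linear q p v) j) (Y-* p (act q v) j)))
    (P.sym (P.distribˡ p _ _))

  act-constant : ∀ p v → act (P[y].constant p) v ≋ (λ j → p P.* v j)
  act-constant p v j = P.trans (P.+-congˡ (Y-0 (λ _ → P.refl) j)) (P.+-identityʳ _)

  act-1 : ∀ v → act S.1# v ≋ v
  act-1 v j = P.trans (act-constant P.1# v j) (P.*-identityˡ (v j))

  act-y : ∀ v → act y v ≋ Y v
  act-y v j = P.trans (P.+-cong (P.zeroˡ (v j)) (Y-cong (act-1 v) j)) (P.+-identityˡ _)

  act-x^ : ∀ k v → act (x ^ k) v ≋ (λ j → X PExp.^ k P.* v j)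
  act-x^ zero    v j = P.trans (act-1 v j) (P.sym (P.*-identityˡ (v j)))
  act-x^ (suc k) v j = P.trans (act-* x (x ^ k) v j)
    (P.trans (act-constant X (act (x ^ k) v) j) (P.trans (P.*-congˡ (act-x^ k v j)) (P.sym (P.*-assoc X _ (v j)))))

  e₀ : P³
  e₀ zero    = P.1#
  e₀ (suc _) = P.0#

  act-y³-xy : ∀ j → act (y ^ 3 S.- x S.* y) e₀ j P.≈ P.0#
  act-y³-xy j = P.trans (act-+ (y ^ 3) (S.- (x S.* y)) e₀ j)
    (P.trans (P.+-congʳ (P.trans (y³ j) (P.sym (xy j))))
      (P.trans (P.sym (act-+ (x S.* y) (S.- (x S.* y)) e₀ j))
        (act-zero (x S.* y S.- x S.* y) e₀ (S.-‿inverseʳ (x S.* y)) j)))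
    where
    y³ : act (y ^ 3) e₀ ≋ Y (Y (Y e₀))
    y³ j = P.trans (act-* y (y ^ 2) e₀ j) (P.trans (act-y _ j) (Y-cong (λ j →
      P.trans (act-* y (y ^ 1) e₀ j) (P.trans (act-y _ j) (Y-cong (λ j →
        P.trans (act-* y (y ^ 0) e₀ j) (P.trans (act-y _ j) (Y-cong (act-1 e₀) j))) j))) j))

    Y³ : Y (Y (Y e₀)) ≋ (λ j → X P.* Y e₀ j)
    Y³ zero             = P.sym (P.zeroʳ X)
    Y³ (suc zero)       = P.+-identityˡ _
    Y³ (suc (suc zero)) = P.+-identityˡ _

    xy : act (x S.* y) e₀ ≋ Y (Y (Y e₀))
    xy j = P.trans (act-* x y e₀ j) (P.trans (act-constant X (act y e₀) j)
      (P.trans (P.*-congˡ (act-y e₀ j)) (P.sym (Y³ j))))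

  act-mod : ∀ n {v w} a b → v S.≈ w S.+ (a S.* x ^ n S.+ b S.* (y ^ 3 S.- x S.* y)) → ∀ j →
            act v e₀ j P.≈ act w e₀ j P.+ X PExp.^ n P.* act a e₀ j
  act-mod n {v} {w} a b e j = begin
    act v e₀ j
      ≈⟨ act-congˡ {v} {w S.+ (a S.* f S.+ b S.* g)} e₀ e j ⟩
    act (w S.+ (a S.* f S.+ b S.* g)) e₀ j
      ≈⟨ act-+ w _ e₀ j ⟩
    act w e₀ j P.+ act (a S.* f S.+ b S.* g) e₀ j
      ≈⟨ P.+-congˡ (act-+ (a S.* f) (b S.* g) e₀ j) ⟩
    act w e₀ j P.+ (act (a S.* f) e₀ j P.+ act (b S.* g) e₀ j)
      ≈⟨ P.+-congˡ (P.+-cong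
           (P.trans (act-* a f e₀ j) (P.trans (act-congʳ a (act-x^ n e₀) j) (act-linear a (X PExp.^ n) e₀ j)))
           (P.trans (act-* b g e₀ j)
             (P.trans (act-congʳ b (λ j → P.trans (act-y³-xy j) (P.sym (P.zeroˡ (e₀ j)))) j)
               (P.trans (act-linear b P.0# e₀ j) (P.zeroˡ _))))) ⟩
    act w e₀ j P.+ (X PExp.^ n P.* act a e₀ j P.+ P.0#)
      ≈⟨ P.+-congˡ (P.+-identityʳ _) ⟩
    act w e₀ j P.+ X PExp.^ n P.* act a e₀ j ∎
    where
    open SetoidReasoning P.setoid
    f g : S.Carrier
    f = x ^ n
    g = y ^ 3 S.- x S.* y

  δₚ : Fin 3 → Fin 3 → P.Carrier
  δₚ j j′ = if does (j Fin.≟ j′) then P.1# else P.0#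

  act-y^ : ∀ j′ → act (y ^ toℕ j′) e₀ ≋ (λ j → δₚ j j′)
  act-y^ = λ { zero → y⁰ ; (suc zero) → y¹ ; (suc (suc zero)) → y² }
    where
    step : ∀ k {u v} → act (y ^ k) e₀ ≋ u → Y u ≋ v → act (y ^ suc k) e₀ ≋ v
    step k p q j = P.trans (act-* y (y ^ k) e₀ j) (P.trans (act-y _ j) (P.trans (Y-cong p j) (q j)))

    y⁰ : act (y ^ 0) e₀ ≋ (λ j → δₚ j zero)
    y⁰ zero             = act-1 e₀ zero
    y⁰ (suc zero)       = act-1 e₀ (suc zero)
    y⁰ (suc (suc zero)) = act-1 e₀ (suc (suc zero))

    y¹ : act (y ^ 1) e₀ ≋ (λ j → δₚ j (suc zero))
    y¹ = step 0 y⁰ λ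
      { zero             → P.refl
      ; (suc zero)       → P.trans (P.+-congˡ (P.zeroʳ X)) (P.+-identityʳ P.1#)
      ; (suc (suc zero)) → P.refl
      }

    y² : act (y ^ 2) e₀ ≋ (λ j → δₚ j (suc (suc zero)))
    y² = step 1 y¹ λ
      { zero             → P.refl
      ; (suc zero)       → P.trans (P.+-identityˡ _) (P.zeroʳ X)
      ; (suc (suc zero)) → P.refl
      }

  act-monomial : ∀ i j′ j → act (x ^ i S.* y ^ toℕ j′) e₀ j P.≈ X PExp.^ i P.* δₚ j j′
  act-monomial i j′ j = P.trans (act-* (x ^ i) (y ^ toℕ j′) e₀ j)
    (P.trans (act-congʳ (x ^ i) (act-y^ j′) j) (act-x^ i (λ j → δₚ j j′) j))

module Coefficients (R : CommutativeRing 0ℓ 0ℓ) where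
  private
    module R = CommutativeRing R
    module R[x] = Polynomials R
    module P = CommutativeRing R[x].polynomialRing
    open Exp P.semiring using (_^_)

    X : P.Carrier
    X = R[x].var

  coeff-X* : ∀ p k → R[x].coeff (X P.* p) (suc k) R.≈ R[x].coeff p k
  coeff-X* p k = R.trans (R[x].coeff-+ (R.0# R[x].· p) (R.0# ∷ P.1# P.* p) (suc k))
    (R.trans (R.+-cong (R.trans (R[x].coeff-· R.0# p (suc k)) (R.zeroˡ _)) (R[x].coeff-cong (P.*-identityˡ p) k))
      (R.+-identityˡ _))

  coeff-X*₀ : ∀ p → R[x].coeff (X P.* p) 0 R.≈ R.0#
  coeff-X*₀ p = R.trans (R[x].coeff-+ (R.0# R[x].· p) (R.0# ∷ P.1# P.* p) 0)
    (R.trans (R.+-identityʳ _) (R.trans (R[x].coeff-· R.0# p 0) (R.zeroˡ _)))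

  coeff-X^* : ∀ {k} (i : Fin k) p → R[x].coeff (X ^ k P.* p) (toℕ i) R.≈ R.0#
  coeff-X^* {suc k} i p = R.trans (R[x].coeff-cong (P.*-assoc X (X ^ k) p) (toℕ i)) (go i)
    where
    go : ∀ (i : Fin (suc k)) → R[x].coeff (X P.* (X ^ k P.* p)) (toℕ i) R.≈ R.0#
    go zero    = coeff-X*₀ (X ^ k P.* p)
    go (suc i) = R.trans (coeff-X* (X ^ k P.* p) (toℕ i)) (coeff-X^* i p)

  coeff-X^ : ∀ {k} (i i′ : Fin k) → R[x].coeff (X ^ toℕ i′) (toℕ i) R.≈ FreeModules.δ R i i′
  coeff-X^ zero    zero     = R.refl
  coeff-X^ (suc i) zero     = R.refl
  coeff-X^ zero    (suc i′) = coeff-X*₀ (X ^ toℕ i′)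
  coeff-X^ (suc i) (suc i′) = R.trans (coeff-X* (X ^ toℕ i′) (toℕ i)) (coeff-X^ i i′)

  tail : P.Carrier → P.Carrier
  tail []      = []
  tail (a ∷ p) = p

  coeff-tail : ∀ p k → R[x].coeff (tail p) k R.≈ R[x].coeff p (suc k)
  coeff-tail []      k = R.refl
  coeff-tail (a ∷ p) k = R.refl

  tail-expansion : ∀ p → p P.≈ R[x].constant (R[x].coeff p 0) P.+ X P.* tail p
  tail-expansion p = R[x].coeffwise λ k → R.sym
    (R.trans (R[x].coeff-+ (R[x].constant (R[x].coeff p 0)) (X P.* tail p) k) (go p k))
    where
    go : ∀ p k → R[x].coeff (R[x].constant (R[x].coeff p 0)) k R.+ R[x].coeff (X P.* tail p) k
                 R.≈ R[x].coeff p k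
    go p       zero    = R.trans (R.+-congˡ (coeff-X*₀ (tail p))) (R.+-identityʳ _)
    go []      (suc k) = R.trans (R.+-identityˡ _) (coeff-X* [] k)
    go (a ∷ p) (suc k) = R.trans (R.+-identityˡ _) (coeff-X* p k)

-- Expansions in powers of an element.

module Expansions (V-ring : CommutativeRing 0ℓ 0ℓ) where
  open CommutativeRing V-ring hiding (zero)
  open Exp semiring using (_^_)
  open SemiringSum semiring
  open SetoidReasoning setoid
  open CommutativeSemigroupProperties *-commutativeSemigroup using (x∙yz≈y∙xz)
  open NaturalCoefficients commutativeSemiring using (solve; _:+_; _:*_; _:=_; con)

  powerExpansion : {A : Set} (x : Carrier) (c : A → ℕ → Carrier) (t : A → A) (f : A → Carrier) →
    (∀ a → f a ≈ c a 0 + x * f (t a)) → (∀ a k → c (t a) k ≈ c a (suc k)) →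
    ∀ n → x ^ n ≈ 0# → ∀ a → f a ≈ sum {n} (λ i → c a (toℕ i) * x ^ toℕ i)
  powerExpansion {A} x c t f unfold c-t n xⁿ≈0 a =
    let (b , e) = go n a in trans e (trans (+-congˡ (trans (*-congʳ xⁿ≈0) (zeroˡ (f b)))) (+-identityʳ _))
    where
    go : ∀ k a → ∃ λ b → f a ≈ sum {k} (λ i → c a (toℕ i) * x ^ toℕ i) + x ^ k * f b
    go zero    a = a , sym (trans (+-identityˡ _) (*-identityˡ (f a)))
    go (suc k) a = let (b , e) = go k (t a) in b , (begin
      f a
        ≈⟨ unfold a ⟩
      c a 0 + x * f (t a)
        ≈⟨ +-cong (sym (*-identityʳ _)) (*-congˡ e) ⟩
      c a 0 * x ^ 0 + x * (sum {k} (λ i → c (t a) (toℕ i) * x ^ toℕ i) + x ^ k * f b)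
        ≈⟨ +-congˡ (distribˡ x _ _) ⟩
      c a 0 * x ^ 0 + (x * sum {k} (λ i → c (t a) (toℕ i) * x ^ toℕ i) + x * (x ^ k * f b))
        ≈⟨ +-congˡ (+-cong (*-distribˡ-sum {k} x _) (sym (*-assoc x _ _))) ⟩
      c a 0 * x ^ 0 + (sum {k} (λ i → x * (c (t a) (toℕ i) * x ^ toℕ i)) + x ^ suc k * f b)
        ≈⟨ +-congˡ (+-congʳ (sum-cong-≋ {k} (λ i → trans (x∙yz≈y∙xz x _ _) (*-congʳ (c-t a (toℕ i)))))) ⟩
      c a 0 * x ^ 0 + (sum {k} (λ i → c a (suc (toℕ i)) * x ^ suc (toℕ i)) + x ^ suc k * f b)
        ≈⟨ +-assoc _ _ _ ⟨
      sum {suc k} (λ i → c a (toℕ i) * x ^ toℕ i) + x ^ suc k * f b ∎)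

  embed : Carrier → (Fin 3 → Carrier) → Carrier
  embed y v = sum {3} (λ j → v j * y ^ toℕ j)

  embed-+ : ∀ y u v → embed y (λ j → u j + v j) ≈ embed y u + embed y v
  embed-+ y u v = trans (sum-cong-≋ {3} (λ j → distribʳ (y ^ toℕ j) (u j) (v j)))
    (∑-distrib-+ {3} (λ j → u j * y ^ toℕ j) (λ j → v j * y ^ toℕ j))

  embed-0 : ∀ y v → (∀ j → v j ≈ 0#) → embed y v ≈ 0#
  embed-0 y v v≈0 = trans (sum-cong-≋ {3} (λ j → trans (*-congʳ (v≈0 j)) (zeroˡ (y ^ toℕ j))))
    (sum-replicate-zero 3)

  embed-constant : ∀ y v c → v zero ≈ c → (∀ j → v (suc j) ≈ 0#) → embed y v ≈ c
  embed-constant y v c v₀≈c v≈0 = trans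
    (+-cong (trans (*-identityʳ (v zero)) v₀≈c)
      (trans (sum-cong-≋ {2} (λ j → trans (*-congʳ (v≈0 j)) (zeroˡ (y ^ suc (toℕ j))))) (sum-replicate-zero 2)))
    (+-identityʳ c)

  -- The left-hand side has the coordinates of Y v.
  embed-Y : ∀ x y → y ^ 3 ≈ x * y → ∀ a b c →
            0# * 1# + ((a + x * c) * (y * 1#) + (b * (y * (y * 1#)) + 0#)) ≈
            y * (a * 1# + (b * (y * 1#) + (c * (y * (y * 1#)) + 0#)))
  embed-Y x y y³≈xy a b c = begin
    0# * 1# + ((a + x * c) * (y * 1#) + (b * (y * (y * 1#)) + 0#))
      ≈⟨ solve 5 (λ a b c x y →
           con 0 :* con 1 :+ ((a :+ x :* c) :* (y :* con 1) :+ (b :* (y :* (y :* con 1)) :+ con 0)) :=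
           (a :* y :+ b :* y :* y) :+ c :* (x :* y)) refl a b c x y ⟩
    (a * y + b * y * y) + c * (x * y)
      ≈⟨ +-congˡ (*-congˡ y³≈xy) ⟨
    (a * y + b * y * y) + c * (y ^ 3)
      ≈⟨ solve 4 (λ a b c y →
           (a :* y :+ b :* y :* y) :+ c :* (y :* (y :* (y :* con 1))) :=
           y :* (a :* con 1 :+ (b :* (y :* con 1) :+ (c :* (y :* (y :* con 1)) :+ con 0)))) refl a b c y ⟩
    y * (a * 1# + (b * (y * 1#) + (c * (y * (y * 1#)) + 0#))) ∎

  doubleExpansion : ∀ n x y (v : Fin 3 → Carrier) (c : Fin n → Fin 3 → Carrier) →
    (∀ j → v j ≈ sum {n} (λ i → c i j * x ^ toℕ i)) →
    embed y v ≈ sum {n} (λ i → sum {3} (λ j → c i j * (x ^ toℕ i * y ^ toℕ j)))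
  doubleExpansion n x y v c e = begin
    sum {3} (λ j → v j * y ^ toℕ j)
      ≈⟨ sum-cong-≋ {3} (λ j → *-congʳ {y ^ toℕ j} (e j)) ⟩
    sum {3} (λ j → sum {n} (λ i → c i j * x ^ toℕ i) * y ^ toℕ j)
      ≈⟨ sum-cong-≋ {3} (λ j → *-distribʳ-sum {n} (y ^ toℕ j) (λ i → c i j * x ^ toℕ i)) ⟩
    sum {3} (λ j → sum {n} (λ i → c i j * x ^ toℕ i * y ^ toℕ j))
      ≈⟨ sum-cong-≋ {3} (λ j → sum-cong-≋ {n} (λ i → *-assoc (c i j) (x ^ toℕ i) (y ^ toℕ j))) ⟩
    sum {3} (λ j → sum {n} (λ i → c i j * (x ^ toℕ i * y ^ toℕ j)))
      ≈⟨ ∑-comm {3} {n} (λ j i → c i j * (x ^ toℕ i * y ^ toℕ j)) ⟩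
    sum {n} (λ i → sum {3} (λ j → c i j * (x ^ toℕ i * y ^ toℕ j))) ∎

-- A ring homomorphism R → S makes S an R-module.

module RestrictScalars (R S : CommutativeRing 0ℓ 0ℓ) where
  private
    module R = CommutativeRing R
    module S = CommutativeRing S

  module _ (φ : R.Carrier → S.Carrier) (hom : IsRingHomomorphism R.rawRing S.rawRing φ) where
    private
      open IsRingHomomorphism hom

      abstract
        isLeftModule-restrict : IsLeftModule R.ring S._≈_ S._+_ S.0# S.-_ (λ r s → φ r S.* s)
        isLeftModule-restrict = record
          { isLeftSemimodule = record
            { +ᴹ-isCommutativeMonoid = S.+-isCommutativeMonoid
            ; isPreleftSemimodule    = record
              { *ₗ-cong      = λ p q → S.*-cong (⟦⟧-cong p) q
              ; *ₗ-zeroˡ     = λ s → S.trans (S.*-congʳ 0#-homo) (S.zeroˡ s)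
              ; *ₗ-distribʳ  = λ s r r′ → S.trans (S.*-congʳ (+-homo r r′)) (S.distribʳ s _ _)
              ; *ₗ-identityˡ = λ s → S.trans (S.*-congʳ 1#-homo) (S.*-identityˡ s)
              ; *ₗ-assoc     = λ r r′ s → S.trans (S.*-congʳ (*-homo r r′)) (S.*-assoc _ _ s)
              ; *ₗ-zeroʳ     = λ r → S.zeroʳ (φ r)
              ; *ₗ-distribˡ  = λ r → S.distribˡ (φ r)
              }
            }
          ; -ᴹ‿cong    = S.-‿cong
          ; -ᴹ‿inverse = S.-‿inverse
          }

    restrictScalars : LeftModule R.ring 0ℓ 0ℓ
    restrictScalars = record { isLeftModule = isLeftModule-restrict }

-- Stated over any R with elements 3n and 1/3n, to be instantiated with R = ℤ[1/(3n)].

module TruncatedAlgebra (R : CommutativeRing 0ℓ 0ℓ) (n : ℕ) (3n 1/3n : CommutativeRing.Carrier R) where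
  private
    module R = CommutativeRing R
    module R[x] = Polynomials R
    module P = CommutativeRing R[x].polynomialRing
    module R[x,y] = Polynomials R[x].polynomialRing
    module S = CommutativeRing R[x,y].polynomialRing
    module SExp = Exp S.semiring

  x y : S.Carrier
  x = R[x,y].constant R[x].var
  y = R[x,y].var

  private module Q = Quotient R[x,y].polynomialRing (x SExp.^ n) (y SExp.^ 3 S.- x S.* y)

  V-ring : CommutativeRing 0ℓ 0ℓ
  V-ring = Q.quotientRing

  open CommutativeRing V-ring using (_+_; _*_; -_; 0#; 1#) renaming (Carrier to V; _≈_ to _≈ᵥ_)
  private module V = CommutativeRing V-ring
  open Exp V.semiring using (_^_)

  scalar : R.Carrier → V
  scalar r = R[x,y].constant (R[x].constant r)

  private
    open Q using (≈⇒∼)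

    abstract
      scalar-hom : IsRingHomomorphism R.rawRing V.rawRing scalar
      scalar-hom = record
        { isSemiringHomomorphism = record
          { isNearSemiringHomomorphism = record
            { +-isMonoidHomomorphism = record
              { isMagmaHomomorphism = record
                { isRelHomomorphism = record
                  { cong = λ e → ≈⇒∼ (R[x,y].∷-cong (R[x].∷-cong e P.refl) S.refl) }
                ; homo = λ a b → V.refl
                }
              ; ε-homo = ≈⇒∼ (S.trans (R[x,y].∷-cong (R[x].0∷-zero P.refl) S.refl) (R[x,y].0∷-zero S.refl))
              }
            ; *-homo = λ a b → ≈⇒∼ (S.sym (S.trans
                (R[x,y].∷-cong (P.trans (P.+-identityʳ _)
                  (R[x].∷-cong (R.+-identityʳ _) P.refl)) S.refl) S.refl))
            }
          ; 1#-homo = V.refl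
          }
        ; -‿homo = λ a → V.refl
        }

  V-module : LeftModule R.ring 0ℓ 0ℓ
  V-module = RestrictScalars.restrictScalars R V-ring scalar scalar-hom

  -- Powers in R[x,y] and in its quotient V are computed in the same way.

  ^-agree : ∀ v k → v SExp.^ k ≡ v ^ k
  ^-agree v zero    = ≡.refl
  ^-agree v (suc k) = cong (v *_) (^-agree v k)

  -- V is free on the monomials xⁱyʲ with i < n and j < 3.

  open FreeModules R

  private
    open Action R[x].polynomialRing R[x].var
    open Coefficients R
    module E = Expansions V-ring
    module PExp = Exp P.semiring
    module V-sum = SemiringSum V.semiring

    coord : Fin n → Fin 3 → V → R.Carrier
    coord i j v = R[x].coeff (act v e₀ j) (toℕ i)

    coord-cong : ∀ i j {v w} → v ≈ᵥ w → coord i j v R.≈ coord i j w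
    coord-cong i j {v} {w} v∼w@(Q.congruent a b _) = R.trans
      (R[x].coeff-cong (act-mod n {v} {w} a b (Q.∼⇒ v∼w) j) (toℕ i))
      (R.trans (R[x].coeff-+ (act w e₀ j) (R[x].var PExp.^ n P.* act a e₀ j) (toℕ i))
        (R.trans (R.+-congˡ (coeff-X^* i (act a e₀ j))) (R.+-identityʳ _)))

    coord-+ : ∀ i j v w → coord i j (v + w) R.≈ coord i j v R.+ coord i j w
    coord-+ i j v w = R.trans (R[x].coeff-cong (act-+ v w e₀ j) (toℕ i))
                              (R[x].coeff-+ (act v e₀ j) (act w e₀ j) (toℕ i))

    coord-* : ∀ i j r v → coord i j (scalar r * v) R.≈ r R.* coord i j v
    coord-* i j r v = R.trans
      (R[x].coeff-cong (P.trans (act-* (scalar r) v e₀ j)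
        (P.trans (act-constant (R[x].constant r) (act v e₀) j) (R[x].constant-* r (act v e₀ j)))) (toℕ i))
      (R[x].coeff-· r (act v e₀ j) (toℕ i))

    coordₘ : Fin n → Fin 3 → V-module ⟶ R-module
    coordₘ i j = linear (coord i j) (coord-cong i j) (coord-+ i j) (coord-* i j)

  monomial : Fin n → Fin 3 → V
  monomial i j = x ^ toℕ i * y ^ toℕ j

  private
    coord-dual : ∀ i j i′ j′ → coord i j (monomial i′ j′) R.≈ δ i i′ R.* δ j j′
    coord-dual i j i′ j′ = R.trans
      (R.reflexive (≡.cong₂ (λ u v → coord i j (u * v)) (≡.sym (^-agree x (toℕ i′))) (≡.sym (^-agree y (toℕ j′)))))
      (R.trans (R[x].coeff-cong (act-monomial (toℕ i′) j′ j) (toℕ i)) go)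
      where
      go : R[x].coeff (R[x].var PExp.^ toℕ i′ P.* δₚ j j′) (toℕ i) R.≈ δ i i′ R.* δ j j′
      go with does (j Fin.≟ j′)
      ... | true  = R.trans (R[x].coeff-cong (P.*-identityʳ (R[x].var PExp.^ toℕ i′)) (toℕ i))
                      (R.trans (coeff-X^ i i′) (R.sym (R.*-identityʳ _)))
      ... | false = R.trans (R[x].coeff-cong (P.zeroʳ (R[x].var PExp.^ toℕ i′)) (toℕ i)) (R.sym (R.zeroʳ _))

    C : P.Carrier → V
    C = R[x,y].constant

    C-* : ∀ p q → C (p P.* q) ≈ᵥ C p * C q
    C-* p q = ≈⇒∼ (S.sym (R[x,y].constant-* p (C q)))

    C-cong : ∀ {p q} → p P.≈ q → C p ≈ᵥ C q
    C-cong e = ≈⇒∼ (R[x,y].∷-cong e S.refl)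

    C-0 : C P.0# ≈ᵥ 0#
    C-0 = ≈⇒∼ (R[x,y].0∷-zero S.refl)

    xⁿ≈0 : x ^ n ≈ᵥ 0#
    xⁿ≈0 = V.trans (V.sym (V.reflexive (^-agree x n))) Q.f∼0

    y³≈xy : y ^ 3 ≈ᵥ x * y
    y³≈xy = Q.g-relation S.refl

    C-expansion : ∀ p → C p ≈ᵥ V-sum.sum {n} (λ i → scalar (R[x].coeff p (toℕ i)) * x ^ toℕ i)
    C-expansion = E.powerExpansion x (λ p k → scalar (R[x].coeff p k)) tail C
      (λ p → V.trans (C-cong (tail-expansion p))
        (V.+-congˡ {scalar (R[x].coeff p 0)} (C-* R[x].var (tail p))))
      (λ p k → IsRingHomomorphism.⟦⟧-cong scalar-hom (coeff-tail p k)) n xⁿ≈0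

    embedₘ : (Fin 3 → P.Carrier) → V
    embedₘ v = E.embed y (λ j → C (v j))

    embedₘ-Y : ∀ v → embedₘ (Y v) ≈ᵥ y * embedₘ v
    embedₘ-Y v = V.trans
      (V.+-cong {C P.0# * 1#} {0# * 1#} (V.*-congʳ {1#} C-0)
        (V.+-congʳ {C (v (suc zero)) * (y * (y * 1#)) + 0#}
          (V.*-congʳ {y * 1#} (V.+-congˡ {C (v zero)} (C-* R[x].var (v (suc (suc zero))))))))
      (E.embed-Y x y y³≈xy (C (v zero)) (C (v (suc zero))) (C (v (suc (suc zero)))))

    embedₘ-e₀ : ∀ p → embedₘ (λ j → p P.* e₀ j) ≈ᵥ C p
    embedₘ-e₀ p = E.embed-constant y (λ j → C (p P.* e₀ j)) (C p)
      (C-cong (P.*-identityʳ p)) (λ j → V.trans (C-cong (P.zeroʳ p)) C-0)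

    embedₘ-act : ∀ v → v ≈ᵥ embedₘ (act v e₀)
    embedₘ-act []      = V.sym (E.embed-0 y (λ _ → C P.0#) (λ _ → C-0))
    embedₘ-act (p ∷ q) = V.trans
      (≈⇒∼ (Coefficients.tail-expansion R[x].polynomialRing (p ∷ q)))
      (V.trans (V.+-cong {C p} {embedₘ (λ j → p P.* e₀ j)} {y * q} {embedₘ (Y (act q e₀))}
          (V.sym (embedₘ-e₀ p))
          (V.trans (V.*-congˡ {y} (embedₘ-act q)) (V.sym (embedₘ-Y (act q e₀)))))
        (V.sym (E.embed-+ y (λ j → C (p P.* e₀ j)) (λ j → C (Y (act q e₀) j)))))

    expansion : ∀ v → v ≈ᵥ V-sum.sum {n} (λ i → V-sum.sum {3} (λ j → scalar (coord i j v) * monomial i j))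
    expansion v = V.trans (embedₘ-act v)
      (E.doubleExpansion n x y (λ j → C (act v e₀ j)) (λ i j → scalar (coord i j v))
        (λ j → C-expansion (act v e₀ j)))

  V-basis : Basis V-module
  V-basis = productBasis V-module n 3 monomial coordₘ coord-dual expansion

  V-free : FreeModule
  V-free = record { mod = V-module ; hasBasis = V-basis }

  μ : V-module ⊗ᴹ V-module ⟶ V-module
  μ = lift (bilinear _*_ V.*-cong
    (λ v v′ w → V.distribʳ w v v′)
    (λ r v w → V.*-assoc (scalar r) v w)
    V.distribˡ
    (λ r v w → x∙yz≈y∙xz v (scalar r) w))
    where open CommutativeSemigroupProperties V.*-commutativeSemigroup using (x∙yz≈y∙xz)

  η : R-module ⟶ V-module
  η = linear scalar ⟦⟧-cong +-homo *-homo
    where open IsRingHomomorphism scalar-hom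

  ε : V-module ⟶ R-module
  ε = extend V-basis R-module λ l → let (i , j) = remQuot {n} 3 l in
    if (toℕ i ≡ᵇ n ∸ 1) ∧ (toℕ j ≡ᵇ 2) then 3n else R.0#

  mulʳ : V → V-module ⟶ V-module
  mulʳ a = linear (_* a) V.*-congʳ (λ v w → V.distribʳ a v w) (λ r v → V.*-assoc (scalar r) v a)

  -- In the first sum i = k + 1 and j = n - i, so that i and j range over the
  -- positive integers with i + j = n.
  Δ : V-module ⟶ V-module ⊗ᴹ V-module
  Δ = record
    { to = λ v →
        (R.- 1/3n) *ₜ (∑[ k < n ∸ 1 ] let i = suc (toℕ k) ; j = n ∸ i in
          (v * x ^ i) ⊗ x ^ j)
        +ₜ
        1/3n *ₜ (∑[ k < n ] let i = toℕ k ; j = n ∸ 1 ∸ i in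
          (v * (x ^ i * y ^ 2)) ⊗ x ^ j +ₜ (v * (x ^ i * y)) ⊗ (x ^ j * y) +ₜ (v * x ^ i) ⊗ (x ^ j * y ^ 2))
    ; isLeftModuleHomomorphism = _⟶_.isLeftModuleHomomorphism
        ((R.- 1/3n) *ₕ sumₕ {k = n ∸ 1} (λ k → let i = suc (toℕ k) ; j = n ∸ i in
          mulʳ (x ^ i) ⊗ₕ x ^ j)
        +ₕ
        1/3n *ₕ sumₕ {k = n} (λ k → let i = toℕ k ; j = n ∸ 1 ∸ i in
          mulʳ (x ^ i * y ^ 2) ⊗ₕ x ^ j +ₕ mulʳ (x ^ i * y) ⊗ₕ (x ^ j * y) +ₕ mulʳ (x ^ i) ⊗ₕ (x ^ j * y ^ 2)))
    }
    where
    open Combination (V-module ⊗ᴹ V-module) using (sum-syntax)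
    open InternalHom V-module (V-module ⊗ᴹ V-module) using (_+ₕ_; _*ₕ_)
    infix 7 _⊗ₕ_
    _⊗ₕ_ : V-module ⟶ V-module → V → V-module ⟶ V-module ⊗ᴹ V-module
    f ⊗ₕ w = (-⊗ w) ∘ₕ f

  φ : V
  φ = if n % 2 ≡ᵇ 0 then x ^ ((n ∸ 2) / 2) * y ^ 2 else x ^ ((n ∸ 1) / 2) * y

  m : V-module ⟶ V-module
  m = mulʳ φ

module MöbiusV (n : ℕ) .{{_ : NonZero n}} where
  private
    instance
      3*n≢0 : NonZero (3 ℕ.* n)
      3*n≢0 = ℕ.m*n≢0 3 n

    module L = Localization (3 ℕ.* n)

  ℤ[1/3n] : CommutativeRing 0ℓ 0ℓ
  ℤ[1/3n] = L.localization

  open FreeModules ℤ[1/3n] public using (RMod; RMod-monoidal; RMod-symmetric)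

  private
    module T = TruncatedAlgebra ℤ[1/3n] n (L.fromℤ (+ (3 ℕ.* n))) L.1/N
    open Category RMod
    open Monoidal RMod-monoidal

  V : Obj
  V = T.V-free

  μ : V ⊗₀ V ⇒ V
  μ = T.μ

  η : unit ⇒ V
  η = T.η

  Δ : V ⇒ V ⊗₀ V
  Δ = T.Δ

  ε : V ⇒ unit
  ε = T.ε

  m : V ⇒ V
  m = T.m

{-# OPTIONS --safe #-}
module Submission where

-- Δ is multiplication by the element Δ(1) of V ⊗ V. If Δ(1) is central, in the sense that
-- (w ⊗ 1)Δ(1) = (1 ⊗ w)Δ(1), then the Frobenius relations hold; coassociativity and the counit laws follow
-- from them, the counit laws needing a check at 1 only. Centrality is multiplicative and linear in w, so it
-- is enough to take w = x, where the sums telescope because xⁿ = 0, and w = y, where y³ = xy makes the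
-- boundary terms cancel. Finally both sides of the Möbius relation vanish: with φ = m(1), already
-- φ x^(n-1) y² and φ³ are multiples of xⁿ.

open import Defs
open import Algebra.Bundles using (CommutativeRing)
open import Algebra.Core using (Op₂)
open import Algebra.Module.Bundles using (LeftModule)
open import Algebra.Structures using (IsCommutativeRing)
open import Data.Bool.Base using (T; true; false; if_then_else_; _∧_)
open import Data.Fin.Base as Fin using (Fin; zero; suc; toℕ; fromℕ<; combine; remQuot)
open import Data.Integer.Base as ℤ using (+_)
open import Data.Nat.Base as ℕ using (ℕ; zero; suc; NonZero; _∸_; _/_; _%_; _≡ᵇ_)
open import Data.Product.Base using (∃₂; _×_; _,_; proj₁; proj₂; uncurry)
open import Level using (0ℓ)
open import Relation.Binary.PropositionalEquality as ≡ using (_≡_; cong)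
open import Relation.Nullary using (yes; no; contradiction)

import Algebra.Properties.Semiring.Exp as Exp
import Algebra.Solver.Ring.NaturalCoefficients.Default as NaturalCoefficients
import Data.Fin.Properties as Fin
import Data.Integer.Properties as ℤ
import Data.Nat.DivMod as ℕ
import Data.Nat.Properties as ℕ
import Relation.Binary.Reasoning.Setoid as SetoidReasoning

-- Parity bounds for the exponents of x in φ³.

even⇒≤3*half : ∀ k → k % 2 ≡ 0 → let h = k / 2 in k ℕ.≤ h ℕ.+ h ℕ.+ h
even⇒≤3*half k e = begin
  k                     ≡⟨ ℕ.m≡m%n+[m/n]*n k 2 ⟩
  k % 2 ℕ.+ h ℕ.* 2     ≡⟨ cong (ℕ._+ h ℕ.* 2) e ⟩
  h ℕ.* 2               ≡⟨ ℕ.*-comm h 2 ⟩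
  h ℕ.+ (h ℕ.+ 0)       ≡⟨ cong (h ℕ.+_) (ℕ.+-identityʳ h) ⟩
  h ℕ.+ h               ≤⟨ ℕ.m≤m+n (h ℕ.+ h) h ⟩
  h ℕ.+ h ℕ.+ h         ∎
  where
  open ℕ.≤-Reasoning
  h : ℕ
  h = k / 2

-- For even n = `suc k`, φ³ has x-exponent 3h and y-exponent 6; since y⁶ = x²y², the exponent that
-- must reach n is 3h + 2, where n = 2h + 2.
even-bound : ∀ k → (suc k % 2 ≡ᵇ 0) ≡ true → let h = (suc k ∸ 2) / 2 in suc k ℕ.≤ suc (suc (h ℕ.+ h ℕ.+ h))
even-bound (suc k) e = ℕ.s≤s (ℕ.s≤s (even⇒≤3*half k (ℕ.≡ᵇ⇒≡ (k % 2) 0 (≡.subst T (≡.sym e) _))))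

-- For odd n = `suc k`, y³ = xy turns φ³ into x^(3h+1) y, where n = 2h + 1.
odd-bound : ∀ k → (suc k % 2 ≡ᵇ 0) ≡ false → let h = k / 2 in suc k ℕ.≤ suc (h ℕ.+ h ℕ.+ h)
odd-bound k e = ℕ.s≤s (even⇒≤3*half k (pred-even k e))
  where
  pred-even : ∀ k → (suc k % 2 ≡ᵇ 0) ≡ false → k % 2 ≡ 0
  pred-even zero          _ = ≡.refl
  pred-even (suc (suc k)) e = pred-even k e

-- Linear maps determined on a basis.

module BasisLemmas (R : CommutativeRing 0ℓ 0ℓ) where
  private module R = CommutativeRing R
  open FreeModules R
  open _⟶_ using (to; ⟦⟧-cong; *ₗ-homo)

  basis-ext : ∀ {M N} (B : Basis M) (f g : M ⟶ N) →
    (∀ i → LeftModule._≈ᴹ_ N (to f (Basis.basis B i)) (to g (Basis.basis B i))) → f ≈ₕ g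
  basis-ext {M} {N} B f g e v = begin
    to f v                          ≈⟨ ⟦⟧-cong f (expansion v) ⟩
    to f (linComb (coords v) basis) ≈⟨ to-linComb f ⟩
    sum (λ i → coords v i *ₗ to f (basis i)) ≈⟨ sum-cong-≋ (λ i → *ₗ-congˡ (e i)) ⟩
    sum (λ i → coords v i *ₗ to g (basis i)) ≈⟨ to-linComb g ⟨
    to g (linComb (coords v) basis) ≈⟨ ⟦⟧-cong g (expansion v) ⟨
    to g v                          ∎
    where
    open Basis B
    open Combination M using (linComb)
    open Combination N using (sum; sum-cong-≋)
    open LeftModule N
    open SetoidReasoning ≈ᴹ-setoid
    to-linComb : (h : M ⟶ N) → to h (linComb (coords v) basis) ≈ᴹ sum (λ i → coords v i *ₗ to h (basis i))
    to-linComb h = ≈ᴹ-trans (to-sum h {rank} _) (sum-cong-≋ (λ i → *ₗ-homo h (coords v i) (basis i)))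

  δ-sym : ∀ {k} (i j : Fin k) → δ i j ≡ δ j i
  δ-sym i j with i Fin.≟ j | j Fin.≟ i
  ... | yes _   | yes _   = ≡.refl
  ... | no  _   | no  _   = ≡.refl
  ... | yes i≡j | no  j≢i = contradiction (≡.sym i≡j) j≢i
  ... | no  i≢j | yes j≡i = contradiction (≡.sym j≡i) i≢j

  extend-basis : ∀ {M} (B : Basis M) (f : Fin (Basis.rank B) → R.Carrier) →
    ∀ l → to (extend B R-module f) (Basis.basis B l) R.≈ f l
  extend-basis B f l = R.trans
    -- `coords-dual` yields the delta with the summation index first, whereas `sum-δ` expects it
    -- second.
    (sum-cong-≋ (λ i → R.trans (R.*-comm _ _)
      (R.*-congˡ (R.trans (coords-dual B i l) (R.reflexive (δ-sym i l))))))
    (sum-δ f l)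
    where open Combination R-module using (sum-cong-≋)

-- Coalgebra laws derived from the Frobenius relations and the unit.

module FrobeniusAtUnit (R : CommutativeRing 0ℓ 0ℓ) where
  private module R = CommutativeRing R
  open FreeModules R
  open _⟶_ using (to; ⟦⟧-cong)

  module Coalgebra {M : Mod} (μ : M ⊗ᴹ M ⟶ M) (e : LeftModule.Carrierᴹ M) (Δ : M ⟶ M ⊗ᴹ M)
    (frobeniusˡ : ∀ v w → _≈ₜ_ M M (to (⊗-map idₕ μ) (to associator (to Δ v ⊗ w))) (to Δ (to μ (v ⊗ w))))
    (frobeniusʳ : ∀ v w → _≈ₜ_ M M (to (⊗-map μ idₕ) (to associator⁻¹ (v ⊗ to Δ w))) (to Δ (to μ (v ⊗ w))))
    (identityˡ : ∀ v → LeftModule._≈ᴹ_ M (to μ (e ⊗ v)) v)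
    (identityʳ : ∀ v → LeftModule._≈ᴹ_ M (to μ (v ⊗ e)) v)
    where

    open LeftModule M using (≈ᴹ-refl)
    open LeftModule (M ⊗ᴹ M) using () renaming (_≈ᴹ_ to _≈₂_)

    private
      -- (c ⊗ d) ⊗ (a ⊗ b) ↦ c ⊗ (d a ⊗ b)
      contract : (M ⊗ᴹ M) ⊗ᴹ (M ⊗ᴹ M) ⟶ M ⊗ᴹ (M ⊗ᴹ M)
      contract = ⊗-map idₕ (⊗-map μ idₕ ∘ₕ associator⁻¹) ∘ₕ associator

      Δ-as-left : ∀ v → to (⊗-map μ idₕ) (to associator⁻¹ (v ⊗ to Δ e)) ≈₂ to Δ v
      Δ-as-left v = transₜ (frobeniusʳ v e) (⟦⟧-cong Δ (identityʳ v))

      Δ-as-right : ∀ v → to (⊗-map idₕ μ) (to associator (to Δ e ⊗ v)) ≈₂ to Δ v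
      Δ-as-right v = transₜ (frobeniusˡ e v) (⟦⟧-cong Δ (identityˡ v))

      -- On c ⊗ d both sides give c ⊗ (da ⊗ b).
      rightMul-associator : ∀ a b →
        associator ∘ₕ (-⊗ b) ∘ₕ ⊗-map idₕ μ ∘ₕ associator ∘ₕ (-⊗ a) ≈ₕ contract ∘ₕ (-⊗ (a ⊗ b))
      rightMul-associator a b = ⊗-ext
        {f = associator ∘ₕ (-⊗ b) ∘ₕ ⊗-map idₕ μ ∘ₕ associator ∘ₕ (-⊗ a)} {contract ∘ₕ (-⊗ (a ⊗ b))}
        (λ c d → reflₜ)

      -- On a ⊗ b the left side is Δ(va) ⊗ b, reassociated, and Δ(va) = Δ(v)(1 ⊗ a) by the left
      -- Frobenius relation.
      Δ-first : ∀ v → associator ∘ₕ ⊗-map Δ idₕ ∘ₕ ⊗-map μ idₕ ∘ₕ associator⁻¹ ∘ₕ (v ⊗-) ≈ₕ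
                      contract ∘ₕ (to Δ v ⊗-)
      Δ-first v = ⊗-ext
        {f = associator ∘ₕ ⊗-map Δ idₕ ∘ₕ ⊗-map μ idₕ ∘ₕ associator⁻¹ ∘ₕ (v ⊗-)} {contract ∘ₕ (to Δ v ⊗-)}
        (λ a b → transₜ (⟦⟧-cong associator (⊗-cong (symₜ (frobeniusˡ v a)) ≈ᴹ-refl))
                        (rightMul-associator a b (to Δ v)))

      Δ-second : ⊗-map idₕ Δ ≈ₕ contract ∘ₕ (-⊗ to Δ e)
      Δ-second = ⊗-ext {f = ⊗-map idₕ Δ} {contract ∘ₕ (-⊗ to Δ e)}
        (λ c d → ⊗-cong ≈ᴹ-refl (symₜ (Δ-as-left d)))

    -- Both sides equal `contract` applied to Δ(v) ⊗ Δ(e). On the left, the inner Δ(v) is first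
    -- replaced by (v ⊗ 1)Δ(e); on the right, the outer Δ is expanded in this way on every second
    -- factor.
    coassoc : associator ∘ₕ ⊗-map Δ idₕ ∘ₕ Δ ≈ₕ ⊗-map idₕ Δ ∘ₕ Δ
    coassoc v = transₜ
      (⟦⟧-cong (associator ∘ₕ ⊗-map Δ idₕ) (symₜ (Δ-as-left v)))
      (transₜ (Δ-first v (to Δ e)) (symₜ (Δ-second (to Δ v))))

    module _ (ε : M ⟶ R-module) where
      private
        module RM = LeftModule (R-module ⊗ᴹ M)
        module MR = LeftModule (M ⊗ᴹ R-module)

        ε-right : ∀ v → ⊗-map ε idₕ ∘ₕ ⊗-map idₕ μ ∘ₕ associator ∘ₕ (-⊗ v) ≈ₕ
                        ⊗-map idₕ μ ∘ₕ associator ∘ₕ (-⊗ v) ∘ₕ ⊗-map ε idₕ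
        ε-right v = ⊗-ext {f = ⊗-map ε idₕ ∘ₕ ⊗-map idₕ μ ∘ₕ associator ∘ₕ (-⊗ v)}
          {⊗-map idₕ μ ∘ₕ associator ∘ₕ (-⊗ v) ∘ₕ ⊗-map ε idₕ} (λ _ _ → reflₜ)

        ε-left : ∀ v → ⊗-map idₕ ε ∘ₕ ⊗-map μ idₕ ∘ₕ associator⁻¹ ∘ₕ (v ⊗-) ≈ₕ
                       ⊗-map μ idₕ ∘ₕ associator⁻¹ ∘ₕ (v ⊗-) ∘ₕ ⊗-map idₕ ε
        ε-left v = ⊗-ext {f = ⊗-map idₕ ε ∘ₕ ⊗-map μ idₕ ∘ₕ associator⁻¹ ∘ₕ (v ⊗-)}
          {⊗-map μ idₕ ∘ₕ associator⁻¹ ∘ₕ (v ⊗-) ∘ₕ ⊗-map idₕ ε} (λ _ _ → reflₜ)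

      -- Writing Δ(v) as Δ(e)(1 ⊗ v), the counit acts on the first factor and v on the second. The
      -- two operations commute, so only the value at e matters.
      coidentityˡ : to (⊗-map ε idₕ) (to Δ e) RM.≈ᴹ R.1# ⊗ e → ⊗-map ε idₕ ∘ₕ Δ ≈ₕ unitorˡ⁻¹
      coidentityˡ ε-e v = transₜ (⟦⟧-cong (⊗-map ε idₕ) (symₜ (Δ-as-right v)))
        (transₜ (ε-right v (to Δ e))
          (transₜ (⟦⟧-cong (⊗-map idₕ μ ∘ₕ associator ∘ₕ (-⊗ v)) ε-e) (⊗-cong R.refl (identityˡ v))))

      coidentityʳ : to (⊗-map idₕ ε) (to Δ e) MR.≈ᴹ e ⊗ R.1# → ⊗-map idₕ ε ∘ₕ Δ ≈ₕ unitorʳ⁻¹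
      coidentityʳ ε-e v = transₜ (⟦⟧-cong (⊗-map idₕ ε) (symₜ (Δ-as-left v)))
        (transₜ (ε-left v (to Δ e))
          (transₜ (⟦⟧-cong (⊗-map μ idₕ ∘ₕ associator⁻¹ ∘ₕ (v ⊗-)) ε-e) (⊗-cong (identityʳ v) R.refl)))

-- The ring shares its equality and addition with the module, so ring identities apply directly to
-- the factors of a tensor.
IsCommutativeRingOn : (R : CommutativeRing 0ℓ 0ℓ) (M : FreeModules.Mod R) →
  Op₂ (LeftModule.Carrierᴹ M) → LeftModule.Carrierᴹ M → Set
IsCommutativeRingOn R M _∙_ e = IsCommutativeRing _≈ᴹ_ _+ᴹ_ _∙_ -ᴹ_ 0ᴹ e
  where open LeftModule M

-- Convolution sums of powers of x in the tensor square.

module CasimirSums (R : CommutativeRing 0ℓ 0ℓ) (V : FreeModules.FreeModule R)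
  {_∙_ : Op₂ (LeftModule.Carrierᴹ (FreeModules.FreeModule.mod V))}
  {e : LeftModule.Carrierᴹ (FreeModules.FreeModule.mod V)}
  (isCommutativeRing : IsCommutativeRingOn R (FreeModules.FreeModule.mod V) _∙_ e)
  (x : LeftModule.Carrierᴹ (FreeModules.FreeModule.mod V)) where
  private
    module R = CommutativeRing R

    A : CommutativeRing 0ℓ 0ℓ
    A = record { isCommutativeRing = isCommutativeRing }

  open CommutativeRing A hiding (zero; isCommutativeRing)
  open Exp semiring using (_^_; ^-homo-*)
  open NaturalCoefficients commutativeSemiring using (solve; _:+_; _:*_; _:=_; con)
  open FreeModules R
  open BasisLemmas R
  open FreeModule V renaming (mod to M; hasBasis to B)
  open LeftModule M using (_*ₗ_; *ₗ-zeroʳ; *ₗ-congˡ)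
  open _⟶_ using (to; ⟦⟧-cong)

  private module M⊗M = LeftModule (M ⊗ᴹ M)

  open Combination (M ⊗ᴹ M) using (sum; sum-syntax; sum-cong-≋; ∑-distrib-+)
  open M⊗M using (+ᴹ-congˡ; +ᴹ-congʳ) renaming (_≈ᴹ_ to _≈₂_)

  -- Σ p xᵏ ⊗ xˡ q over k + l = N - 1.
  convolution : ℕ → Carrier → Carrier → Tensor M M
  convolution N p q = sum {N} (λ k → (p * x ^ toℕ k) ⊗ (x ^ (N ∸ suc (toℕ k)) * q))

  private
    E : ℕ → Carrier → Carrier → Tensor M M
    E = convolution

  convolution-cong : ∀ N {p p′ q q′} → p ≈ p′ → q ≈ q′ → E N p q ≈₂ E N p′ q′
  convolution-cong N e f = sum-cong-≋ {N} (λ k → ⊗-cong (*-congʳ e) (*-congˡ f))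

  convolution-map : (f : M ⊗ᴹ M ⟶ M ⊗ᴹ M) → ∀ {p q p′ q′} →
    (∀ a b → to f ((p * a) ⊗ (b * q)) ≈₂ (p′ * a) ⊗ (b * q′)) →
    ∀ N → to f (E N p q) ≈₂ E N p′ q′
  convolution-map f h N = transₜ (to-sum f {N} _) (sum-cong-≋ {N} (λ k → h _ _))

  convolution-first : ∀ N p q → E (suc N) p q ≈₂ p ⊗ (x ^ N * q) +ₜ E N (p * x) q
  convolution-first N p q = +ₜ-cong (⊗-cong (*-identityʳ p) refl)
    (sum-cong-≋ {N} (λ k → ⊗-cong (sym (*-assoc p x _)) refl))

  -- Both sides are the sum of p xᵏ ⊗ xˡ q over k + l = N: on the left the term k = 0 is split off,
  -- on the right the term l = 0. This is the telescoping behind the centrality of x.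
  convolution-shift : ∀ N p q →
    E N (p * x) q +ₜ p ⊗ (x ^ N * q) ≈₂ E N p (x * q) +ₜ (p * x ^ N) ⊗ q
  convolution-shift zero    p q = +ᴹ-congˡ
    (⊗-cong (sym (*-identityʳ p)) (*-identityˡ q))
  convolution-shift (suc N) p q = begin
    E (suc N) (p * x) q +ₜ p ⊗ (x ^ suc N * q)
      ≈⟨ +ₜ-comm _ _ ⟩
    p ⊗ (x ^ suc N * q) +ₜ E (suc N) (p * x) q
      ≈⟨ +ₜ-cong (⊗-cong refl (power-suc N)) (transₜ (convolution-first N (p * x) q) (+ₜ-comm _ _)) ⟩
    p ⊗ (x ^ N * (x * q)) +ₜ (E N ((p * x) * x) q +ₜ (p * x) ⊗ (x ^ N * q))
      ≈⟨ +ᴹ-congˡ (convolution-shift N (p * x) q) ⟩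
    p ⊗ (x ^ N * (x * q)) +ₜ (E N (p * x) (x * q) +ₜ ((p * x) * x ^ N) ⊗ q)
      ≈⟨ +ₜ-assoc _ _ _ ⟨
    p ⊗ (x ^ N * (x * q)) +ₜ E N (p * x) (x * q) +ₜ ((p * x) * x ^ N) ⊗ q
      ≈⟨ +ₜ-cong (symₜ (convolution-first N p (x * q))) (⊗-cong (*-assoc p x _) refl) ⟩
    E (suc N) p (x * q) +ₜ (p * x ^ suc N) ⊗ q ∎
    where
    open SetoidReasoning M⊗M.≈ᴹ-setoid
    power-suc : ∀ N → x ^ suc N * q ≈ x ^ N * (x * q)
    power-suc N = trans (*-congʳ (*-comm x (x ^ N))) (*-assoc _ _ _)

  convolution-last : ∀ N p q → E (suc N) p q ≈₂ E N p (x * q) +ₜ (p * x ^ N) ⊗ q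
  convolution-last N p q = transₜ (convolution-first N p q)
    (transₜ (+ₜ-comm _ _) (convolution-shift N p q))

  private
    0⊗ : ∀ {p} q → p ≈ 0# → p ⊗ q ≈₂ 0ₜ
    0⊗ q e = transₜ (⊗-cong e refl) (_⟶_.0ᴹ-homo (-⊗_ {M} {M} q))

    ⊗0 : ∀ p {q} → q ≈ 0# → p ⊗ q ≈₂ 0ₜ
    ⊗0 p e = transₜ (⊗-cong refl e) (_⟶_.0ᴹ-homo (_⊗- {M} {M} p))

    drop-0 : ∀ {s t u} → s ≈₂ t +ₜ u → u ≈₂ 0ₜ → s ≈₂ t
    drop-0 e f = transₜ e (transₜ (+ᴹ-congˡ f) (M⊗M.+ᴹ-identityʳ _))

  -- The two split-off boundary terms vanish, so x crosses the tensor sign.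
  convolution-balanced : ∀ N p q → p * x ^ N ≈ 0# → x ^ N * q ≈ 0# → E N (p * x) q ≈₂ E N p (x * q)
  convolution-balanced N p q e f = transₜ (symₜ (drop-0 reflₜ (⊗0 p f)))
    (drop-0 (convolution-shift N p q) (0⊗ q e))

  convolution-zero : ∀ {P : Mod} (f : M ⊗ᴹ M ⟶ P) N {p q} →
    (∀ k l → suc (k ℕ.+ l) ≡ N → LeftModule._≈ᴹ_ P (to f ((p * x ^ k) ⊗ (x ^ l * q))) (LeftModule.0ᴹ P)) →
    LeftModule._≈ᴹ_ P (to f (E N p q)) (LeftModule.0ᴹ P)
  convolution-zero {P} f N h = P.≈ᴹ-trans (to-sum f {N} _)
    (P.≈ᴹ-trans (PC.sum-cong-≋ {N} (λ k → h (toℕ k) _ (ℕ.m+[n∸m]≡n (Fin.toℕ<n k)))) (PC.sum-replicate-zero N))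
    where
    module P = LeftModule P
    module PC = Combination P

  -- The interface to the concrete algebra: the argument below uses the relations, a monomial basis
  -- and the values of the structure maps, never the polynomials behind them. The scalar `c` stands
  -- for 1/3n.
  record IsTruncatedStructure (y : Carrier) (c 3n : R.Carrier) (n : ℕ)
    (μ : M ⊗ᴹ M ⟶ M) (η : R-module ⟶ M) (Δ : M ⟶ M ⊗ᴹ M) (ε : M ⟶ R-module) (m : M ⟶ M) : Set where

    crosscap : Carrier
    crosscap = if n % 2 ≡ᵇ 0 then x ^ ((n ∸ 2) / 2) * y ^ 2 else x ^ ((n ∸ 1) / 2) * y

    field
      xⁿ≈0       : x ^ n ≈ 0#
      y³≈xy      : y ^ 3 ≈ x * y
      c*3n≈1     : c R.* 3n R.≈ R.1#
      monomials  : ∀ l → ∃₂ λ i j → Basis.basis B l ≡ x ^ i * y ^ j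
      μ-⊗        : ∀ a b → to μ (a ⊗ b) ≈ a * b
      η-scalar   : ∀ r v → to η r * v ≈ r *ₗ v
      Δ-sum      : ∀ v → to Δ v ≈₂
        (R.- c) *ₜ (∑[ k < n ∸ 1 ] let i = suc (toℕ k) ; j = n ∸ i in
          (v * x ^ i) ⊗ x ^ j)
        +ₜ
        c *ₜ (∑[ k < n ] let i = toℕ k ; j = n ∸ 1 ∸ i in
          (v * (x ^ i * y ^ 2)) ⊗ x ^ j +ₜ (v * (x ^ i * y)) ⊗ (x ^ j * y) +ₜ (v * x ^ i) ⊗ (x ^ j * y ^ 2))
      ε-monomial : ∀ (i : Fin n) (j : Fin 3) →
        to ε (x ^ toℕ i * y ^ toℕ j) R.≈ (if (toℕ i ≡ᵇ n ∸ 1) ∧ (toℕ j ≡ᵇ 2) then 3n else R.0#)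
      m-crosscap : ∀ v → to m v ≈ v * crosscap

  -- The comultiplication in terms of convolutions.

  module TruncatedStructure {y : Carrier} {c 3n : R.Carrier} {n′ : ℕ}
    {μ : M ⊗ᴹ M ⟶ M} {η : R-module ⟶ M} {Δ : M ⟶ M ⊗ᴹ M} {ε : M ⟶ R-module} {m : M ⟶ M}
    (isTruncatedStructure : IsTruncatedStructure y c 3n (suc n′) μ η Δ ε m) where
    open IsTruncatedStructure isTruncatedStructure

    private
      n : ℕ
      n = suc n′

      Δ-convolution : ∀ v → to Δ v ≈₂
        (R.- c) *ₜ E n′ (v * x) x +ₜ c *ₜ (E n (v * y ^ 2) 1# +ₜ E n (v * y) y +ₜ E n v (y ^ 2))
      Δ-convolution v = transₜ (Δ-sum v) (+ₜ-cong
        (*ₜ-cong R.refl (sum-cong-≋ {n′} (λ k → ⊗-cong (sym (*-assoc v x _)) (power k))))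
        (*ₜ-cong R.refl (transₜ (∑-distrib-+ {n} (λ k → t₀ k +ₜ t₁ k) t₂) (+ₜ-cong
          (transₜ (∑-distrib-+ {n} t₀ t₁) (+ₜ-cong (sum-cong-≋ {n} t₀≈) (sum-cong-≋ {n} t₁≈)))
          reflₜ))))
        where
        reassociate : ∀ v a b → v * (a * b) ≈ v * b * a
        reassociate v a b = trans (*-congˡ (*-comm a b)) (sym (*-assoc v b a))
        t₀ t₁ t₂ : Fin n → Tensor M M
        t₀ k = (v * (x ^ toℕ k * y ^ 2)) ⊗ x ^ (n′ ∸ toℕ k)
        t₁ k = (v * (x ^ toℕ k * y)) ⊗ (x ^ (n′ ∸ toℕ k) * y)
        t₂ k = (v * x ^ toℕ k) ⊗ (x ^ (n′ ∸ toℕ k) * y ^ 2)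
        t₀≈ : ∀ k → t₀ k ≈₂ (v * y ^ 2 * x ^ toℕ k) ⊗ (x ^ (n′ ∸ toℕ k) * 1#)
        t₀≈ k = ⊗-cong (reassociate v _ _) (sym (*-identityʳ _))
        t₁≈ : ∀ k → t₁ k ≈₂ (v * y * x ^ toℕ k) ⊗ (x ^ (n′ ∸ toℕ k) * y)
        t₁≈ k = ⊗-cong (reassociate v _ _) refl
        -- As k < n′, the truncated subtraction is exact and the exponent n - (k + 1) is positive.
        -- One factor x can therefore be moved into the right-hand parameter of the convolution,
        -- leaving n′ terms.
        power : ∀ (k : Fin n′) → x ^ (n ∸ suc (toℕ k)) ≈ x ^ (n′ ∸ suc (toℕ k)) * x
        power k = trans (reflexive (cong (x ^_) (ℕ.+-∸-assoc 1 (Fin.toℕ<n k)))) (*-comm x _)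

      combination : Tensor M M → Tensor M M → Tensor M M → Tensor M M → Tensor M M
      combination r s t u = (R.- c) *ₜ r +ₜ c *ₜ (s +ₜ t +ₜ u)

      combination-cong : ∀ {r r′ s s′ t t′ u u′} → r ≈₂ r′ → s ≈₂ s′ → t ≈₂ t′ → u ≈₂ u′ →
        combination r s t u ≈₂ combination r′ s′ t′ u′
      combination-cong e f g h = +ₜ-cong (*ₜ-cong R.refl e) (*ₜ-cong R.refl (+ₜ-cong (+ₜ-cong f g) h))

      combination-map : ∀ {P : Mod} (f : M ⊗ᴹ M ⟶ P) → let open LeftModule P renaming (_≈ᴹ_ to _≈ₚ_; _*ₗ_ to _*ₚ_) in
        ∀ r s t u {r′ s′ t′ u′} → to f r ≈ₚ r′ → to f s ≈ₚ s′ → to f t ≈ₚ t′ → to f u ≈ₚ u′ →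
        to f (combination r s t u) ≈ₚ (R.- c) *ₚ r′ +ᴹ c *ₚ (s′ +ᴹ t′ +ᴹ u′)
      combination-map {P} f r s t u er es et eu = P.≈ᴹ-trans (f.+ᴹ-homo _ _) (P.+ᴹ-cong
        (P.≈ᴹ-trans (f.*ₗ-homo _ _) (P.*ₗ-congˡ er))
        (P.≈ᴹ-trans (f.*ₗ-homo _ _) (P.*ₗ-congˡ
          (P.≈ᴹ-trans (f.+ᴹ-homo _ _) (P.+ᴹ-cong (P.≈ᴹ-trans (f.+ᴹ-homo _ _) (P.+ᴹ-cong es et)) eu)))))
        where
        module P = LeftModule P
        module f = _⟶_ f

      -- The first sum enters Δ with the opposite sign to the others; this is how boundary terms
      -- disappear in the centrality of y.
      combination-cancel : ∀ s t u → combination s s t u ≈₂ c *ₜ (t +ₜ u)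
      combination-cancel s t u = begin
        (R.- c) *ₜ s +ₜ c *ₜ (s +ₜ t +ₜ u)
          ≈⟨ +ᴹ-congˡ (transₜ (*ₜ-cong R.refl (+ₜ-assoc s t u)) (*ₜ-distribˡ c s (t +ₜ u))) ⟩
        (R.- c) *ₜ s +ₜ (c *ₜ s +ₜ c *ₜ (t +ₜ u))
          ≈⟨ +ₜ-assoc _ _ _ ⟨
        (R.- c) *ₜ s +ₜ c *ₜ s +ₜ c *ₜ (t +ₜ u)
          ≈⟨ +ᴹ-congʳ (transₜ (symₜ (*ₜ-distribʳ s (R.- c) c))
               (transₜ (*ₜ-cong (R.-‿inverseˡ c) reflₜ) (*ₜ-zeroˡ s))) ⟩
        0ₜ +ₜ c *ₜ (t +ₜ u)
          ≈⟨ +ₜ-identityˡ _ ⟩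
        c *ₜ (t +ₜ u) ∎
        where open SetoidReasoning M⊗M.≈ᴹ-setoid

      leftMul : Carrier → M ⊗ᴹ M ⟶ M ⊗ᴹ M
      leftMul v = ⊗-map μ idₕ ∘ₕ associator⁻¹ ∘ₕ (v ⊗-)

      rightMul : Carrier → M ⊗ᴹ M ⟶ M ⊗ᴹ M
      rightMul w = ⊗-map idₕ μ ∘ₕ associator ∘ₕ (-⊗ w)

      leftMul-convolution : ∀ v {p p′} q → v * p ≈ p′ → ∀ N → to (leftMul v) (E N p q) ≈₂ E N p′ q
      leftMul-convolution v {p} {p′} q e = convolution-map (leftMul v) {p} {q} {p′} {q}
        (λ a b → ⊗-cong (trans (μ-⊗ v _) (trans (sym (*-assoc v p a)) (*-congʳ e))) refl)

      rightMul-convolution : ∀ w p {q q′} → q * w ≈ q′ → ∀ N → to (rightMul w) (E N p q) ≈₂ E N p q′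
      rightMul-convolution w p {q} {q′} e = convolution-map (rightMul w) {p} {q} {p} {q′}
        (λ a b → ⊗-cong refl (trans (μ-⊗ _ w) (trans (*-assoc b q w) (*-congˡ e))))

      *xⁿ≈0 : ∀ p → p * x ^ n ≈ 0#
      *xⁿ≈0 p = trans (*-congˡ xⁿ≈0) (zeroʳ p)

      xⁿ*≈0 : ∀ q → x ^ n * q ≈ 0#
      xⁿ*≈0 q = trans (*-congʳ xⁿ≈0) (zeroˡ q)

      balanced : ∀ {p p′ q q′} → p′ ≈ p * x → x * q ≈ q′ → E n p q′ ≈₂ E n p′ q
      balanced {p} {q = q} e f = transₜ (convolution-cong n refl (sym f)) (transₜ
        (symₜ (convolution-balanced n p q (*xⁿ≈0 p) (xⁿ*≈0 q))) (convolution-cong n (sym e) refl))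

      -- The term l = 0 of the longer sum contains p x xⁿ⁻¹ = 0; each remaining term has a factor x
      -- to spare on the right.
      truncate : ∀ {p p′ q q′} → p′ ≈ p * x → x * q ≈ q′ → E n p′ q ≈₂ E n′ p′ q′
      truncate {p} {p′} {q} e f = transₜ
        (drop-0 (convolution-last n′ p′ q)
          (0⊗ q (trans (*-congʳ e) (trans (*-assoc p x _) (*xⁿ≈0 p)))))
        (convolution-cong n′ refl f)

    -- In each of the four sums the argument of Δ occurs only as a left factor of the first tensor
    -- component, so multiplying by v there just replaces w by vw.
    frobeniusʳ : ∀ v w → to (⊗-map μ idₕ) (to associator⁻¹ (v ⊗ to Δ w)) ≈₂ to Δ (to μ (v ⊗ w))
    frobeniusʳ v w = transₜ (⟦⟧-cong (leftMul v) (Δ-convolution w))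
      (transₜ (combination-map (leftMul v)
          (E n′ (w * x) x) (E n (w * y ^ 2) 1#) (E n (w * y) y) (E n w (y ^ 2))
          (leftMul-convolution v x (sym (*-assoc v w x)) n′)
          (leftMul-convolution v 1# (sym (*-assoc v w (y ^ 2))) n)
          (leftMul-convolution v y (sym (*-assoc v w y)) n)
          (leftMul-convolution v (y ^ 2) refl n))
        (transₜ (symₜ (Δ-convolution (v * w))) (⟦⟧-cong Δ (sym (μ-⊗ v w)))))

    -- Centrality of Δ(1) and the left Frobenius relation.

    private
      -- At v = 1 this is the centrality condition (1 ⊗ w)Δ(1) = (w ⊗ 1)Δ(1), given `frobeniusʳ`.
      -- Quantifying over v makes the property pass to products.
      Central : Carrier → Set
      Central w = ∀ v → to (rightMul w) (to Δ v) ≈₂ to Δ (v * w)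

      rightMul-Δ : ∀ w v {r s t u} →
        E n′ (v * x) (x * w) ≈₂ r → E n (v * y ^ 2) w ≈₂ s → E n (v * y) (y * w) ≈₂ t → E n v (y ^ 2 * w) ≈₂ u →
        to (rightMul w) (to Δ v) ≈₂ combination r s t u
      rightMul-Δ w v er es et eu = transₜ (⟦⟧-cong (rightMul w) (Δ-convolution v))
        (combination-map (rightMul w)
          (E n′ (v * x) x) (E n (v * y ^ 2) 1#) (E n (v * y) y) (E n v (y ^ 2))
          (transₜ (rightMul-convolution w (v * x) refl n′) er)
          (transₜ (rightMul-convolution w (v * y ^ 2) (*-identityˡ w) n) es)
          (transₜ (rightMul-convolution w (v * y) refl n) et)
          (transₜ (rightMul-convolution w v refl n) eu))

      swap : ∀ v a b → v * a * b ≈ v * b * a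
      swap = solve 3 (λ v a b → v :* a :* b := v :* b :* a) refl

      central-x : Central x
      central-x v = transₜ
        (rightMul-Δ x v
          -- This sum has only n - 1 terms, so its boundary terms carry xⁿ⁻¹; the extra x in each
          -- parameter completes it to xⁿ.
          (symₜ (convolution-balanced n′ (v * x) x
            (trans (*-assoc v x _) (*xⁿ≈0 v)) (trans (*-comm _ x) xⁿ≈0)))
          (balanced (swap v x (y ^ 2)) (*-identityʳ x))
          (balanced (swap v x y) (*-comm x y))
          (balanced refl (*-comm x (y ^ 2))))
        (symₜ (Δ-convolution (v * x)))

      y²y≈xy : y ^ 2 * y ≈ x * y
      y²y≈xy = trans (*-comm _ y) y³≈xy

      central-y : Central y
      central-y v = begin
        to (rightMul y) (to Δ v)
          -- In the last sum y² becomes y³ = xy; its x moves to the left factor and `truncate` then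
          -- yields exactly the first sum, which has the opposite sign.
          ≈⟨ rightMul-Δ y v reflₜ reflₜ (convolution-cong n refl (*-congˡ (sym (*-identityʳ y))))
               (transₜ (balanced refl (sym y²y≈xy)) (truncate refl refl)) ⟩
        combination (E n′ (v * x) (x * y)) (E n (v * y ^ 2) y) (E n (v * y) (y ^ 2)) (E n′ (v * x) (x * y))
          ≈⟨ +ᴹ-congˡ (*ₜ-cong R.refl (transₜ (+ₜ-comm _ _) (symₜ (+ₜ-assoc _ _ _)))) ⟩
        combination (E n′ (v * x) (x * y)) (E n′ (v * x) (x * y)) (E n (v * y ^ 2) y) (E n (v * y) (y ^ 2))
          ≈⟨ combination-cancel _ _ _ ⟩
        c *ₜ (E n (v * y ^ 2) y +ₜ E n (v * y) (y ^ 2))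
          -- A cancelling pair is inserted: the first sum of Δ(vy), and the same sum as it arises
          -- from the y² ⊗ 1 part through v y y² = v x y.
          ≈⟨ combination-cancel _ _ _ ⟨
        combination (E n′ (v * y * x) x) (E n′ (v * y * x) x) (E n (v * y ^ 2) y) (E n (v * y) (y ^ 2))
          ≈⟨ combination-cong reflₜ
               (transₜ (symₜ (truncate refl (*-identityʳ x)))
                 (convolution-cong n (trans (swap v y x) (trans (*-assoc v x y)
                   (trans (*-congˡ (sym y³≈xy)) (sym (*-assoc v y _))))) refl))
               (convolution-cong n (solve 2 (λ v y → v :* (y :* (y :* con 1)) := v :* y :* y) refl v y) refl)
               reflₜ ⟩
        combination (E n′ (v * y * x) x) (E n (v * y * y ^ 2) 1#) (E n (v * y * y) y) (E n (v * y) (y ^ 2))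
          ≈⟨ Δ-convolution (v * y) ⟨
        to Δ (v * y) ∎
        where open SetoidReasoning M⊗M.≈ᴹ-setoid

      rightMul-1 : rightMul 1# ≈ₕ idₕ
      rightMul-1 = ⊗-ext {f = rightMul 1#} {idₕ}
        (λ p q → ⊗-cong refl (trans (μ-⊗ q 1#) (*-identityʳ q)))

      rightMul-* : ∀ a b → rightMul (a * b) ≈ₕ rightMul b ∘ₕ rightMul a
      rightMul-* a b = ⊗-ext {f = rightMul (a * b)} {rightMul b ∘ₕ rightMul a}
        (λ p q → ⊗-cong refl (trans (μ-⊗ q (a * b)) (trans (sym (*-assoc q a b))
          (sym (trans (μ-⊗ _ b) (*-congʳ (μ-⊗ q a)))))))

      central-1 : Central 1#
      central-1 v = transₜ (rightMul-1 (to Δ v)) (⟦⟧-cong Δ (sym (*-identityʳ v)))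

      central-* : ∀ {a b} → Central a → Central b → Central (a * b)
      central-* {a} {b} ca cb v = transₜ (rightMul-* a b (to Δ v))
        (transₜ (⟦⟧-cong (rightMul b) (ca v)) (transₜ (cb (v * a)) (⟦⟧-cong Δ (*-assoc v a b))))

      central-^ : ∀ {a} k → Central a → Central (a ^ k)
      central-^     zero    ca = central-1
      central-^ {a} (suc k) ca = central-* {a} {a ^ k} ca (central-^ k ca)

    frobeniusˡ : ∀ v w → to (⊗-map idₕ μ) (to associator (to Δ v ⊗ w)) ≈₂ to Δ (to μ (v ⊗ w))
    frobeniusˡ v = basis-ext B
      (⊗-map idₕ μ ∘ₕ associator ∘ₕ (to Δ v ⊗-)) (Δ ∘ₕ μ ∘ₕ (v ⊗-)) on-basis
      where
      on-basis : ∀ l → to (rightMul (Basis.basis B l)) (to Δ v) ≈₂ to Δ (to μ (v ⊗ Basis.basis B l))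
      on-basis l with Basis.basis B l | monomials l
      -- Both sides are linear in w, so it suffices to treat basis vectors, which are products of
      -- powers of the central elements x and y.
      ... | _ | i , j , ≡.refl = transₜ
        (central-* {x ^ i} {y ^ j} (central-^ i central-x) (central-^ j central-y) v)
        (⟦⟧-cong Δ (sym (μ-⊗ v _)))

    -- The counit laws at 1.

    private
      ε-cong : ∀ {v w r} → v ≈ w → to ε w R.≈ r → to ε v R.≈ r
      ε-cong e f = R.trans (⟦⟧-cong ε e) f

      ε-xᵏyʲ : ∀ {k} (k≤n′ : k ℕ.≤ n′) (j : Fin 3) →
        to ε (x ^ k * y ^ toℕ j) R.≈ (if (k ≡ᵇ n′) ∧ (toℕ j ≡ᵇ 2) then 3n else R.0#)
      -- The value of ε is known for indices in `Fin n`; the bound on k supplies such an index.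
      ε-xᵏyʲ k≤n′ j with ε-monomial (fromℕ< (ℕ.s≤s k≤n′)) j
      ... | e rewrite Fin.toℕ-fromℕ< (ℕ.s≤s k≤n′) = e

      if-∧-false : ∀ b → (if b ∧ false then 3n else R.0#) ≡ R.0#
      if-∧-false true  = ≡.refl
      if-∧-false false = ≡.refl

      ε-xᵏ : ∀ {k} → k ℕ.≤ n′ → to ε (x ^ k) R.≈ R.0#
      ε-xᵏ {k} k≤n′ = ε-cong (sym (*-identityʳ _))
        (R.trans (ε-xᵏyʲ k≤n′ zero) (R.reflexive (if-∧-false (k ≡ᵇ n′))))

      ε-xᵏy : ∀ {k} → k ℕ.≤ n′ → to ε (x ^ k * y) R.≈ R.0#
      ε-xᵏy {k} k≤n′ = ε-cong (*-congˡ (sym (*-identityʳ y)))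
        (R.trans (ε-xᵏyʲ k≤n′ (suc zero)) (R.reflexive (if-∧-false (k ≡ᵇ n′))))

      ε-xᵏy² : ∀ {k} → k ℕ.< n′ → to ε (x ^ k * y ^ 2) R.≈ R.0#
      ε-xᵏy² {k} k<n′ with ε-xᵏyʲ (ℕ.<⇒≤ k<n′) (suc (suc zero))
      ... | e with k ≡ᵇ n′ | ℕ.≡ᵇ⇒≡ k n′
      ... | true  | k≡n′ = contradiction (k≡n′ _) (ℕ.<⇒≢ k<n′)
      ... | false | _    = e

      ε-top : to ε (x ^ n′ * y ^ 2) R.≈ 3n
      ε-top with ε-xᵏyʲ ℕ.≤-refl (suc (suc zero))
      ... | e with n′ ≡ᵇ n′ | ℕ.≡⇒≡ᵇ n′ n′ ≡.refl
      ... | true | _ = e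

      εˡ : M ⊗ᴹ M ⟶ R-module ⊗ᴹ M
      εˡ = ⊗-map ε idₕ

      εʳ : M ⊗ᴹ M ⟶ M ⊗ᴹ R-module
      εʳ = ⊗-map idₕ ε

      k≤ : ∀ {k l N} → k ℕ.+ l ≡ N → k ℕ.≤ N
      k≤ {k} {l} e = ℕ.m+n≤o⇒m≤o k (ℕ.≤-reflexive e)

      l≤ : ∀ {k l N} → k ℕ.+ l ≡ N → l ℕ.≤ N
      l≤ {k} {l} e = ℕ.m+n≤o⇒n≤o k (ℕ.≤-reflexive e)

      l< : ∀ {k l N} → suc (k ℕ.+ l) ≡ N → l ℕ.< N
      l< {k} {l} e = ℕ.≤-trans (ℕ.s≤s (ℕ.m≤n+m l k)) (ℕ.≤-reflexive e)

      εˡ-zero : ∀ N {p q} → (∀ k l → suc (k ℕ.+ l) ≡ N → to ε (p * x ^ k) R.≈ R.0#) →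
        LeftModule._≈ᴹ_ (R-module ⊗ᴹ M) (to εˡ (E N p q)) 0ₜ
      εˡ-zero N {p} {q} h = convolution-zero εˡ N {p} {q} (λ k l e →
        transₜ (⊗-cong (h k l e) refl) (_⟶_.0ᴹ-homo (-⊗_ {R-module} {M} _)))

      εʳ-zero : ∀ N {p q} → (∀ k l → suc (k ℕ.+ l) ≡ N → to ε (x ^ l * q) R.≈ R.0#) →
        LeftModule._≈ᴹ_ (M ⊗ᴹ R-module) (to εʳ (E N p q)) 0ₜ
      εʳ-zero N {p} {q} h = convolution-zero εʳ N {p} {q} (λ k l e →
        transₜ (⊗-cong refl (h k l e)) (_⟶_.0ᴹ-homo (_⊗- {M} {R-module} _)))

      1*-comm : ∀ a b → 1# * a * b ≈ b * a
      1*-comm a b = trans (*-congʳ (*-identityˡ a)) (*-comm a b)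

    counitˡ : LeftModule._≈ᴹ_ (R-module ⊗ᴹ M) (to εˡ (to Δ 1#)) (R.1# ⊗ 1#)
    counitˡ = begin
      to εˡ (to Δ 1#)
        ≈⟨ ⟦⟧-cong εˡ (Δ-convolution 1#) ⟩
      to εˡ (combination (E n′ (1# * x) x) (E n (1# * y ^ 2) 1#) (E n (1# * y) y) (E n 1# (y ^ 2)))
        ≈⟨ combination-map εˡ
             (E n′ (1# * x) x) (E n (1# * y ^ 2) 1#) (E n (1# * y) y) (E n 1# (y ^ 2))
             (εˡ-zero n′ (λ k l e → ε-cong (*-congʳ (*-identityˡ x)) (ε-xᵏ (k≤ {suc k} e))))
             -- Only here does xⁿ⁻¹y² occur in the first factor: in the term l = 0, which gives 3n ⊗
             -- 1. Every other term is killed by ε.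
             (transₜ (⟦⟧-cong εˡ (convolution-last n′ (1# * y ^ 2) 1#))
               (transₜ (+ₜ-cong
                   (εˡ-zero n′ (λ k l e → ε-cong (1*-comm _ _) (ε-xᵏy² (k≤ {suc k} e))))
                   (⊗-cong (ε-cong (1*-comm _ _) ε-top) refl))
                 (+ₜ-identityˡ (3n ⊗ 1#))))
             (εˡ-zero n (λ k l e → ε-cong (1*-comm _ _) (ε-xᵏy (k≤ {k} (ℕ.suc-injective e)))))
             (εˡ-zero n (λ k l e → ε-cong (*-identityˡ _) (ε-xᵏ (k≤ {k} (ℕ.suc-injective e))))) ⟩
      (R.- c) *ₜ 0ₜ +ₜ c *ₜ (3n ⊗ 1# +ₜ 0ₜ +ₜ 0ₜ)
        ≈⟨ transₜ (+ₜ-cong (*ₜ-zeroʳ _) (*ₜ-cong R.refl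
             (transₜ (+ᴹ-identityʳ _) (+ᴹ-identityʳ _)))) (+ₜ-identityˡ _) ⟩
      c *ₜ 3n ⊗ 1#
        ≈⟨ ⊗-*ˡ c 3n 1# ⟨
      (c R.* 3n) ⊗ 1#
        ≈⟨ ⊗-cong c*3n≈1 refl ⟩
      R.1# ⊗ 1# ∎
      where
      open LeftModule (R-module ⊗ᴹ M) using (≈ᴹ-setoid; +ᴹ-identityʳ)
      open SetoidReasoning ≈ᴹ-setoid

    counitʳ : LeftModule._≈ᴹ_ (M ⊗ᴹ R-module) (to εʳ (to Δ 1#)) (1# ⊗ R.1#)
    counitʳ = begin
      to εʳ (to Δ 1#)
        ≈⟨ ⟦⟧-cong εʳ (Δ-convolution 1#) ⟩
      to εʳ (combination (E n′ (1# * x) x) (E n (1# * y ^ 2) 1#) (E n (1# * y) y) (E n 1# (y ^ 2)))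
        ≈⟨ combination-map εʳ
             (E n′ (1# * x) x) (E n (1# * y ^ 2) 1#) (E n (1# * y) y) (E n 1# (y ^ 2))
             (εʳ-zero n′ (λ k l e → ε-cong (*-comm _ x) (ε-xᵏ (l< {k} e))))
             (εʳ-zero n (λ k l e → ε-cong (*-identityʳ _) (ε-xᵏ (l≤ {k} (ℕ.suc-injective e)))))
             (εʳ-zero n (λ k l e → ε-xᵏy (l≤ {k} (ℕ.suc-injective e))))
             -- Mirror image: xⁿ⁻¹y² occurs in the second factor only for k = 0 in the 1 ⊗ y² part.
             (transₜ (⟦⟧-cong εʳ (convolution-first n′ 1# (y ^ 2)))
               (transₜ (+ₜ-cong (⊗-cong refl ε-top)
                   (εʳ-zero n′ (λ k l e → ε-xᵏy² (l< {k} e))))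
                 (+ᴹ-identityʳ (1# ⊗ 3n)))) ⟩
      (R.- c) *ₜ 0ₜ +ₜ c *ₜ (0ₜ +ₜ 0ₜ +ₜ 1# ⊗ 3n)
        ≈⟨ transₜ (+ₜ-cong (*ₜ-zeroʳ _) (*ₜ-cong R.refl
             (transₜ (+ₜ-cong (+ₜ-identityˡ _) reflₜ) (+ₜ-identityˡ _)))) (+ₜ-identityˡ _) ⟩
      c *ₜ 1# ⊗ 3n
        ≈⟨ ⊗-*ʳ c 1# 3n ⟨
      1# ⊗ (c R.* 3n)
        ≈⟨ ⊗-cong refl c*3n≈1 ⟩
      1# ⊗ R.1# ∎
      where
      open LeftModule (M ⊗ᴹ R-module) using (≈ᴹ-setoid; +ᴹ-identityʳ)
      open SetoidReasoning ≈ᴹ-setoid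

    -- The Möbius relation: both sides vanish.

    handle-zero : ∀ w → w * (x ^ n′ * y ^ 2) ≈ 0# → to μ (to Δ w) ≈ 0#
    handle-zero w w-top = trans (⟦⟧-cong μ (Δ-convolution w))
      (trans (combination-map μ (E n′ (w * x) x) (E n (w * y ^ 2) 1#) (E n (w * y) y) (E n w (y ^ 2))
          -- With k + l + 1 = n′, the two extra factors x bring the total exponent to n.
          (convolution-zero μ n′ (λ k l e → trans (μ-⊗ _ _) (trans
            (solve 4 (λ w x a b → w :* x :* a :* (b :* x) := w :* (x :* (x :* (a :* b)))) refl w x (x ^ k) (x ^ l))
            (trans (*-congˡ (*-congˡ (*-congˡ (sym (^-homo-* x k l)))))
              (trans (reflexive (cong (λ N → w * x ^ suc N) e)) (*xⁿ≈0 w))))))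
          -- In all three remaining sums the two components multiply to w xⁿ⁻¹ y², wherever the
          -- factors y stand.
          (convolution-zero μ n (λ k l e → top k l (ℕ.suc-injective e)
            (solve 4 (λ w a b y →
               w :* (y :* (y :* con 1)) :* a :* (b :* con 1) :=
               w :* (a :* b :* (y :* (y :* con 1)))) refl w (x ^ k) (x ^ l) y)))
          (convolution-zero μ n (λ k l e → top k l (ℕ.suc-injective e)
            (solve 4 (λ w a b y →
               w :* y :* a :* (b :* y) :=
               w :* (a :* b :* (y :* (y :* con 1)))) refl w (x ^ k) (x ^ l) y)))
          (convolution-zero μ n (λ k l e → top k l (ℕ.suc-injective e)
            (solve 4 (λ w a b y →
               w :* a :* (b :* (y :* (y :* con 1))) :=
               w :* (a :* b :* (y :* (y :* con 1)))) refl w (x ^ k) (x ^ l) y))))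
        (trans (+-cong (*ₗ-zeroʳ _) (trans (*ₗ-congˡ (trans (+-congʳ (+-identityˡ 0#)) (+-identityˡ 0#))) (*ₗ-zeroʳ c)))
          (+-identityˡ 0#)))
      where
      top : ∀ k l → k ℕ.+ l ≡ n′ → ∀ {a b} → a * b ≈ w * (x ^ k * x ^ l * y ^ 2) → to μ (a ⊗ b) ≈ 0#
      top k l e f = trans (μ-⊗ _ _) (trans f (trans
        (*-congˡ (*-congʳ (trans (sym (^-homo-* x k l)) (reflexive (cong (x ^_) e))))) w-top))

    private
      x^≈0 : ∀ k → n ℕ.≤ k → x ^ k ≈ 0#
      x^≈0 k n≤k = trans (reflexive (cong (x ^_) (≡.sym (ℕ.m+[n∸m]≡n n≤k))))
        (trans (^-homo-* x n (k ∸ n)) (xⁿ*≈0 _))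

      x^h³ : ∀ h → x ^ h * x ^ h * x ^ h ≈ x ^ (h ℕ.+ h ℕ.+ h)
      x^h³ h = sym (trans (^-homo-* x (h ℕ.+ h) h) (*-congʳ (^-homo-* x h h)))

    -- The y-exponent is 4 or 3, so y³ = xy releases one x, and `x * x ^ n′` is `x ^ n` by
    -- definition.
    crosscap-top : crosscap * (x ^ n′ * y ^ 2) ≈ 0#
    crosscap-top with n % 2 ≡ᵇ 0
    ... | true  = trans
      (solve 4 (λ a b x y →
         a :* (y :* (y :* con 1)) :* (b :* (y :* (y :* con 1))) :=
         a :* y :* b :* (y :* (y :* (y :* con 1)))) refl (x ^ ((n ∸ 2) / 2)) (x ^ n′) x y)
      (trans (*-congˡ y³≈xy) (trans
        (solve 4 (λ a b x y → a :* y :* b :* (x :* y) := x :* b :* (a :* y :* y)) refl (x ^ ((n ∸ 2) / 2)) (x ^ n′) x y)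
        (xⁿ*≈0 _)))
    ... | false = trans
      (solve 3 (λ a b y →
         a :* y :* (b :* (y :* (y :* con 1))) :=
         a :* b :* (y :* (y :* (y :* con 1)))) refl (x ^ (n′ / 2)) (x ^ n′) y)
      (trans (*-congˡ y³≈xy) (trans
        (solve 4 (λ a b x y → a :* b :* (x :* y) := x :* b :* (a :* y)) refl (x ^ (n′ / 2)) (x ^ n′) x y)
        (xⁿ*≈0 _)))

    crosscap-cubed : crosscap * crosscap * crosscap ≈ 0#
    -- The equation `parity` is kept because the exponent bounds need it.
    crosscap-cubed with n % 2 ≡ᵇ 0 in parity
    ... | true  = trans
      (solve 2 (λ a y → a :* (y :* (y :* con 1)) :* (a :* (y :* (y :* con 1))) :* (a :* (y :* (y :* con 1))) :=
         a :* a :* a :* (y :* (y :* (y :* con 1)) :* (y :* (y :* (y :* con 1))))) refl a y)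
      (trans (*-cong (x^h³ h) (*-cong y³≈xy y³≈xy)) (trans
        (solve 3 (λ b x y → b :* (x :* y :* (x :* y)) := x :* (x :* b) :* (y :* y)) refl (x ^ (h ℕ.+ h ℕ.+ h)) x y)
        (trans (*-congʳ (x^≈0 (suc (suc (h ℕ.+ h ℕ.+ h))) (even-bound n′ parity))) (zeroˡ _))))
      where
      h : ℕ
      h = (n ∸ 2) / 2
      a : Carrier
      a = x ^ h
    ... | false = trans
      (solve 2 (λ a y → a :* y :* (a :* y) :* (a :* y) := a :* a :* a :* (y :* (y :* (y :* con 1)))) refl (x ^ h) y)
      (trans (*-cong (x^h³ h) y³≈xy) (trans
        (solve 3 (λ b x y → b :* (x :* y) := x :* b :* y) refl (x ^ (h ℕ.+ h ℕ.+ h)) x y)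
        (trans (*-congʳ (x^≈0 (suc (h ℕ.+ h ℕ.+ h)) (odd-bound n′ parity))) (zeroˡ y))))
      where
      h : ℕ
      h = n′ / 2

    -- Assembling the Möbius Frobenius algebra.

    private
      identityˡ : ∀ v → to μ (1# ⊗ v) ≈ v
      identityˡ v = trans (μ-⊗ 1# v) (*-identityˡ v)

      identityʳ : ∀ v → to μ (v ⊗ 1#) ≈ v
      identityʳ v = trans (μ-⊗ v 1#) (*-identityʳ v)

    isMöbius :
      IsMöbiusFrobeniusAlgebra (Symmetric.braided RMod-symmetric) V μ η Δ ε m
    isMöbius = record
      { isCommutativeFrobeniusAlgebra = record
        { isFrobeniusAlgebra = record
          { μ-assoc = ⊗-extˡ {f = μ ∘ₕ ⊗-map μ idₕ} {μ ∘ₕ ⊗-map idₕ μ ∘ₕ associator} λ a b d →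
              trans (μ-⊗ _ d) (trans (*-congʳ (μ-⊗ a b)) (trans (*-assoc a b d)
                (sym (trans (μ-⊗ a _) (*-congˡ (μ-⊗ b d))))))
          ; μ-identityˡ = ⊗-ext {f = μ ∘ₕ ⊗-map η idₕ} {unitorˡ} λ r v →
              trans (μ-⊗ _ v) (η-scalar r v)
          ; μ-identityʳ = ⊗-ext {f = μ ∘ₕ ⊗-map idₕ η} {unitorʳ} λ v r →
              trans (μ-⊗ v _) (trans (*-comm v _) (η-scalar r v))
          ; Δ-coassoc = coassoc
          ; Δ-coidentityˡ = coidentityˡ ε counitˡ
          ; Δ-coidentityʳ = coidentityʳ ε counitʳ
          ; frobeniusˡ = ⊗-ext {f = ⊗-map idₕ μ ∘ₕ associator ∘ₕ ⊗-map Δ idₕ} {Δ ∘ₕ μ} frobeniusˡ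
          ; frobeniusʳ = ⊗-ext {f = ⊗-map μ idₕ ∘ₕ associator⁻¹ ∘ₕ ⊗-map idₕ Δ} {Δ ∘ₕ μ} frobeniusʳ
          }
        ; μ-comm = ⊗-ext {f = μ ∘ₕ braiding} {μ} λ a b →
            trans (μ-⊗ b a) (trans (*-comm b a) (sym (μ-⊗ a b)))
        }
      ; m-μˡ = ⊗-ext {f = μ ∘ₕ ⊗-map m idₕ} {m ∘ₕ μ} λ a b →
          trans (μ-⊗ _ b) (trans (*-congʳ (m-crosscap a)) (trans (swap a crosscap b)
            (sym (trans (m-crosscap _) (*-congʳ (μ-⊗ a b))))))
      ; m-μʳ = ⊗-ext {f = m ∘ₕ μ} {μ ∘ₕ ⊗-map idₕ m} λ a b →
          trans (m-crosscap _) (trans (*-congʳ (μ-⊗ a b)) (trans (*-assoc a b crosscap)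
            (sym (trans (μ-⊗ a _) (*-congˡ (m-crosscap b))))))
      -- With m(v) = vφ, the left side vanishes because φ xⁿ⁻¹ y² = 0, and the right side is v φ³ =
      -- 0.
      ; möbius = λ v → trans
          (handle-zero (to m v) (trans (*-congʳ (m-crosscap v)) (trans (*-assoc v crosscap _)
            (trans (*-congˡ crosscap-top) (zeroʳ v)))))
          (sym (trans (m-crosscap _) (trans (*-congʳ (trans (m-crosscap _) (*-congʳ (m-crosscap v))))
            (trans (trans (*-congʳ (*-assoc v _ _)) (*-assoc v _ _))
              (trans (*-congˡ crosscap-cubed) (zeroʳ v))))))
      }
      where
      open FrobeniusAtUnit R
      open Coalgebra {M} μ 1# Δ frobeniusˡ frobeniusʳ identityˡ identityʳ

  isMöbiusFrobeniusAlgebra : ∀ {y c 3n n} .{{_ : NonZero n}} {μ η Δ ε m} →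
    IsTruncatedStructure y c 3n n μ η Δ ε m →
    IsMöbiusFrobeniusAlgebra (Symmetric.braided RMod-symmetric) V μ η Δ ε m
  isMöbiusFrobeniusAlgebra {n = suc _} = TruncatedStructure.isMöbius

-- The concrete quotient algebra satisfies the interface.

module TruncatedAlgebraProperties (R : CommutativeRing 0ℓ 0ℓ) (n : ℕ) (3n 1/3n : CommutativeRing.Carrier R) where
  private module R = CommutativeRing R
  open TruncatedAlgebra R n 3n 1/3n
  open FreeModules R
  open BasisLemmas R

  private
    module V = CommutativeRing V-ring
    module R[x] = Polynomials R
    module R[x,y] = Polynomials R[x].polynomialRing
    module S = CommutativeRing R[x,y].polynomialRing
    module SExp = Exp S.semiring
    module Q = Quotient R[x,y].polynomialRing (x SExp.^ n) (y SExp.^ 3 S.- x S.* y)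
    open Exp V.semiring using (_^_)
    open _⟶_ using (to)

  -- The ideal is generated by a power formed in the polynomial ring; for the variable exponent n,
  -- `^-agree` identifies it with the power in the quotient.
  xⁿ≈0 : x ^ n V.≈ V.0#
  xⁿ≈0 = V.trans (V.sym (V.reflexive (^-agree x n))) Q.f∼0

  y³≈xy : y ^ 3 V.≈ x V.* y
  y³≈xy = Q.g-relation S.refl

  ε-monomial : ∀ (i : Fin n) (j : Fin 3) → to ε (x ^ toℕ i V.* y ^ toℕ j) R.≈
    (if (toℕ i ≡ᵇ n ∸ 1) ∧ (toℕ j ≡ᵇ 2) then 3n else R.0#)
  -- The basis is indexed by a single number; `combine i j` is the index of xⁱyʲ.
  ε-monomial i j = ≡.subst (λ ij → to ε (uncurry monomial ij) R.≈ value ij)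
    (Fin.remQuot-combine i j) (extend-basis V-basis (λ l → value (remQuot {n} 3 l)) (combine i j))
    where
    value : Fin n × Fin 3 → R.Carrier
    value (i , j) = if (toℕ i ≡ᵇ n ∸ 1) ∧ (toℕ j ≡ᵇ 2) then 3n else R.0#

  basis-monomial : ∀ l → ∃₂ λ i j → Basis.basis V-basis l ≡ x ^ i V.* y ^ j
  basis-monomial l = toℕ (proj₁ (remQuot {n} 3 l)) , toℕ (proj₂ (remQuot {n} 3 l)) , ≡.refl

-- After cross-multiplication the claim reads (1 · N) · 1 = 1 · (N · 1).
reciprocal : (N : ℕ) .{{_ : NonZero N}} → let open Localization N using (localization; 1/N; fromℤ) in
  CommutativeRing._≈_ localization (CommutativeRing._*_ localization 1/N (fromℤ (+ N))) (fromℤ (+ 1))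
reciprocal N = Localization.cross (ℤ.*-assoc ℤ.1ℤ (+ N) ℤ.1ℤ)

lemma5p1p3 : (n : ℕ) .{{n≢0 : NonZero n}} → let open MöbiusV n {{n≢0}} in
    IsMöbiusFrobeniusAlgebra (Symmetric.braided RMod-symmetric) V μ η Δ ε m
lemma5p1p3 n {{n≢0}} = CasimirSums.isMöbiusFrobeniusAlgebra ℤ[1/3n] V
  {A._*_} {A.1#} A.isCommutativeRing T.x {y = T.y} {1/N} {3n} record
    { xⁿ≈0       = P.xⁿ≈0
    ; y³≈xy      = P.y³≈xy
    ; c*3n≈1     = reciprocal (3 ℕ.* n)
    ; monomials  = P.basis-monomial
    ; μ-⊗        = λ _ _ → A.refl
    ; η-scalar   = λ _ _ → A.refl
    ; Δ-sum      = λ _ → reflₜ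
    ; ε-monomial = P.ε-monomial
    ; m-crosscap = λ _ → A.refl
    }
  where
  open MöbiusV n {{n≢0}}
  open FreeModules ℤ[1/3n]
  instance
    3*n≢0 : NonZero (3 ℕ.* n)
    3*n≢0 = ℕ.m*n≢0 3 n {{_}} {{n≢0}}
  open Localization (3 ℕ.* n) using (fromℤ; 1/N)
  3n : CommutativeRing.Carrier ℤ[1/3n]
  3n = fromℤ (+ (3 ℕ.* n))
  module T = TruncatedAlgebra ℤ[1/3n] n 3n 1/N
  module P = TruncatedAlgebraProperties ℤ[1/3n] n 3n 1/N
  module A = CommutativeRing T.V-ring
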